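{- Let $q$ be a prime power and $n\geq 1$. Let $\xi_1,\dots,\xi_n$ be independent random variables, each uniformly distributed on the set of squares $\{\alpha^2 : \alpha\in\mathbb{F}_q\}\subseteq\mathbb{F}_q$, and let $P(x)=x^n+\xi_1x^{n-1}+\xi_2x^{n-2}+\dots+\xi_n\in\mathbb{F}_q[x]$. Then \[ \Pr\big[P(x)\text{ is irreducible over }\mathbb{F}_q\big]=\frac1n+O_n\big(q^{ -1/2}\big) \] as $q\to\infty$, where the implied constant depends only on $n$. -}

module Defs where

open import Level using (0ℓ)
open import Algebra.Bundles using (CommutativeRing)
open import Data.Nat using (ℕ; zero; suc)
open import Data.List using (List; []; _∷_; length; reverse; _++_; [_])
open import Data.List.Relation.Unary.Any using (Any)
open import Data.List.Relation.Unary.All using (All)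
open import Data.List.Relation.Unary.AllPairs using (AllPairs)
open import Data.Vec using (Vec; toList; last)
import Data.Vec.Relation.Unary.All as VAll
open import Data.Vec.Relation.Binary.Pointwise.Inductive using (Pointwise)
open import Data.Product using (Σ; ∃; ∃-syntax; _×_)
open import Data.Empty using (⊥)
open import Data.Unit using (⊤)
open import Relation.Nullary using (¬_)
open import Relation.Binary using (Decidable)
open import Function.Bundles using (_⇔_)

record FiniteField : Set₁ where
  field
    commRing : CommutativeRing 0ℓ 0ℓ
  open CommutativeRing commRing public
  field
    1≉0      : ¬ (1# ≈ 0#)
    inverse  : ∀ x → ¬ (x ≈ 0#) → ∃[ y ] (x * y ≈ 1#)
    _≟_      : Decidable _≈_
    elements : List Carrier
    complete : ∀ x → Any (x ≈_) elements
    distinct : AllPairs (λ a b → ¬ (a ≈ b)) elements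

  order : ℕ
  order = length elements

module Polynomials (F : FiniteField) where
  open FiniteField F

  -- Polynomials over F as coefficient lists [c₀, c₁, c₂, …] (c₀ = constant term).
  Poly : Set
  Poly = List Carrier

  scale : Carrier → Poly → Poly
  scale a []       = []
  scale a (b ∷ p)  = (a * b) ∷ scale a p

  _+ₚ_ : Poly → Poly → Poly
  []      +ₚ q       = q
  (a ∷ p) +ₚ []      = a ∷ p
  (a ∷ p) +ₚ (b ∷ q) = (a + b) ∷ (p +ₚ q)

  _*ₚ_ : Poly → Poly → Poly
  []      *ₚ q = []
  (a ∷ p) *ₚ q = scale a q +ₚ (0# ∷ (p *ₚ q))

  _≈ₚ_ : Poly → Poly → Set
  []      ≈ₚ []      = ⊤
  []      ≈ₚ (b ∷ q) = (b ≈ 0#) × ([] ≈ₚ q)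
  (a ∷ p) ≈ₚ []      = (a ≈ 0#) × (p ≈ₚ [])
  (a ∷ p) ≈ₚ (b ∷ q) = (a ≈ b) × (p ≈ₚ q)

  record NonconstPoly : Set where
    field
      deg-1  : ℕ
      coeffs : Vec Carrier (suc (suc deg-1))
      lead≉0 : ¬ (last coeffs ≈ 0#)
    poly : Poly
    poly = toList coeffs

  Nonconstant : Poly → Set
  Nonconstant []      = ⊥
  Nonconstant (_ ∷ p) = Any (λ c → ¬ (c ≈ 0#)) p

  -- Irreducible over F: nonconstant (i.e. nonzero and not a unit) and not a
  -- product of two nonconstant polynomials (the units of F[x] being the
  -- nonzero constants).
  Irreducible : Poly → Set
  Irreducible p = Nonconstant p ×
    ¬ (Σ NonconstPoly λ g → Σ NonconstPoly λ h →
         (NonconstPoly.poly g *ₚ NonconstPoly.poly h) ≈ₚ p)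

  IsSquare : Carrier → Set
  IsSquare x = ∃[ α ] (α * α ≈ x)

  -- P(x) = x^n + ξ₁ x^{n-1} + … + ξₙ for ξ = (ξ₁,…,ξₙ), as coefficient list
  -- [ξₙ, ξₙ₋₁, …, ξ₁, 1].
  charPoly : ∀ {n} → Vec Carrier n → Poly
  charPoly ξ = reverse (toList ξ) ++ [ 1# ]

  EnumSquares : List Carrier → Set
  EnumSquares S = AllPairs (λ a b → ¬ (a ≈ b)) S
                × (∀ x → Any (x ≈_) S ⇔ IsSquare x)

  EnumIrreducible : (n : ℕ) → List (Vec Carrier n) → Set
  EnumIrreducible n L = AllPairs (λ u v → ¬ Pointwise _≈_ u v) L
                      × (∀ (ξ : Vec Carrier n) → Any (Pointwise _≈_ ξ) L
                               ⇔ (VAll.All IsSquare ξ × Irreducible (charPoly ξ)))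

-- A squarefree monic f of degree n satisfies n = ∑ deg h over its monic irreducible divisors h, and all
-- but O(qⁿ⁻¹) monic f are squarefree. Writing f = g h and sorting by l = deg h, the theorem reduces to
-- the following for l < n: for every set of monic h of degree l, the products g h have only square
-- coefficients with the expected frequency, up to O(q^(-1/2)).
--
-- This needs no Weil bound. Let c be the coefficient of g next to the leading one. The first l + 1
-- coefficients of g h have the form hᵢ₋₁ (rᵢ + c) with rᵢ independent of c, and the later ones do not
-- involve c. Cauchy–Schwarz over h and the other coefficients of g leaves a second moment. Over
-- independent rᵢ it is computed from the correlation of the set of squares with its translates, that is,
-- from the number of points on a hyperbola. As the second moment is a sum of nonnegative terms, it is
-- enough that the map from h and the rest of g to (r₁, …, rₗ₊₁) has no fibre much larger than average:
-- given g, the numbers r₁, …, rₗ determine h by a linear recurrence, and rₗ₊₁ then imposes one nontrivial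
-- polynomial condition on g.

module Submission where

open import Level using (0ℓ)
open import Algebra.Bundles using (CommutativeRing)
open import Algebra.Structures using (IsCommutativeRing)
import Algebra.Properties.AbelianGroup
import Algebra.Properties.CommutativeSemigroup
import Algebra.Properties.Ring
import Algebra.Solver.Ring.NaturalCoefficients.Default
open import Data.Bool using (Bool; true; false)
import Data.Bool.Properties as Bool
open import Data.Empty using (⊥-elim)
open import Data.Fin as Fin using (Fin)
import Data.Fin.Properties as Fin
open import Data.List as List using (List; []; _∷_; _++_; length; map; cartesianProductWith)
open import Data.List.Membership.Propositional using (_∈_)
open import Data.List.Membership.Propositional.Properties using (∈-allFin)
import Data.List.Properties as List
open import Data.List.Relation.Unary.All as All using (All; []; _∷_)
open import Data.List.Relation.Unary.AllPairs as AllPairs using (AllPairs; []; _∷_)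
import Data.List.Relation.Unary.AllPairs.Properties as AllPairs
open import Data.List.Relation.Unary.Any as Any using (here; there)
import Data.List.Relation.Unary.Any.Properties as Any
open import Data.List.Relation.Unary.Unique.Propositional using (Unique)
import Data.List.Relation.Unary.Unique.Propositional.Properties as Unique
open import Data.Nat hiding (_≟_)
import Data.Nat as ℕ
open import Data.Nat.Properties hiding (_≟_)
open import Data.Nat.Tactic.RingSolver using (solve-∀)
open import Data.Product using (Σ; ∃-syntax; _×_; _,_; proj₁; proj₂)
open import Data.Sum using (_⊎_; inj₁; inj₂; [_,_]′)
open import Data.Unit using (tt)
open import Data.Vec as Vec using (Vec; []; _∷_; toList; last)
import Data.Vec.Properties as Vec
open import Data.Vec.Relation.Binary.Pointwise.Inductive using (Pointwise; []; _∷_)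
import Data.Vec.Relation.Unary.All as VAll
open import Function using (_∘_)
open import Function.Bundles using (Equivalence)
open import Relation.Binary using (DecidableEquality; IsEquivalence; tri<; tri≈; tri>)
open import Relation.Binary.PropositionalEquality
import Relation.Binary.PropositionalEquality.Properties as ≡
import Relation.Binary.Reasoning.Setoid
open import Relation.Nullary
open import Relation.Nullary.Decidable using (map′; _×-dec_)
open import Defs

open Algebra.Properties.CommutativeSemigroup +-commutativeSemigroup using () renaming (interchange to +-interchange)
open Algebra.Properties.CommutativeSemigroup *-commutativeSemigroup using () renaming (interchange to *-interchange; x∙yz≈y∙xz to *-swap)

-- The main terms of the degrees l < n are not evaluated one by one. The degree identity is used
-- twice: for f of degree n with square coefficients, and without weight in degree n - 1, where it
-- says that the sum of l π(l) q^(n-1-l) over l ≤ n - 1 is about (n - 1) q^(n-1). So the degrees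
-- below n account for (n - 1) sⁿ out of n sⁿ, with s the number of squares, and sⁿ is left for
-- degree n.
--
-- Whether hᵢ₋₁ (rᵢ + c) is a square depends on hᵢ₋₁ only through its square class. A label is
-- therefore a Boolean together with rᵢ. Letting the Boolean vary freely costs a constant, whereas a
-- free hᵢ₋₁ would cost a power of q.
--
-- The last ratio is not free. It is held fixed in the second moment, and the sum over its label
-- costs a factor 2 q. The count of g in a fibre, obtained by averaging over the multiples t g,
-- gains q back.
--
-- Everything is a natural number: probabilities are scaled by powers of q, errors are absolute
-- differences, and a saving of q^(-1/2) appears as a bound for the square of an error times q.

-- Finite sums of natural numbers and finite types.

module FiniteSums where

  private variable
    A B : Set
    P Q : Set

  ⟦_⟧ : Dec P → ℕ
  ⟦ yes _ ⟧ = 1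
  ⟦ no _ ⟧ = 0

  ⟦⟧-yes : (d : Dec P) → P → ⟦ d ⟧ ≡ 1
  ⟦⟧-yes (yes _) p = refl
  ⟦⟧-yes (no ¬p) p = ⊥-elim (¬p p)

  ⟦⟧-no : (d : Dec P) → ¬ P → ⟦ d ⟧ ≡ 0
  ⟦⟧-no (yes p) ¬p = ⊥-elim (¬p p)
  ⟦⟧-no (no _) ¬p = refl

  ⟦⟧-true : (d : Dec P) → ⟦ d ⟧ ≢ 0 → P
  ⟦⟧-true (yes p) _ = p
  ⟦⟧-true (no _) ne = ⊥-elim (ne refl)

  ⟦⟧-mono : (d : Dec P) (e : Dec Q) → (P → Q) → ⟦ d ⟧ ≤ ⟦ e ⟧
  ⟦⟧-mono (no _) e f = z≤n
  ⟦⟧-mono (yes p) e f = ≤-reflexive (sym (⟦⟧-yes e (f p)))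

  ⟦⟧-cong : (d : Dec P) (e : Dec Q) → (P → Q) → (Q → P) → ⟦ d ⟧ ≡ ⟦ e ⟧
  ⟦⟧-cong d e f g = ≤-antisym (⟦⟧-mono d e f) (⟦⟧-mono e d g)

  ⟦⟧≤1 : (d : Dec P) → ⟦ d ⟧ ≤ 1
  ⟦⟧≤1 (yes _) = ≤-refl
  ⟦⟧≤1 (no _) = z≤n

  ⟦⟧-× : (d : Dec P) (e : Dec Q) (f : Dec (P × Q)) → ⟦ f ⟧ ≡ ⟦ d ⟧ * ⟦ e ⟧
  ⟦⟧-× (no ¬p) e f = ⟦⟧-no f (¬p ∘ proj₁)
  ⟦⟧-× (yes p) (no ¬q) f = ⟦⟧-no f (¬q ∘ proj₂)
  ⟦⟧-× (yes p) (yes q) f = ⟦⟧-yes f (p , q)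

  ∑ : List A → (A → ℕ) → ℕ
  ∑ [] f = 0
  ∑ (x ∷ xs) f = f x + ∑ xs f

  ∑-cong : (xs : List A) {f g : A → ℕ} → (∀ x → f x ≡ g x) → ∑ xs f ≡ ∑ xs g
  ∑-cong [] e = refl
  ∑-cong (x ∷ xs) e = cong₂ _+_ (e x) (∑-cong xs e)

  ∑-mono : (xs : List A) {f g : A → ℕ} → (∀ x → f x ≤ g x) → ∑ xs f ≤ ∑ xs g
  ∑-mono [] e = z≤n
  ∑-mono (x ∷ xs) e = +-mono-≤ (e x) (∑-mono xs e)

  ∑-const : (xs : List A) (c : ℕ) → ∑ xs (λ _ → c) ≡ length xs * c
  ∑-const [] c = refl
  ∑-const (x ∷ xs) c = cong (c +_) (∑-const xs c)

  ∑-one : (xs : List A) → ∑ xs (λ _ → 1) ≡ length xs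
  ∑-one xs = trans (∑-const xs 1) (*-identityʳ _)

  ∑-zero : (xs : List A) → ∑ xs (λ _ → 0) ≡ 0
  ∑-zero xs = trans (∑-const xs 0) (*-zeroʳ (length xs))

  ∑-+ : (xs : List A) (f g : A → ℕ) → ∑ xs (λ x → f x + g x) ≡ ∑ xs f + ∑ xs g
  ∑-+ [] f g = refl
  ∑-+ (x ∷ xs) f g = trans (cong (f x + g x +_) (∑-+ xs f g)) (+-interchange (f x) (g x) _ _)

  ∑-*ˡ : (xs : List A) (c : ℕ) (f : A → ℕ) → ∑ xs (λ x → c * f x) ≡ c * ∑ xs f
  ∑-*ˡ [] c f = sym (*-zeroʳ c)
  ∑-*ˡ (x ∷ xs) c f = trans (cong (c * f x +_) (∑-*ˡ xs c f)) (sym (*-distribˡ-+ c (f x) _))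

  ∑-*ʳ : (xs : List A) (f : A → ℕ) (c : ℕ) → ∑ xs (λ x → f x * c) ≡ ∑ xs f * c
  ∑-*ʳ xs f c = trans (∑-cong xs (λ x → *-comm (f x) c)) (trans (∑-*ˡ xs c f) (*-comm c _))

  ∑-swap : (xs : List A) (ys : List B) (f : A → B → ℕ) →
           ∑ xs (λ x → ∑ ys (f x)) ≡ ∑ ys (λ y → ∑ xs (λ x → f x y))
  ∑-swap [] ys f = sym (∑-zero ys)
  ∑-swap (x ∷ xs) ys f = trans (cong (∑ ys (f x) +_) (∑-swap xs ys f)) (sym (∑-+ ys _ _))

  ∑-bound : (xs : List A) {f : A → ℕ} {c : ℕ} → (∀ x → f x ≤ c) → ∑ xs f ≤ length xs * c
  ∑-bound xs {c = c} e = ≤-trans (∑-mono xs e) (≤-reflexive (∑-const xs c))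

  ∑-++ : (xs ys : List A) (f : A → ℕ) → ∑ (xs ++ ys) f ≡ ∑ xs f + ∑ ys f
  ∑-++ [] ys f = refl
  ∑-++ (x ∷ xs) ys f = trans (cong (f x +_) (∑-++ xs ys f)) (sym (+-assoc (f x) _ _))

  ∑-map : (h : B → A) (xs : List B) (f : A → ℕ) → ∑ (map h xs) f ≡ ∑ xs (f ∘ h)
  ∑-map h [] f = refl
  ∑-map h (x ∷ xs) f = cong (f (h x) +_) (∑-map h xs f)

  ∑-cartesian : {C : Set} (h : A → B → C) (xs : List A) (ys : List B) (f : C → ℕ) →
                ∑ (cartesianProductWith h xs ys) f ≡ ∑ xs (λ x → ∑ ys (λ y → f (h x y)))
  ∑-cartesian h [] ys f = refl
  ∑-cartesian h (x ∷ xs) ys f = trans (∑-++ (map (h x) ys) _ f)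
    (cong₂ _+_ (∑-map (h x) ys f) (∑-cartesian h xs ys f))

  ∣-∣-+ : ∀ a b c d → ∣ a + c - b + d ∣ ≤ ∣ a - b ∣ + ∣ c - d ∣
  ∣-∣-+ a b c d = ≤-trans (∣-∣-triangle (a + c) (b + c) (b + d)) (+-mono-≤
    (≤-reflexive (trans (cong₂ ∣_-_∣ (+-comm a c) (+-comm b c)) (∣m+n-m+o∣≡∣n-o∣ c a b)))
    (≤-reflexive (∣m+n-m+o∣≡∣n-o∣ b c d)))

  ∑-∣-∣ : (xs : List A) (f g : A → ℕ) → ∣ ∑ xs f - ∑ xs g ∣ ≤ ∑ xs (λ x → ∣ f x - g x ∣)
  ∑-∣-∣ [] f g = z≤n
  ∑-∣-∣ (x ∷ xs) f g = ≤-trans (∣-∣-+ (f x) (g x) _ _) (+-monoʳ-≤ ∣ f x - g x ∣ (∑-∣-∣ xs f g))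

  ∣-∣-square : ∀ a b → ∣ a - b ∣ * ∣ a - b ∣ + 2 * (a * b) ≡ a * a + b * b
  ∣-∣-square zero b = +-identityʳ _
  ∣-∣-square (suc a) zero = cong (suc a * suc a +_) (trans (cong (2 *_) (*-zeroʳ a)) refl)
  ∣-∣-square (suc a) (suc b) = trans (lemma ∣ a - b ∣ a b) (trans (cong (λ z → z + 2 * (a + b) + 2) (∣-∣-square a b)) (lemma′ a b))
    where
    lemma : ∀ d a b → d * d + 2 * (suc a * suc b) ≡ d * d + 2 * (a * b) + 2 * (a + b) + 2
    lemma = solve-∀
    lemma′ : ∀ a b → a * a + b * b + 2 * (a + b) + 2 ≡ suc a * suc a + suc b * suc b
    lemma′ = solve-∀

  2*≤squares : ∀ a b → 2 * (a * b) ≤ a * a + b * b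
  2*≤squares a b = ≤-trans (m≤n+m (2 * (a * b)) (∣ a - b ∣ * ∣ a - b ∣)) (≤-reflexive (∣-∣-square a b))

  square-+ : ∀ a b → (a + b) * (a + b) ≤ 2 * (a * a + b * b)
  square-+ a b = begin
    (a + b) * (a + b) ≡⟨ expand a b ⟩
    a * a + b * b + 2 * (a * b) ≤⟨ +-monoʳ-≤ (a * a + b * b) (2*≤squares a b) ⟩
    a * a + b * b + (a * a + b * b) ≡⟨ cong (a * a + b * b +_) (+-identityʳ _) ⟨
    2 * (a * a + b * b) ∎
    where
    open ≤-Reasoning
    expand : ∀ a b → (a + b) * (a + b) ≡ a * a + b * b + 2 * (a * b)
    expand = solve-∀

  ∑-square : (xs : List A) (f : A → ℕ) →
             ∑ xs f * ∑ xs f ≡ ∑ xs (λ x → ∑ xs (λ y → f x * f y))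
  ∑-square xs f = sym (trans (∑-cong xs (λ x → ∑-*ˡ xs (f x) f)) (∑-*ʳ xs f (∑ xs f)))

  cauchy-schwarz : (xs : List A) (f : A → ℕ) →
                   ∑ xs f * ∑ xs f ≤ length xs * ∑ xs (λ x → f x * f x)
  cauchy-schwarz xs f = *-cancelˡ-≤ 2 (begin
    2 * (∑ xs f * ∑ xs f) ≡⟨ cong (2 *_) (∑-square xs f) ⟩
    2 * ∑ xs (λ x → ∑ xs (λ y → f x * f y)) ≡⟨ ∑-*ˡ xs 2 _ ⟨
    ∑ xs (λ x → 2 * ∑ xs (λ y → f x * f y)) ≤⟨ ∑-mono xs (λ x → ≤-trans (≤-reflexive (sym (∑-*ˡ xs 2 _)))
                                                                                (∑-mono xs (λ y → 2*≤squares (f x) (f y)))) ⟩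
    ∑ xs (λ x → ∑ xs (λ y → f x * f x + f y * f y)) ≡⟨ ∑-cong xs (λ x → trans (∑-+ xs _ _) (cong (_+ S) (∑-const xs _))) ⟩
    ∑ xs (λ x → length xs * (f x * f x) + S) ≡⟨ trans (∑-+ xs _ _) (cong₂ _+_ (∑-*ˡ xs (length xs) _) (∑-const xs S)) ⟩
    length xs * S + length xs * S ≡⟨ cong (length xs * S +_) (+-identityʳ _) ⟨
    2 * (length xs * S) ∎)
    where
    open ≤-Reasoning
    S = ∑ xs (λ x → f x * f x)

  -- Completeness and absence of repetitions are stated as a sum of indicators, so that `pick` and
  -- `reindex` follow by interchanging sums.
  record Finite (A : Set) : Set where
    infix 4 _≟_
    field
      elems : List A
      _≟_ : DecidableEquality A
      once : ∀ a → ∑ elems (λ x → ⟦ x ≟ a ⟧) ≡ 1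

    size : ℕ
    size = length elems

    pick : ∀ (f : A → ℕ) a → ∑ elems (λ x → ⟦ x ≟ a ⟧ * f x) ≡ f a
    pick f a = trans (∑-cong elems pointwise) (trans (∑-*ʳ elems _ (f a)) (trans (cong (_* f a) (once a)) (+-identityʳ _)))
      where
      pointwise : ∀ x → ⟦ x ≟ a ⟧ * f x ≡ ⟦ x ≟ a ⟧ * f a
      pointwise x with x ≟ a
      ... | yes refl = refl
      ... | no _ = refl

    term≤ : ∀ (f : A → ℕ) a → f a ≤ ∑ elems f
    term≤ f a = ≤-trans (≤-reflexive (sym (pick f a)))
      (∑-mono elems (λ x → ≤-trans (*-monoˡ-≤ (f x) (⟦⟧≤1 (x ≟ a))) (≤-reflexive (*-identityˡ _))))

    once′ : ∀ a → ∑ elems (λ x → ⟦ a ≟ x ⟧) ≡ 1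
    once′ a = trans (∑-cong elems (λ x → ⟦⟧-cong (a ≟ x) (x ≟ a) sym sym)) (once a)

    -- The differences `g x ∸ f x` are nonnegative with sum 0. This turns a comparison of totals
    -- into a pointwise identity, both for squares in characteristic 2 and for nonsquares.
    tight : ∀ {f g : A → ℕ} → (∀ x → f x ≤ g x) → ∑ elems g ≤ ∑ elems f → ∀ x → f x ≡ g x
    tight {f} {g} f≤g Σg≤Σf a = ≤-antisym (f≤g a)
      (m∸n≡0⇒m≤n (n≤0⇒n≡0 (≤-trans (term≤ (λ x → g x ∸ f x) a) (+-cancelˡ-≤ (∑ elems f) _ _ (begin
        ∑ elems f + ∑ elems (λ x → g x ∸ f x) ≡⟨ ∑-+ elems f _ ⟨
        ∑ elems (λ x → f x + (g x ∸ f x)) ≡⟨ ∑-cong elems (λ x → m+[n∸m]≡n (f≤g x)) ⟩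
        ∑ elems g ≤⟨ Σg≤Σf ⟩
        ∑ elems f ≡⟨ +-identityʳ _ ⟨
        ∑ elems f + 0 ∎)))))
      where open ≤-Reasoning

  open Finite using (elems; size)

  reindex : (FA : Finite A) (FB : Finite B) (σ : A → B) (τ : B → A) →
            (∀ a → τ (σ a) ≡ a) → (∀ b → σ (τ b) ≡ b) → (f : B → ℕ) →
            ∑ (elems FA) (λ a → f (σ a)) ≡ ∑ (elems FB) f
  reindex FA FB σ τ τσ στ f = begin
    ∑ as (λ a → f (σ a)) ≡⟨ ∑-cong as (λ a → Finite.pick FB f (σ a)) ⟨
    ∑ as (λ a → ∑ bs (λ b → ⟦ b B.≟ σ a ⟧ * f b)) ≡⟨ ∑-swap as bs _ ⟩
    ∑ bs (λ b → ∑ as (λ a → ⟦ b B.≟ σ a ⟧ * f b)) ≡⟨ ∑-cong bs (λ b → ∑-*ʳ as _ (f b)) ⟩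
    ∑ bs (λ b → ∑ as (λ a → ⟦ b B.≟ σ a ⟧) * f b) ≡⟨ ∑-cong bs (λ b → cong (_* f b) (trans (∑-cong as (λ a →
        ⟦⟧-cong (b B.≟ σ a) (a A.≟ τ b) (λ e → trans (sym (τσ a)) (cong τ (sym e))) (λ e → trans (sym (στ b)) (cong σ (sym e)))))
        (A.once (τ b)))) ⟩
    ∑ bs (λ b → 1 * f b) ≡⟨ ∑-cong bs (λ b → *-identityˡ _) ⟩
    ∑ bs f ∎
    where
    open ≡-Reasoning
    module A = Finite FA
    module B = Finite FB
    as = elems FA
    bs = elems FB

  ∷-injˡ : ∀ {n} {x y : A} {v w : Vec A n} → x ∷ v ≡ y ∷ w → x ≡ y
  ∷-injˡ refl = refl
  ∷-injʳ : ∀ {n} {x y : A} {v w : Vec A n} → x ∷ v ≡ y ∷ w → v ≡ w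
  ∷-injʳ refl = refl

  Vec-finite : Finite A → ∀ k → Finite (Vec A k)
  Vec-finite FA zero = record
    { elems = [] ∷ [] ; _≟_ = λ { [] [] → yes refl } ; once = λ { [] → refl } }
  Vec-finite {A} FA (suc k) = record
    { elems = cartesianProductWith _∷_ F.elems V.elems
    ; _≟_ = _≟_
    ; once = λ { (a ∷ v) → begin
        ∑ (cartesianProductWith _∷_ F.elems V.elems) (λ w → ⟦ w ≟ a ∷ v ⟧) ≡⟨ ∑-cartesian _∷_ F.elems V.elems _ ⟩
        ∑ F.elems (λ x → ∑ V.elems (λ w → ⟦ x ∷ w ≟ a ∷ v ⟧)) ≡⟨ ∑-cong F.elems (λ x → ∑-cong V.elems (λ w → split x a w v)) ⟩
        ∑ F.elems (λ x → ∑ V.elems (λ w → ⟦ x F.≟ a ⟧ * ⟦ w V.≟ v ⟧)) ≡⟨ ∑-cong F.elems (λ x → trans (∑-*ˡ V.elems ⟦ x F.≟ a ⟧ _)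
                                                                                           (trans (cong (⟦ x F.≟ a ⟧ *_) (V.once v)) (*-identityʳ _))) ⟩
        ∑ F.elems (λ x → ⟦ x F.≟ a ⟧) ≡⟨ F.once a ⟩
        1 ∎ }
    }
    where
    open ≡-Reasoning
    module F = Finite FA
    module V = Finite (Vec-finite FA k)
    infix 4 _≟_
    _≟_ : DecidableEquality (Vec A (suc k))
    (x ∷ v) ≟ (y ∷ w) with x F.≟ y | v V.≟ w
    ... | yes refl | yes refl = yes refl
    ... | no ne | _ = no (ne ∘ ∷-injˡ)
    ... | yes _ | no ne = no (ne ∘ ∷-injʳ)
    split : ∀ x y v w → ⟦ x ∷ v ≟ y ∷ w ⟧ ≡ ⟦ x F.≟ y ⟧ * ⟦ v V.≟ w ⟧
    split x y v w with x F.≟ y | v V.≟ w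
    ... | yes refl | yes refl = refl
    ... | no ne | _ = refl
    ... | yes refl | no ne = refl

  ×-finite : Finite A → Finite B → Finite (A × B)
  ×-finite {A} {B} FA FB = record
    { elems = cartesianProductWith _,_ F.elems G.elems
    ; _≟_ = _≟_
    ; once = λ { (a , b) → begin
        ∑ (cartesianProductWith _,_ F.elems G.elems) (λ w → ⟦ w ≟ (a , b) ⟧) ≡⟨ ∑-cartesian _,_ F.elems G.elems _ ⟩
        ∑ F.elems (λ x → ∑ G.elems (λ w → ⟦ (x , w) ≟ (a , b) ⟧)) ≡⟨ ∑-cong F.elems (λ x → ∑-cong G.elems (λ w → split x a w b)) ⟩
        ∑ F.elems (λ x → ∑ G.elems (λ w → ⟦ x F.≟ a ⟧ * ⟦ w G.≟ b ⟧)) ≡⟨ ∑-cong F.elems (λ x → trans (∑-*ˡ G.elems ⟦ x F.≟ a ⟧ _)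
                                                                                      (trans (cong (⟦ x F.≟ a ⟧ *_) (G.once b)) (*-identityʳ _))) ⟩
        ∑ F.elems (λ x → ⟦ x F.≟ a ⟧) ≡⟨ F.once a ⟩
        1 ∎ }
    }
    where
    open ≡-Reasoning
    module F = Finite FA
    module G = Finite FB
    infix 4 _≟_
    _≟_ : DecidableEquality (A × B)
    (x , v) ≟ (y , w) with x F.≟ y | v G.≟ w
    ... | yes refl | yes refl = yes refl
    ... | no ne | _ = no (ne ∘ cong proj₁)
    ... | yes _ | no ne = no (ne ∘ cong proj₂)
    split : ∀ x y v w → ⟦ (x , v) ≟ (y , w) ⟧ ≡ ⟦ x F.≟ y ⟧ * ⟦ v G.≟ w ⟧
    split x y v w with x F.≟ y | v G.≟ w
    ... | yes refl | yes refl = refl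
    ... | no ne | _ = refl
    ... | yes refl | no ne = refl

  ∑-∷ : (FA : Finite A) (k : ℕ) (f : Vec A (suc k) → ℕ) →
        ∑ (elems (Vec-finite FA (suc k))) f ≡ ∑ (elems FA) (λ x → ∑ (elems (Vec-finite FA k)) (λ v → f (x ∷ v)))
  ∑-∷ FA k f = ∑-cartesian _∷_ (elems FA) (elems (Vec-finite FA k)) f

  Vec-size : (FA : Finite A) (k : ℕ) → size (Vec-finite FA k) ≡ size FA ^ k
  Vec-size FA zero = refl
  Vec-size FA (suc k) = begin
    size (Vec-finite FA (suc k)) ≡⟨ ∑-one (elems (Vec-finite FA (suc k))) ⟨
    ∑ (elems (Vec-finite FA (suc k))) (λ _ → 1) ≡⟨ ∑-∷ FA k _ ⟩
    ∑ (elems FA) (λ x → ∑ (elems (Vec-finite FA k)) (λ v → 1)) ≡⟨ ∑-cong (elems FA) (λ _ → ∑-one (elems (Vec-finite FA k))) ⟩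
    ∑ (elems FA) (λ x → size (Vec-finite FA k)) ≡⟨ ∑-const (elems FA) _ ⟩
    size FA * size (Vec-finite FA k) ≡⟨ cong (size FA *_) (Vec-size FA k) ⟩
    size FA ^ suc k ∎
    where open ≡-Reasoning

  ×-size : (FA : Finite A) (FB : Finite B) → size (×-finite FA FB) ≡ size FA * size FB
  ×-size FA FB = begin
    size (×-finite FA FB) ≡⟨ ∑-one (elems (×-finite FA FB)) ⟨
    ∑ (elems (×-finite FA FB)) (λ _ → 1) ≡⟨ ∑-cartesian _,_ (elems FA) (elems FB) _ ⟩
    ∑ (elems FA) (λ x → ∑ (elems FB) (λ v → 1)) ≡⟨ ∑-cong (elems FA) (λ _ → ∑-one (elems FB)) ⟩
    ∑ (elems FA) (λ x → size FB) ≡⟨ ∑-const (elems FA) _ ⟩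
    size FA * size FB ∎
    where open ≡-Reasoning

open FiniteSums

-- Equality in `FiniteField` is a setoid relation. With propositional equality every function on the
-- field is well defined and sums can be reindexed freely; `Indexed` transfers the result back.
record DiscreteFiniteField : Set₁ where
  infixl 6 _⊕_
  infixl 7 _⊗_
  field
    Carrier : Set
    _⊕_ _⊗_ : Carrier → Carrier → Carrier
    ⊖_ : Carrier → Carrier
    0F 1F : Carrier
    isCommutativeRing : IsCommutativeRing _≡_ _⊕_ _⊗_ ⊖_ 0F 1F
    1≢0 : 1F ≢ 0F
    inverse : ∀ x → x ≢ 0F → ∃[ y ] x ⊗ y ≡ 1F
    finite : Finite Carrier

module _ {A : Set} (FA : Finite A) where
  open Finite FA

  ∃? : {P : A → Set} → (∀ x → Dec (P x)) → Dec (∃[ x ] P x)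
  ∃? {P} P? with ∑ elems (λ x → ⟦ P? x ⟧) in eq
  ... | zero = no λ { (x , p) → 1+n≰n (≤-trans (≤-reflexive (sym (⟦⟧-yes (P? x) p)))
                 (≤-trans (term≤ (λ y → ⟦ P? y ⟧) x) (≤-reflexive eq))) }
  ... | suc k = yes (search elems (λ e → 1+n≢0 (trans (sym eq) e)))
    where
    search : (xs : List A) → ∑ xs (λ x → ⟦ P? x ⟧) ≢ 0 → ∃[ x ] P x
    search [] ne = ⊥-elim (ne refl)
    search (x ∷ xs) ne with P? x
    ... | yes p = x , p
    ... | no _ = search xs ne

-- Squares in a finite field and their correlations.

module FieldTheory (𝔽 : DiscreteFiniteField) where
  open DiscreteFiniteField 𝔽 public
  open IsCommutativeRing isCommutativeRing public
    using () renaming (+-assoc to ⊕-assoc; +-comm to ⊕-comm; *-assoc to ⊗-assoc; *-comm to ⊗-comm;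
      +-identityˡ to ⊕-identityˡ; +-identityʳ to ⊕-identityʳ; *-identityˡ to ⊗-identityˡ; *-identityʳ to ⊗-identityʳ;
      -‿inverseˡ to ⊖-inverseˡ; -‿inverseʳ to ⊖-inverseʳ; zeroˡ to ⊗-zeroˡ; zeroʳ to ⊗-zeroʳ;
      distribˡ to ⊗-distribˡ; distribʳ to ⊗-distribʳ)
  open Finite finite public using (_≟_) renaming (elems to F; size to q)

  commutativeRing : CommutativeRing 0ℓ 0ℓ
  commutativeRing = record { isCommutativeRing = isCommutativeRing }

  module Solver = Algebra.Solver.Ring.NaturalCoefficients.Default (CommutativeRing.commutativeSemiring commutativeRing)
  open Solver using (solve; _:+_; _:*_; _:=_; con)

  ⊕-cancelʳ : ∀ x y z → y ⊕ x ≡ z ⊕ x → y ≡ z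
  ⊕-cancelʳ x y z e = begin
    y ≡⟨ ⊕-identityʳ y ⟨
    y ⊕ 0F ≡⟨ cong (y ⊕_) (⊖-inverseʳ x) ⟨
    y ⊕ (x ⊕ ⊖ x) ≡⟨ ⊕-assoc y x _ ⟨
    y ⊕ x ⊕ ⊖ x ≡⟨ cong (_⊕ ⊖ x) e ⟩
    z ⊕ x ⊕ ⊖ x ≡⟨ ⊕-assoc z x _ ⟩
    z ⊕ (x ⊕ ⊖ x) ≡⟨ cong (z ⊕_) (⊖-inverseʳ x) ⟩
    z ⊕ 0F ≡⟨ ⊕-identityʳ z ⟩
    z ∎
    where open ≡-Reasoning

  ⊕-⊖ : ∀ x a → (x ⊕ a) ⊕ ⊖ a ≡ x
  ⊕-⊖ x a = trans (⊕-assoc x a _) (trans (cong (x ⊕_) (⊖-inverseʳ a)) (⊕-identityʳ x))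

  ⊖-⊕ : ∀ x a → (x ⊕ ⊖ a) ⊕ a ≡ x
  ⊖-⊕ x a = trans (⊕-assoc x _ a) (trans (cong (x ⊕_) (⊖-inverseˡ a)) (⊕-identityʳ x))

  inv : ∀ {a} → a ≢ 0F → Carrier
  inv a≢0 = proj₁ (inverse _ a≢0)

  ⊗-inv : ∀ {a} (a≢0 : a ≢ 0F) → a ⊗ inv a≢0 ≡ 1F
  ⊗-inv a≢0 = proj₂ (inverse _ a≢0)

  inv-⊗-⊗ : ∀ {a} (a≢0 : a ≢ 0F) x → inv a≢0 ⊗ (a ⊗ x) ≡ x
  inv-⊗-⊗ {a} a≢0 x = trans (sym (⊗-assoc _ a x)) (trans (cong (_⊗ x) (trans (⊗-comm _ a) (⊗-inv a≢0))) (⊗-identityˡ x))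

  ⊗-inv-⊗ : ∀ {a} (a≢0 : a ≢ 0F) x → a ⊗ (inv a≢0 ⊗ x) ≡ x
  ⊗-inv-⊗ {a} a≢0 x = trans (sym (⊗-assoc a _ x)) (trans (cong (_⊗ x) (⊗-inv a≢0)) (⊗-identityˡ x))

  ⊗-cancelˡ : ∀ {a} → a ≢ 0F → ∀ {x y} → a ⊗ x ≡ a ⊗ y → x ≡ y
  ⊗-cancelˡ a≢0 e = trans (sym (inv-⊗-⊗ a≢0 _)) (trans (cong (inv a≢0 ⊗_) e) (inv-⊗-⊗ a≢0 _))

  ⊗≢0 : ∀ {a b} → a ≢ 0F → b ≢ 0F → a ⊗ b ≢ 0F
  ⊗≢0 {a} a≢0 b≢0 e = b≢0 (⊗-cancelˡ a≢0 (trans e (sym (⊗-zeroʳ a))))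

  ∑-translate : ∀ b (f : Carrier → ℕ) → ∑ F (λ x → f (x ⊕ b)) ≡ ∑ F f
  ∑-translate b = reindex finite finite (_⊕ b) (_⊕ ⊖ b) (λ x → ⊕-⊖ x b) (λ x → ⊖-⊕ x b)

  ∑-scale : ∀ {a} → a ≢ 0F → (f : Carrier → ℕ) → ∑ F (λ x → f (a ⊗ x)) ≡ ∑ F f
  ∑-scale {a} a≢0 = reindex finite finite (a ⊗_) (inv a≢0 ⊗_) (inv-⊗-⊗ a≢0) (⊗-inv-⊗ a≢0)

  ∑-affine : ∀ {a} → a ≢ 0F → ∀ b (f : Carrier → ℕ) → ∑ F (λ x → f (a ⊗ x ⊕ b)) ≡ ∑ F f
  ∑-affine a≢0 b f = trans (∑-scale a≢0 (λ y → f (y ⊕ b))) (∑-translate b f)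

  1≤q : 1 ≤ q
  1≤q = ≤-trans (Finite.term≤ finite (λ _ → 1) 0F) (≤-reflexive (∑-one F))

  IsSq : Carrier → Set
  IsSq x = ∃[ α ] α ⊗ α ≡ x

  isSq? : ∀ x → Dec (IsSq x)
  isSq? x = ∃? finite (λ α → α ⊗ α ≟ x)

  sq : Carrier → ℕ
  sq x = ⟦ isSq? x ⟧

  s : ℕ
  s = ∑ F sq

  sq≤1 : ∀ x → sq x ≤ 1
  sq≤1 x = ⟦⟧≤1 (isSq? x)

  s≤q : s ≤ q
  s≤q = ≤-trans (∑-mono F sq≤1) (≤-reflexive (∑-one F))

  sq-yes : ∀ {x} → IsSq x → sq x ≡ 1
  sq-yes {x} = ⟦⟧-yes (isSq? x)

  sq-0 : sq 0F ≡ 1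
  sq-0 = sq-yes (0F , ⊗-zeroˡ 0F)

  IsSq-⊗ : ∀ {x y} → IsSq x → IsSq y → IsSq (x ⊗ y)
  IsSq-⊗ (α , refl) (β , refl) = α ⊗ β , solve 2 (λ α β → (α :* β) :* (α :* β) := (α :* α) :* (β :* β)) refl α β

  IsSq-⊗⁻ : ∀ {x y} → x ≢ 0F → IsSq x → IsSq (x ⊗ y) → IsSq y
  IsSq-⊗⁻ {x} {y} x≢0 (α , refl) (β , e) = inv α≢0 ⊗ β , (begin
    (inv α≢0 ⊗ β) ⊗ (inv α≢0 ⊗ β) ≡⟨ solve 2 (λ α β → (α :* β) :* (α :* β) := (α :* α) :* (β :* β)) refl (inv α≢0) β ⟩
    (inv α≢0 ⊗ inv α≢0) ⊗ (β ⊗ β) ≡⟨ cong (inv α≢0 ⊗ inv α≢0 ⊗_) e ⟩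
    (inv α≢0 ⊗ inv α≢0) ⊗ (α ⊗ α ⊗ y) ≡⟨ solve 3 (λ i α y → (i :* i) :* (α :* α :* y) := i :* (α :* (i :* (α :* y)))) refl (inv α≢0) α y ⟩
    inv α≢0 ⊗ (α ⊗ (inv α≢0 ⊗ (α ⊗ y))) ≡⟨ inv-⊗-⊗ α≢0 _ ⟩
    inv α≢0 ⊗ (α ⊗ y) ≡⟨ inv-⊗-⊗ α≢0 y ⟩
    y ∎)
    where
    open ≡-Reasoning
    α≢0 : α ≢ 0F
    α≢0 e = x≢0 (trans (cong (_⊗ α) e) (⊗-zeroˡ α))

  sq-⊗ : ∀ {x} → x ≢ 0F → IsSq x → ∀ y → sq (x ⊗ y) ≡ sq y
  sq-⊗ {x} x≢0 sx y = ⟦⟧-cong (isSq? (x ⊗ y)) (isSq? y) (IsSq-⊗⁻ x≢0 sx) (IsSq-⊗ sx)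

  roots : Carrier → ℕ
  roots x = ∑ F (λ α → ⟦ α ⊗ α ≟ x ⟧)

  ∑-roots : ∑ F roots ≡ q
  ∑-roots = trans (∑-swap F F _) (trans (∑-cong F (λ α → Finite.once′ finite (α ⊗ α))) (∑-one F))

  ∑-δ : ∀ a (f : Carrier → ℕ) → ∑ F (λ x → ⟦ x ≟ a ⟧ * f x) ≡ f a
  ∑-δ a f = Finite.pick finite f a

  ⊕≡0 : ∀ {a b c} → a ⊕ b ≡ 0F → c ⊕ b ≡ 0F → a ≡ c
  ⊕≡0 {a} {b} {c} e f = ⊕-cancelʳ b a c (trans e (sym f))

  module EvenCharacteristic (2≡0 : 1F ⊕ 1F ≡ 0F) where

    x⊕x≡0 : ∀ x → x ⊕ x ≡ 0F
    x⊕x≡0 x = trans (solve 1 (λ x → x :+ x := (con 1 :+ con 1) :* x) refl x) (trans (cong (_⊗ x) 2≡0) (⊗-zeroˡ x))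

    -- In characteristic 2, (x + y)² = x² + y², which is 0 as soon as the two squares agree.
    square-injective : ∀ {x y} → x ⊗ x ≡ y ⊗ y → x ≡ y
    square-injective {x} {y} e with x ⊕ y ≟ 0F
    ... | yes z = ⊕≡0 z (x⊕x≡0 y)
    ... | no nz = ⊥-elim (⊗≢0 nz nz (begin
      (x ⊕ y) ⊗ (x ⊕ y) ≡⟨ solve 2 (λ x y → (x :+ y) :* (x :+ y) := (x :* x :+ y :* y) :+ (x :* y :+ x :* y)) refl x y ⟩
      (x ⊗ x ⊕ y ⊗ y) ⊕ (x ⊗ y ⊕ x ⊗ y) ≡⟨ cong₂ _⊕_ (cong (_⊕ y ⊗ y) e) (x⊕x≡0 _) ⟩
      (y ⊗ y ⊕ y ⊗ y) ⊕ 0F ≡⟨ trans (⊕-identityʳ _) (x⊕x≡0 _) ⟩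
      0F ∎))
      where open ≡-Reasoning

    roots≤sq : ∀ x → roots x ≤ sq x
    roots≤sq x with isSq? x
    ... | yes (β , refl) = ≤-trans (∑-mono F (λ α → ⟦⟧-mono (α ⊗ α ≟ β ⊗ β) (α ≟ β) square-injective)) (≤-reflexive (Finite.once finite β))
    ... | no ns = ≤-reflexive (trans (∑-cong F (λ α → ⟦⟧-no (α ⊗ α ≟ x) (λ e → ns (α , e)))) (∑-zero F))

    s≡q : s ≡ q
    s≡q = ≤-antisym s≤q (≤-trans (≤-reflexive (sym ∑-roots)) (∑-mono F roots≤sq))

    sq≡1 : ∀ x → sq x ≡ 1
    sq≡1 = Finite.tight finite sq≤1 (≤-reflexive (trans (∑-one F) (sym s≡q)))

  module OddCharacteristic (2≢0 : 1F ⊕ 1F ≢ 0F) where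

    double≢0 : ∀ {x} → x ≢ 0F → x ⊕ x ≢ 0F
    double≢0 {x} x≢0 e = ⊗≢0 2≢0 x≢0 (trans (solve 1 (λ x → (con 1 :+ con 1) :* x := x :+ x) refl x) e)

    roots-square : ∀ β → β ≢ 0F → roots (β ⊗ β) ≡ 2
    roots-square β β≢0 = trans (∑-cong F count) (trans (∑-+ F _ _) (cong₂ _+_ (Finite.once finite β) (Finite.once finite (⊖ β))))
      where
      -β≢β : β ≢ ⊖ β
      -β≢β e = double≢0 β≢0 (trans (cong (β ⊕_) e) (⊖-inverseʳ β))
      -β² : ⊖ β ⊗ ⊖ β ≡ β ⊗ β
      -β² = ⊕-cancelʳ (⊖ β ⊗ β) _ _ (begin
        ⊖ β ⊗ ⊖ β ⊕ ⊖ β ⊗ β ≡⟨ ⊗-distribˡ (⊖ β) (⊖ β) β ⟨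
        ⊖ β ⊗ (⊖ β ⊕ β) ≡⟨ trans (cong (⊖ β ⊗_) (⊖-inverseˡ β)) (⊗-zeroʳ _) ⟩
        0F ≡⟨ trans (cong (_⊗ β) (⊖-inverseʳ β)) (⊗-zeroˡ β) ⟨
        (β ⊕ ⊖ β) ⊗ β ≡⟨ ⊗-distribʳ β β (⊖ β) ⟩
        β ⊗ β ⊕ ⊖ β ⊗ β ∎)
        where open ≡-Reasoning
      factor : ∀ α → α ⊗ α ≡ β ⊗ β → α ≢ β → α ≡ ⊖ β
      factor α e ne with α ⊕ β ≟ 0F
      ... | yes z = ⊕≡0 z (⊖-inverseˡ β)
      ... | no nz = ⊥-elim (ne (⊗-cancelˡ nz (trans (solve 2 (λ α β → (α :+ β) :* α := α :* α :+ α :* β) refl α β)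
               (trans (cong (_⊕ α ⊗ β) e) (solve 2 (λ α β → β :* β :+ α :* β := (α :+ β) :* β) refl α β)))))
      count : ∀ α → ⟦ α ⊗ α ≟ β ⊗ β ⟧ ≡ ⟦ α ≟ β ⟧ + ⟦ α ≟ ⊖ β ⟧
      count α with α ≟ β | α ≟ ⊖ β
      ... | yes refl | yes e = ⊥-elim (-β≢β e)
      ... | yes refl | no _ = ⟦⟧-yes (β ⊗ β ≟ β ⊗ β) refl
      ... | no _ | yes refl = ⟦⟧-yes (⊖ β ⊗ ⊖ β ≟ β ⊗ β) -β²
      ... | no ne | no ne′ = ⟦⟧-no (α ⊗ α ≟ β ⊗ β) (λ e → ne′ (factor α e ne))

    roots-0 : roots 0F ≡ 1
    roots-0 = trans (∑-cong F (λ α → ⟦⟧-cong (α ⊗ α ≟ 0F) (α ≟ 0F) nilpotent (λ { refl → ⊗-zeroˡ 0F }))) (Finite.once finite 0F)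
      where
      nilpotent : ∀ {α} → α ⊗ α ≡ 0F → α ≡ 0F
      nilpotent {α} e with α ≟ 0F
      ... | yes z = z
      ... | no nz = ⊥-elim (⊗≢0 nz nz e)

    -- A nonzero square has two roots while 0 has one; the indicator of 0 corrects for that.
    2sq : ∀ x → 2 * sq x ≡ roots x + ⟦ x ≟ 0F ⟧
    2sq x with x ≟ 0F
    ... | yes refl = trans (cong (2 *_) sq-0) (cong (_+ 1) (sym roots-0))
    ... | no x≢0 with isSq? x
    ... | yes (β , refl) = sym (trans (+-identityʳ _) (roots-square β (λ { refl → x≢0 (⊗-zeroˡ 0F) })))
    ... | no ns = sym (trans (+-identityʳ _) (trans (∑-cong F (λ α → ⟦⟧-no (α ⊗ α ≟ x) (λ e → ns (α , e)))) (∑-zero F)))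

    2s : 2 * s ≡ q + 1
    2s = trans (sym (∑-*ˡ F 2 sq)) (trans (∑-cong F 2sq) (trans (∑-+ F _ _) (cong₂ _+_ ∑-roots (Finite.once finite 0F))))

    roots≤2 : ∀ x → roots x ≤ 2
    roots≤2 x = ≤-trans (m≤m+n _ _) (≤-trans (≤-reflexive (sym (2sq x))) (*-monoʳ-≤ 2 (sq≤1 x)))

    -- The hyperbola (β - α)(β + α) = d, parametrised by u = β - α.
    roots-correlation : ∀ d → d ≢ 0F → ∑ F (λ x → roots x * roots (x ⊕ d)) ≤ q
    roots-correlation d d≢0 = begin
      ∑ F (λ x → roots x * roots (x ⊕ d)) ≡⟨ ∑-cong F (λ x → ∑-*ʳ F _ (roots (x ⊕ d))) ⟨
      ∑ F (λ x → ∑ F (λ α → ⟦ α ⊗ α ≟ x ⟧ * roots (x ⊕ d))) ≡⟨ ∑-swap F F _ ⟩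
      ∑ F (λ α → ∑ F (λ x → ⟦ α ⊗ α ≟ x ⟧ * roots (x ⊕ d))) ≡⟨ ∑-cong F (λ α → trans (∑-cong F (λ x → cong (_* roots (x ⊕ d))
                                                                                   (⟦⟧-cong (α ⊗ α ≟ x) (x ≟ α ⊗ α) sym sym))) (∑-δ (α ⊗ α) _)) ⟩
      ∑ F (λ α → roots (α ⊗ α ⊕ d)) ≡⟨ ∑-cong F (λ α → ∑-translate α (λ β → ⟦ β ⊗ β ≟ α ⊗ α ⊕ d ⟧)) ⟨
      ∑ F (λ α → ∑ F (λ u → ⟦ (u ⊕ α) ⊗ (u ⊕ α) ≟ α ⊗ α ⊕ d ⟧)) ≡⟨ ∑-swap F F _ ⟩
      ∑ F (λ u → ∑ F (λ α → ⟦ (u ⊕ α) ⊗ (u ⊕ α) ≟ α ⊗ α ⊕ d ⟧)) ≤⟨ ∑-mono F per-u ⟩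
      ∑ F (λ u → 1) ≡⟨ ∑-one F ⟩
      q ∎
      where
      open ≤-Reasoning
      expand : ∀ u α → (u ⊕ α) ⊗ (u ⊕ α) ≡ ((u ⊕ u) ⊗ α ⊕ u ⊗ u) ⊕ α ⊗ α
      expand = solve 2 (λ u α → (u :+ α) :* (u :+ α) := ((u :+ u) :* α :+ u :* u) :+ α :* α) refl
      solves : ∀ u α → (u ⊕ α) ⊗ (u ⊕ α) ≡ α ⊗ α ⊕ d → (u ⊕ u) ⊗ α ⊕ u ⊗ u ≡ d
      solves u α e = ⊕-cancelʳ (α ⊗ α) _ _ (trans (sym (expand u α)) (trans e (⊕-comm _ d)))
      per-u : ∀ u → ∑ F (λ α → ⟦ (u ⊕ α) ⊗ (u ⊕ α) ≟ α ⊗ α ⊕ d ⟧) ≤ 1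
      per-u u with u ≟ 0F
      ... | yes refl = ≤-trans (≤-reflexive (trans (∑-cong F (λ α → ⟦⟧-no ((0F ⊕ α) ⊗ (0F ⊕ α) ≟ α ⊗ α ⊕ d) (λ e →
              d≢0 (sym (trans (solve 1 (λ α → con 0 := (con 0 :+ con 0) :* α :+ con 0 :* con 0) refl α) (solves 0F α e)))))) (∑-zero F))) z≤n
      ... | no u≢0 = ≤-trans (∑-mono F (λ α → ⟦⟧-mono ((u ⊕ α) ⊗ (u ⊕ α) ≟ α ⊗ α ⊕ d) ((u ⊕ u) ⊗ α ⊕ u ⊗ u ≟ d) (solves u α)))
              (≤-reflexive (trans (∑-affine (double≢0 u≢0) (u ⊗ u) (λ y → ⟦ y ≟ d ⟧)) (Finite.once finite d)))

    -- Expanding 4 `sq x` `sq (x ⊕ d)` by `2sq` gives the hyperbola count, at most q, and boundary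
    -- terms at x = 0 and x = -d of total at most 4. Then q (q + 4) ≤ (q + 1)² + 4 q, where q + 1 =
    -- 2 s.
    correlation-odd : ∀ d → d ≢ 0F → q * ∑ F (λ x → sq x * sq (x ⊕ d)) ≤ s * s + q
    correlation-odd d d≢0 = *-cancelˡ-≤ 4 (begin
      4 * (q * R) ≡⟨ arith₁ q R ⟩
      q * (4 * R) ≤⟨ *-monoʳ-≤ q 4R≤ ⟩
      q * (q + 4) ≤⟨ m≤m+n _ (2 * q + 1) ⟩
      q * (q + 4) + (2 * q + 1) ≡⟨ arith₂ q ⟩
      (q + 1) * (q + 1) + 4 * q ≡⟨ cong (λ z → z * z + 4 * q) 2s ⟨
      2 * s * (2 * s) + 4 * q ≡⟨ arith₃ s q ⟩
      4 * (s * s + q) ∎)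
      where
      open ≤-Reasoning
      R = ∑ F (λ x → sq x * sq (x ⊕ d))
      arith₁ : ∀ q r → 4 * (q * r) ≡ q * (4 * r)
      arith₁ = solve-∀
      arith₂ : ∀ q → q * (q + 4) + (2 * q + 1) ≡ (q + 1) * (q + 1) + 4 * q
      arith₂ = solve-∀
      arith₃ : ∀ s q → 2 * s * (2 * s) + 4 * q ≡ 4 * (s * s + q)
      arith₃ = solve-∀
      arith₄ : ∀ a b → 4 * (a * b) ≡ 2 * a * (2 * b)
      arith₄ = solve-∀
      arith₅ : ∀ a b c d → (a + b) * (c + d) ≡ a * c + b * (c + d) + d * a
      arith₅ = solve-∀
      pointwise : ∀ x → 4 * (sq x * sq (x ⊕ d)) ≤ roots x * roots (x ⊕ d) + ⟦ x ≟ 0F ⟧ * 2 + ⟦ x ⊕ d ≟ 0F ⟧ * 2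
      pointwise x = begin
        4 * (sq x * sq (x ⊕ d)) ≡⟨ arith₄ (sq x) _ ⟩
        2 * sq x * (2 * sq (x ⊕ d)) ≡⟨ cong₂ _*_ (2sq x) (2sq (x ⊕ d)) ⟩
        (roots x + ⟦ x ≟ 0F ⟧) * (roots (x ⊕ d) + ⟦ x ⊕ d ≟ 0F ⟧) ≡⟨ arith₅ (roots x) _ _ _ ⟩
        roots x * roots (x ⊕ d) + ⟦ x ≟ 0F ⟧ * (roots (x ⊕ d) + ⟦ x ⊕ d ≟ 0F ⟧) + ⟦ x ⊕ d ≟ 0F ⟧ * roots x
          ≤⟨ +-mono-≤ (+-monoʳ-≤ (roots x * roots (x ⊕ d)) (*-monoʳ-≤ ⟦ x ≟ 0F ⟧
               (≤-trans (≤-reflexive (sym (2sq (x ⊕ d)))) (*-monoʳ-≤ 2 (sq≤1 (x ⊕ d))))))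
               (*-monoʳ-≤ ⟦ x ⊕ d ≟ 0F ⟧ (roots≤2 x)) ⟩
        roots x * roots (x ⊕ d) + ⟦ x ≟ 0F ⟧ * 2 + ⟦ x ⊕ d ≟ 0F ⟧ * 2 ∎
      4R≤ : 4 * R ≤ q + 4
      4R≤ = begin
        4 * R ≡⟨ ∑-*ˡ F 4 _ ⟨
        ∑ F (λ x → 4 * (sq x * sq (x ⊕ d))) ≤⟨ ∑-mono F pointwise ⟩
        ∑ F (λ x → roots x * roots (x ⊕ d) + ⟦ x ≟ 0F ⟧ * 2 + ⟦ x ⊕ d ≟ 0F ⟧ * 2) ≡⟨ trans (∑-+ F _ _) (cong (_+ ∑ F (λ x → ⟦ x ⊕ d ≟ 0F ⟧ * 2)) (∑-+ F _ _)) ⟩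
        ∑ F (λ x → roots x * roots (x ⊕ d)) + ∑ F (λ x → ⟦ x ≟ 0F ⟧ * 2) + ∑ F (λ x → ⟦ x ⊕ d ≟ 0F ⟧ * 2)
          ≡⟨ cong₂ (λ a b → ∑ F (λ x → roots x * roots (x ⊕ d)) + a + b) (∑-δ 0F _)
               (trans (∑-translate d (λ y → ⟦ y ≟ 0F ⟧ * 2)) (∑-δ 0F _)) ⟩
        ∑ F (λ x → roots x * roots (x ⊕ d)) + 2 + 2 ≤⟨ +-monoˡ-≤ 2 (+-monoˡ-≤ 2 (roots-correlation d d≢0)) ⟩
        q + 2 + 2 ≡⟨ +-assoc q 2 2 ⟩
        q + 4 ∎

    -- Squares and their translate by a non-square cover everything, by counting.
    nonsquare-complement : ∀ {a} → ¬ IsSq a → ∀ x → sq x + sq (a ⊗ x) ≡ 1 + ⟦ x ≟ 0F ⟧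
    nonsquare-complement {a} na = Finite.tight finite atMost (≤-reflexive (begin
      ∑ F (λ x → 1 + ⟦ x ≟ 0F ⟧) ≡⟨ trans (∑-+ F _ _) (cong₂ _+_ (∑-one F) (Finite.once finite 0F)) ⟩
      q + 1 ≡⟨ 2s ⟨
      2 * s ≡⟨ cong (s +_) (+-identityʳ s) ⟩
      s + s ≡⟨ cong (s +_) (∑-scale a≢0 sq) ⟨
      s + ∑ F (λ x → sq (a ⊗ x)) ≡⟨ ∑-+ F _ _ ⟨
      ∑ F (λ x → sq x + sq (a ⊗ x)) ∎))
      where
      open ≡-Reasoning
      a≢0 : a ≢ 0F
      a≢0 refl = na (0F , ⊗-zeroˡ 0F)
      atMost : ∀ x → sq x + sq (a ⊗ x) ≤ 1 + ⟦ x ≟ 0F ⟧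
      atMost x with x ≟ 0F
      ... | yes refl = +-mono-≤ (sq≤1 0F) (sq≤1 _)
      ... | no x≢0 with isSq? x
      ... | no _ = sq≤1 _
      ... | yes sx = ≤-reflexive (cong suc (⟦⟧-no (isSq? (a ⊗ x)) (λ sax →
                na (IsSq-⊗⁻ x≢0 sx (subst IsSq (⊗-comm a x) sax)))))

  even? : Dec (1F ⊕ 1F ≡ 0F)
  even? = 1F ⊕ 1F ≟ 0F

  q≤2s : q ≤ 2 * s
  q≤2s with even?
  ... | yes e = ≤-trans (≤-reflexive (sym (EvenCharacteristic.s≡q e))) (m≤m+n s _)
  ... | no o = ≤-trans (m≤m+n q 1) (≤-reflexive (sym (OddCharacteristic.2s o)))

  correlation : ∀ d → d ≢ 0F → q * ∑ F (λ x → sq x * sq (x ⊕ d)) ≤ s * s + q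
  correlation d d≢0 with even?
  ... | no o = OddCharacteristic.correlation-odd o d d≢0
  ... | yes e = begin
    q * ∑ F (λ x → sq x * sq (x ⊕ d)) ≤⟨ *-monoʳ-≤ q (∑-mono F (λ x → *-mono-≤ (sq≤1 x) (sq≤1 _))) ⟩
    q * ∑ F (λ x → 1) ≡⟨ cong (q *_) (∑-one F) ⟩
    q * q ≡⟨ cong₂ _*_ (EvenCharacteristic.s≡q e) (EvenCharacteristic.s≡q e) ⟨
    s * s ≤⟨ m≤m+n _ q ⟩
    s * s + q ∎
    where open ≤-Reasoning

  -- By `nonsquare-complement`, `sq (a ⊗ x)` is the same function of `x` for every nonsquare `a`, so
  -- any nonsquare serves as `ν`. If there is none, the property is vacuous and 1 serves.
  ν-spec : ∃[ ν ] ν ≢ 0F × (∀ {a} → ¬ IsSq a → ∀ x → sq (a ⊗ x) ≡ sq (ν ⊗ x))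
  ν-spec with ∃? finite (λ a → ¬? (isSq? a))
  ... | no none = 1F , 1≢0 , λ {a} na → ⊥-elim (none (a , na))
  ... | yes (ν , nν) = ν , (λ { refl → nν (0F , ⊗-zeroˡ 0F) }) , λ {a} na x →
      +-cancelˡ-≡ (sq x) _ _ (trans (OddCharacteristic.nonsquare-complement o na x) (sym (OddCharacteristic.nonsquare-complement o nν x)))
    where
    o : 1F ⊕ 1F ≢ 0F
    o e = nν (⟦⟧-true (isSq? ν) (λ z → 1+n≢0 (trans (sym (EvenCharacteristic.sq≡1 e ν)) z)))

  -- Representatives of 𝔽ˣ modulo squares; they coincide in characteristic 2.
  class : Bool → Carrier
  class false = 1F
  class true = proj₁ ν-spec

  class≢0 : ∀ b → class b ≢ 0F
  class≢0 false = 1≢0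
  class≢0 true = proj₁ (proj₂ ν-spec)

  -- This allows a label to remember one bit of a coefficient in place of the coefficient itself.
  classify : ∀ {a} → a ≢ 0F → ∃[ b ] (∀ x → sq (a ⊗ x) ≡ sq (class b ⊗ x))
  classify {a} a≢0 with isSq? a
  ... | yes sa = false , λ x → trans (sq-⊗ a≢0 sa x) (cong sq (sym (⊗-identityˡ x)))
  ... | no na = true , proj₂ (proj₂ ν-spec) na

Bool-finite : Finite Bool
Bool-finite = record
  { elems = false ∷ true ∷ [] ; _≟_ = Bool._≟_ ; once = λ { false → refl ; true → refl } }

*-^ : ∀ a b k → (a * b) ^ k ≡ a ^ k * b ^ k
*-^ a b zero = refl
*-^ a b (suc k) = trans (cong (a * b *_) (*-^ a b k)) (*-interchange a b (a ^ k) (b ^ k))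

-- This is 2^k - 1, in the recursive form that the induction of `perturbed-power` produces.
excess : ℕ → ℕ
excess zero = 0
excess (suc k) = 1 + 2 * excess k

-- In the application S is s². With Q = q², one more factor S + q adds at most q Q^(k+1) and
-- multiplies the old error by S + q ≤ 2 Q, hence the recursion 1 + 2 e. The spare factor S is
-- contributed by the label that is held fixed.
perturbed-power : ∀ {S q} k → S ≤ q * q → 1 ≤ q →
                  (S + q) ^ k * S ≤ S ^ k * S + excess k * (q * (q * q) ^ k)
perturbed-power {S} {q} zero S≤Q 1≤q = m≤m+n _ _
perturbed-power {S} {q} (suc k) S≤Q 1≤q = begin
  (S + q) * (S + q) ^ k * S ≡⟨ *-assoc (S + q) _ S ⟩
  (S + q) * ((S + q) ^ k * S) ≤⟨ *-monoʳ-≤ (S + q) (perturbed-power k S≤Q 1≤q) ⟩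
  (S + q) * (S ^ k * S + e * W) ≡⟨ expand S q (S ^ k) e W ⟩
  S * S ^ k * S + q * (S ^ k * S) + (S + q) * (e * W)
    ≤⟨ +-mono-≤ (+-monoʳ-≤ (S * S ^ k * S) (*-monoʳ-≤ q (*-mono-≤ (^-monoˡ-≤ k S≤Q) S≤Q)))
                (*-monoˡ-≤ (e * W) (+-mono-≤ S≤Q (≤-trans (≤-reflexive (sym (*-identityʳ q))) (*-monoʳ-≤ q 1≤q)))) ⟩
  S * S ^ k * S + q * (Q ^ k * Q) + (Q + Q) * (e * W) ≡⟨ collect (S * S ^ k * S) q Q (Q ^ k) e ⟩
  S * S ^ k * S + (1 + 2 * e) * (q * (Q * Q ^ k)) ∎
  where
  open ≤-Reasoning
  Q = q * q
  W = q * Q ^ k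
  e = excess k
  expand : ∀ S q x e W → (S + q) * (x * S + e * W) ≡ S * x * S + q * (x * S) + (S + q) * (e * W)
  expand = solve-∀
  collect : ∀ z q Q x e → z + q * (x * Q) + (Q + Q) * (e * (q * x)) ≡ z + (1 + 2 * e) * (q * (Q * x))
  collect = solve-∀

-- First and second moments over independent labels.

module SecondMoment (𝔽 : DiscreteFiniteField) where
  open FieldTheory 𝔽

  Label : Set
  Label = Bool × Carrier

  Label-finite : Finite Label
  Label-finite = ×-finite Bool-finite finite

  Label-list : List Label
  Label-list = Finite.elems Label-finite

  labels : ∀ k → List (Vec Label k)
  labels k = Finite.elems (Vec-finite Label-finite k)

  -- The indicator that h (r + c) is a square, for any h in the square class `b`.
  u : Label → Carrier → ℕ
  u (b , r) c = sq (class b ⊗ (r ⊕ c))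

  U : ∀ {k} → Vec Label k → Carrier → ℕ
  U [] c = 1
  U (a ∷ z) c = u a c * U z c

  U≤1 : ∀ {k} (z : Vec Label k) c → U z c ≤ 1
  U≤1 [] c = ≤-refl
  U≤1 ((b , r) ∷ z) c = *-mono-≤ (sq≤1 (class b ⊗ (r ⊕ c))) (U≤1 z c)

  ∑-Label : (f : Label → ℕ) → ∑ Label-list f ≡ ∑ F (λ r → f (false , r)) + ∑ F (λ r → f (true , r))
  ∑-Label f = trans (∑-cartesian _,_ (Finite.elems Bool-finite) F f) (cong (∑ F (λ r → f (false , r)) +_) (+-identityʳ _))

  labels-size : ∀ k → length (labels k) ≡ (2 * q) ^ k
  labels-size k = trans (Vec-size Label-finite k) (cong (_^ k) (×-size Bool-finite finite))

  ∑-sq-label : ∀ b c → ∑ F (λ r → u (b , r) c) ≡ s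
  ∑-sq-label b c = trans (∑-translate c (λ x → sq (class b ⊗ x))) (∑-scale (class≢0 b) sq)

  first-moment₁ : ∀ c → ∑ Label-list (λ a → u a c) ≡ 2 * s
  first-moment₁ c = trans (∑-Label _) (trans (cong₂ _+_ (∑-sq-label false c) (∑-sq-label true c)) (cong (s +_) (sym (+-identityʳ s))))

  -- In terms of x = e (r + c) the other argument is x + e (d - c), a translate by a nonzero amount.
  correlation-label : ∀ b {c d} → c ≢ d → q * ∑ F (λ r → u (b , r) c * u (b , r) d) ≤ s * s + q
  correlation-label b {c} {d} c≢d = ≤-trans (≤-reflexive (cong (q *_) (begin
    ∑ F (λ r → sq (e ⊗ (r ⊕ c)) * sq (e ⊗ (r ⊕ d))) ≡⟨ ∑-cong F (λ r → cong (λ z → sq (e ⊗ (r ⊕ c)) * sq z) (shift r)) ⟩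
    ∑ F (λ r → sq (e ⊗ (r ⊕ c)) * sq (e ⊗ (r ⊕ c) ⊕ δ)) ≡⟨ ∑-translate c (λ x → sq (e ⊗ x) * sq (e ⊗ x ⊕ δ)) ⟩
    ∑ F (λ x → sq (e ⊗ x) * sq (e ⊗ x ⊕ δ)) ≡⟨ ∑-scale (class≢0 b) (λ x → sq x * sq (x ⊕ δ)) ⟩
    ∑ F (λ x → sq x * sq (x ⊕ δ)) ∎)))
    (correlation δ (⊗≢0 (class≢0 b) (λ z → c≢d (sym (⊕≡0 z (⊖-inverseʳ c))))))
    where
    open ≡-Reasoning
    e = class b
    δ = e ⊗ (d ⊕ ⊖ c)
    shift : ∀ r → e ⊗ (r ⊕ d) ≡ e ⊗ (r ⊕ c) ⊕ δ
    shift r = trans (cong (e ⊗_) (begin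
      r ⊕ d ≡⟨ cong (r ⊕_) (⊖-⊕ d c) ⟨
      r ⊕ ((d ⊕ ⊖ c) ⊕ c) ≡⟨ cong (r ⊕_) (⊕-comm _ c) ⟩
      r ⊕ (c ⊕ (d ⊕ ⊖ c)) ≡⟨ ⊕-assoc r c _ ⟨
      (r ⊕ c) ⊕ (d ⊕ ⊖ c) ∎)) (⊗-distribˡ e _ _)

  second-moment₁ : ∀ {c d} → c ≢ d → q * ∑ Label-list (λ a → u a c * u a d) ≤ 2 * (s * s + q)
  second-moment₁ {c} {d} c≢d = begin
    q * ∑ Label-list (λ a → u a c * u a d) ≡⟨ cong (q *_) (∑-Label _) ⟩
    q * (∑ F (λ r → u (false , r) c * u (false , r) d) + ∑ F (λ r → u (true , r) c * u (true , r) d))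
      ≡⟨ *-distribˡ-+ q _ _ ⟩
    q * ∑ F (λ r → u (false , r) c * u (false , r) d) + q * ∑ F (λ r → u (true , r) c * u (true , r) d)
      ≤⟨ +-mono-≤ (correlation-label false c≢d) (correlation-label true c≢d) ⟩
    (s * s + q) + (s * s + q) ≡⟨ cong (s * s + q +_) (+-identityʳ _) ⟨
    2 * (s * s + q) ∎
    where open ≤-Reasoning

  first-moment : ∀ k c → ∑ (labels k) (λ z → U z c) ≡ (2 * s) ^ k
  first-moment zero c = refl
  first-moment (suc k) c = begin
    ∑ (labels (suc k)) (λ z → U z c) ≡⟨ ∑-∷ Label-finite k _ ⟩
    ∑ Label-list (λ a → ∑ (labels k) (λ z → u a c * U z c)) ≡⟨ ∑-cong Label-list (λ a → ∑-*ˡ (labels k) (u a c) _) ⟩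
    ∑ Label-list (λ a → u a c * ∑ (labels k) (λ z → U z c)) ≡⟨ ∑-*ʳ Label-list (λ a → u a c) _ ⟩
    ∑ Label-list (λ a → u a c) * ∑ (labels k) (λ z → U z c) ≡⟨ cong₂ _*_ (first-moment₁ c) (first-moment k c) ⟩
    (2 * s) ^ suc k ∎
    where open ≡-Reasoning

  -- Both factors split over the independent coordinates of `z`, so the bound for one label is
  -- raised to the power k.
  second-moment : ∀ k {c d} → c ≢ d → q ^ k * ∑ (labels k) (λ z → U z c * U z d) ≤ (2 * (s * s + q)) ^ k
  second-moment zero c≢d = ≤-refl
  second-moment (suc k) {c} {d} c≢d = begin
    q * q ^ k * ∑ (labels (suc k)) (λ z → U z c * U z d) ≡⟨ cong (q * q ^ k *_) (begin-equality
      ∑ (labels (suc k)) (λ z → U z c * U z d) ≡⟨ ∑-∷ Label-finite k _ ⟩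
      ∑ as (λ a → ∑ (labels k) (λ z → u a c * U z c * (u a d * U z d))) ≡⟨ ∑-cong as (λ a → trans
          (∑-cong (labels k) (λ z → *-interchange (u a c) (U z c) (u a d) (U z d))) (∑-*ˡ (labels k) (u a c * u a d) _)) ⟩
      ∑ as (λ a → u a c * u a d * ∑ (labels k) (λ z → U z c * U z d)) ≡⟨ ∑-*ʳ as _ _ ⟩
      ∑ as (λ a → u a c * u a d) * ∑ (labels k) (λ z → U z c * U z d) ∎) ⟩
    q * q ^ k * (∑ as (λ a → u a c * u a d) * ∑ (labels k) (λ z → U z c * U z d)) ≡⟨ *-interchange q (q ^ k) _ _ ⟩
    q * ∑ as (λ a → u a c * u a d) * (q ^ k * ∑ (labels k) (λ z → U z c * U z d)) ≤⟨ *-mono-≤ (second-moment₁ c≢d) (second-moment k c≢d) ⟩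
    (2 * (s * s + q)) ^ suc k ∎
    where
    open ≤-Reasoning
    as = Label-list

  -- `v` is the factor of one more label, which is not averaged: in the application the closing
  -- condition ties it to the others. The mean of `X` is M = s^(k+1), with s from `v` and s^k from
  -- the k averaged labels.
  module _ (v : Carrier → ℕ) (v≤1 : ∀ c → v c ≤ 1) (∑v : ∑ F v ≡ s) (k : ℕ) where

    private
      zs = labels k
      M = s ^ suc k

    X : Vec Label k → ℕ
    X z = q ^ k * ∑ F (λ c → v c * U z c)

    ∑X : ∑ zs X ≡ (2 * q) ^ k * M
    ∑X = begin
      ∑ zs X ≡⟨ ∑-*ˡ zs (q ^ k) _ ⟩
      q ^ k * ∑ zs (λ z → ∑ F (λ c → v c * U z c)) ≡⟨ cong (q ^ k *_) (∑-swap zs F _) ⟩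
      q ^ k * ∑ F (λ c → ∑ zs (λ z → v c * U z c)) ≡⟨ cong (q ^ k *_) (∑-cong F (λ c → trans (∑-*ˡ zs (v c) _) (cong (v c *_) (first-moment k c)))) ⟩
      q ^ k * ∑ F (λ c → v c * (2 * s) ^ k) ≡⟨ cong (q ^ k *_) (trans (∑-*ʳ F v _) (cong (_* (2 * s) ^ k) ∑v)) ⟩
      q ^ k * (s * (2 * s) ^ k) ≡⟨ cong (λ t → q ^ k * (s * t)) (*-^ 2 s k) ⟩
      q ^ k * (s * (2 ^ k * s ^ k)) ≡⟨ shuffle (q ^ k) s (2 ^ k) (s ^ k) ⟩
      2 ^ k * q ^ k * (s * s ^ k) ≡⟨ cong (_* M) (*-^ 2 q k) ⟨
      (2 * q) ^ k * M ∎
      where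
      open ≡-Reasoning
      shuffle : ∀ a b c d → a * (b * (c * d)) ≡ c * a * (b * d)
      shuffle = solve-∀

    -- The square is a double sum over c and d. Pairs c ≠ d decorrelate up to (s² + q)^k in place of
    -- s^(2k), and the q pairs c = d are few enough for the trivial bound.
    ∑X² : ∑ zs (λ z → X z * X z) ≤ (2 * q) ^ k * (M * M + (excess k + 1) * (q * (q * q) ^ k))
    ∑X² = begin
      ∑ zs (λ z → X z * X z)
        ≡⟨ ∑-cong zs (λ z → trans (square (q ^ k) (∑ F (λ c → v c * U z c))) (cong (q ^ k * q ^ k *_)
             (trans (∑-square F _) (∑-cong F (λ c → ∑-cong F (λ d → *-interchange (v c) (U z c) (v d) (U z d))))))) ⟩
      ∑ zs (λ z → q ^ k * q ^ k * ∑ F (λ c → ∑ F (λ d → v c * v d * (U z c * U z d))))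
        ≡⟨ ∑-*ˡ zs (q ^ k * q ^ k) _ ⟩
      q ^ k * q ^ k * ∑ zs (λ z → ∑ F (λ c → ∑ F (λ d → v c * v d * (U z c * U z d))))
        ≡⟨ cong (q ^ k * q ^ k *_) (trans (∑-swap zs F _) (∑-cong F (λ c → trans (∑-swap zs F _) (∑-cong F (λ d → ∑-*ˡ zs (v c * v d) _))))) ⟩
      q ^ k * q ^ k * ∑ F (λ c → ∑ F (λ d → v c * v d * P c d))
        ≡⟨ *-assoc (q ^ k) (q ^ k) _ ⟩
      q ^ k * (q ^ k * ∑ F (λ c → ∑ F (λ d → v c * v d * P c d)))
        ≡⟨ cong (q ^ k *_) (trans (sym (∑-*ˡ F (q ^ k) _)) (∑-cong F (λ c → trans (sym (∑-*ˡ F (q ^ k) _)) (∑-cong F (λ d → *-swap (q ^ k) (v c * v d) (P c d)))))) ⟩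
      q ^ k * ∑ F (λ c → ∑ F (λ d → v c * v d * (q ^ k * P c d)))
        ≤⟨ *-monoʳ-≤ (q ^ k) (∑-mono F (λ c → ∑-mono F (λ d → pair c d))) ⟩
      q ^ k * ∑ F (λ c → ∑ F (λ d → v c * v d * D + ⟦ d ≟ c ⟧ * (q ^ k * (2 * q) ^ k)))
        ≡⟨ cong (q ^ k *_) (trans (∑-cong F (λ c → trans (∑-+ F _ _) (cong₂ _+_ (trans (∑-*ʳ F _ D) (cong (_* D) (trans (∑-*ˡ F (v c) v) (cong (v c *_) ∑v))))
              (∑-δ c _)))) (trans (∑-+ F _ _) (cong₂ _+_ (trans (∑-*ʳ F _ D) (cong (_* D) (trans (∑-*ʳ F v s) (cong (_* s) ∑v)))) (∑-const F _)))) ⟩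
      q ^ k * (s * s * D + q * (q ^ k * (2 * q) ^ k))
        ≡⟨ cong₂ (λ a b → q ^ k * (s * s * a + q * (q ^ k * b))) (*-^ 2 _ k) (*-^ 2 q k) ⟩
      q ^ k * (s * s * (2 ^ k * (s * s + q) ^ k) + q * (q ^ k * (2 ^ k * q ^ k)))
        ≡⟨ arith (q ^ k) (s * s) (2 ^ k) ((s * s + q) ^ k) q ⟩
      2 ^ k * q ^ k * ((s * s + q) ^ k * (s * s) + q * (q ^ k * q ^ k))
        ≤⟨ *-monoʳ-≤ (2 ^ k * q ^ k) (+-monoˡ-≤ (q * (q ^ k * q ^ k)) (perturbed-power k (*-mono-≤ s≤q s≤q) 1≤q)) ⟩
      2 ^ k * q ^ k * ((s * s) ^ k * (s * s) + excess k * (q * (q * q) ^ k) + q * (q ^ k * q ^ k))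
        ≡⟨ cong₂ _*_ (sym (*-^ 2 q k)) (trans (cong₂ (λ a b → a * (s * s) + excess k * (q * (q * q) ^ k) + q * b) (*-^ s s k) (sym (*-^ q q k)))
              (arith₂ s (s ^ k) (excess k) (q * (q * q) ^ k))) ⟩
      (2 * q) ^ k * (M * M + (excess k + 1) * (q * (q * q) ^ k)) ∎
      where
      open ≤-Reasoning
      D = (2 * (s * s + q)) ^ k
      P : Carrier → Carrier → ℕ
      P c d = ∑ zs (λ z → U z c * U z d)
      square : ∀ a b → a * b * (a * b) ≡ a * a * (b * b)
      square = solve-∀
      arith : ∀ x S t y q → x * (S * (t * y) + q * (x * (t * x))) ≡ t * x * (y * S + q * (x * x))
      arith = solve-∀
      arith₂ : ∀ s x e w → x * x * (s * s) + e * w + w ≡ s * x * (s * x) + (e + 1) * w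
      arith₂ = solve-∀
      pair : ∀ c d → v c * v d * (q ^ k * P c d) ≤ v c * v d * D + ⟦ d ≟ c ⟧ * (q ^ k * (2 * q) ^ k)
      pair c d with d ≟ c
      ... | no ne = ≤-trans (*-monoʳ-≤ (v c * v d) (second-moment k (λ e → ne (sym e)))) (m≤m+n _ _)
      ... | yes refl = ≤-trans (*-mono-≤ (*-mono-≤ (v≤1 d) (v≤1 d)) (*-monoʳ-≤ (q ^ k)
              (≤-trans (∑-bound zs (λ z → *-mono-≤ (U≤1 z d) (U≤1 z d))) (≤-reflexive (trans (*-identityʳ _) (labels-size k))))))
              (m≤n+m _ (v d * v d * D))

    -- The cross term 2 `X z` M is added to both sides to avoid subtraction. Its sum is known
    -- exactly from `∑X`, so the terms M² cancel. The bound beats the trivial one by a factor of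
    -- order q.
    variance : ∑ zs (λ z → ∣ X z - M ∣ * ∣ X z - M ∣) ≤ 2 ^ k * (excess k + 1) * (q * (q ^ k * q ^ k * q ^ k))
    variance = +-cancelʳ-≤ (2 * (Q * (M * M))) _ _ (begin
      ∑ zs (λ z → ∣ X z - M ∣ * ∣ X z - M ∣) + 2 * (Q * (M * M)) ≡⟨ cong (λ t → ∑ zs (λ z → ∣ X z - M ∣ * ∣ X z - M ∣) + 2 * t) (trans (sym (*-assoc Q M M)) (cong (_* M) (sym ∑X))) ⟩
      ∑ zs (λ z → ∣ X z - M ∣ * ∣ X z - M ∣) + 2 * (∑ zs X * M) ≡⟨ cong (∑ zs (λ z → ∣ X z - M ∣ * ∣ X z - M ∣) +_) (trans (cong (2 *_) (sym (∑-*ʳ zs X M))) (sym (∑-*ˡ zs 2 _))) ⟩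
      ∑ zs (λ z → ∣ X z - M ∣ * ∣ X z - M ∣) + ∑ zs (λ z → 2 * (X z * M)) ≡⟨ ∑-+ zs _ _ ⟨
      ∑ zs (λ z → ∣ X z - M ∣ * ∣ X z - M ∣ + 2 * (X z * M)) ≡⟨ ∑-cong zs (λ z → ∣-∣-square (X z) M) ⟩
      ∑ zs (λ z → X z * X z + M * M) ≡⟨ trans (∑-+ zs _ _) (cong (∑ zs (λ z → X z * X z) +_) (trans (∑-const zs _) (cong (_* (M * M)) (labels-size k)))) ⟩
      ∑ zs (λ z → X z * X z) + Q * (M * M) ≤⟨ +-monoˡ-≤ (Q * (M * M)) ∑X² ⟩
      Q * (M * M + (excess k + 1) * (q * (q * q) ^ k)) + Q * (M * M) ≡⟨ cong₂ (λ a b → a * (M * M + (excess k + 1) * (q * b)) + a * (M * M)) (*-^ 2 q k) (*-^ q q k) ⟩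
      2 ^ k * q ^ k * (M * M + (excess k + 1) * (q * (q ^ k * q ^ k))) + 2 ^ k * q ^ k * (M * M) ≡⟨ arith (2 ^ k) (q ^ k) (M * M) (excess k + 1) q ⟩
      2 ^ k * (excess k + 1) * (q * (q ^ k * q ^ k * q ^ k)) + 2 * (2 ^ k * q ^ k * (M * M)) ≡⟨ cong (λ a → 2 ^ k * (excess k + 1) * (q * (q ^ k * q ^ k * q ^ k)) + 2 * (a * (M * M))) (*-^ 2 q k) ⟨
      2 ^ k * (excess k + 1) * (q * (q ^ k * q ^ k * q ^ k)) + 2 * (Q * (M * M)) ∎)
      where
      open ≤-Reasoning
      Q = (2 * q) ^ k
      arith : ∀ t x m e q → t * x * (m + e * (q * (x * x))) + t * x * m ≡ t * e * (q * (x * x * x)) + 2 * (t * x * m)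
      arith = solve-∀

-- Polynomial functions and the number of their roots.

module PolynomialFunctions (𝔽 : DiscreteFiniteField) where
  open FieldTheory 𝔽
  open Solver using (solve; _:+_; _:*_; _:=_; con)

  eval : ∀ {d} → Vec Carrier d → Carrier → Carrier
  eval [] t = 0F
  eval (a ∷ p) t = a ⊕ t ⊗ eval p t

  -- Synthetic division: the quotient by x - t₁, with remainder `eval p t₁`.
  deflate : ∀ {d} → Vec Carrier (suc d) → Carrier → Vec Carrier d
  deflate (a ∷ []) t₁ = []
  deflate (a ∷ p@(_ ∷ _)) t₁ = eval p t₁ ∷ deflate p t₁

  -- p(t) - p(t₁) = (t - t₁) (deflate p t₁)(t), without subtraction
  eval-deflate : ∀ {d} (p : Vec Carrier (suc d)) t₁ t →
                 eval p t ⊕ t₁ ⊗ eval (deflate p t₁) t ≡ eval p t₁ ⊕ t ⊗ eval (deflate p t₁) t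
  eval-deflate (a ∷ []) t₁ t =
    solve 3 (λ a t t₁ → (a :+ t :* con 0) :+ t₁ :* con 0 := (a :+ t₁ :* con 0) :+ t :* con 0) refl a t t₁
  eval-deflate (a ∷ p@(_ ∷ _)) t₁ t = begin
    (a ⊕ t ⊗ R t) ⊕ t₁ ⊗ (R t₁ ⊕ t ⊗ Q) ≡⟨ solve 6 (λ a t t₁ R R₁ Q → (a :+ t :* R) :+ t₁ :* (R₁ :+ t :* Q)
                                                  := (a :+ t₁ :* R₁) :+ t :* (R :+ t₁ :* Q)) refl a t t₁ (R t) (R t₁) Q ⟩
    (a ⊕ t₁ ⊗ R t₁) ⊕ t ⊗ (R t ⊕ t₁ ⊗ Q) ≡⟨ cong (λ z → (a ⊕ t₁ ⊗ R t₁) ⊕ t ⊗ z) (eval-deflate p t₁ t) ⟩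
    (a ⊕ t₁ ⊗ R t₁) ⊕ t ⊗ (R t₁ ⊕ t ⊗ Q) ∎
    where
    open ≡-Reasoning
    R = eval p
    Q = eval (deflate p t₁) t

  -- The witness `t₀` is what excludes the zero polynomial. It passes to the quotient by x - t₁,
  -- which cannot vanish at `t₀` either.
  roots≤degree : ∀ {d} (p : Vec Carrier (suc d)) {t₀} → eval p t₀ ≢ 0F → ∑ F (λ t → ⟦ eval p t ≟ 0F ⟧) ≤ d
  roots≤degree {zero} (a ∷ []) {t₀} ne = ≤-reflexive (trans (∑-cong F (λ t → ⟦⟧-no (a ⊕ t ⊗ 0F ≟ 0F) (λ e → ne
    (trans (cong (a ⊕_) (trans (⊗-zeroʳ t₀) (sym (⊗-zeroʳ t)))) e)))) (∑-zero F))
  roots≤degree {suc d} p {t₀} ne with ∃? finite (λ t → eval p t ≟ 0F)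
  ... | no none = ≤-trans (≤-reflexive (trans (∑-cong F (λ t → ⟦⟧-no (eval p t ≟ 0F) (λ e → none (t , e)))) (∑-zero F))) z≤n
  ... | yes (t₁ , root) = begin
    ∑ F (λ t → ⟦ eval p t ≟ 0F ⟧) ≤⟨ ∑-mono F split ⟩
    ∑ F (λ t → ⟦ t ≟ t₁ ⟧ + ⟦ eval p′ t ≟ 0F ⟧) ≡⟨ trans (∑-+ F _ _) (cong (_+ ∑ F (λ t → ⟦ eval p′ t ≟ 0F ⟧)) (Finite.once finite t₁)) ⟩
    1 + ∑ F (λ t → ⟦ eval p′ t ≟ 0F ⟧) ≤⟨ s≤s (roots≤degree p′ {t₀} (λ e → ne (vanish e))) ⟩
    suc d ∎
    where
    p′ = deflate p t₁
    vanish : eval p′ t₀ ≡ 0F → eval p t₀ ≡ 0F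
    vanish e = begin
      eval p t₀ ≡⟨ ⊕-identityʳ _ ⟨
      eval p t₀ ⊕ 0F ≡⟨ cong (eval p t₀ ⊕_) (trans (cong (t₁ ⊗_) e) (⊗-zeroʳ t₁)) ⟨
      eval p t₀ ⊕ t₁ ⊗ eval p′ t₀ ≡⟨ eval-deflate p t₁ t₀ ⟩
      eval p t₁ ⊕ t₀ ⊗ eval p′ t₀ ≡⟨ cong₂ _⊕_ root (trans (cong (t₀ ⊗_) e) (⊗-zeroʳ t₀)) ⟩
      0F ⊕ 0F ≡⟨ ⊕-identityʳ 0F ⟩
      0F ∎
      where open ≡-Reasoning
    at-root : ∀ t → eval p t ≡ 0F → eval p′ t ⊗ t₁ ≡ eval p′ t ⊗ t
    at-root t e = begin
      eval p′ t ⊗ t₁ ≡⟨ ⊗-comm _ t₁ ⟩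
      t₁ ⊗ eval p′ t ≡⟨ ⊕-identityˡ _ ⟨
      0F ⊕ t₁ ⊗ eval p′ t ≡⟨ cong (_⊕ t₁ ⊗ eval p′ t) e ⟨
      eval p t ⊕ t₁ ⊗ eval p′ t ≡⟨ eval-deflate p t₁ t ⟩
      eval p t₁ ⊕ t ⊗ eval p′ t ≡⟨ cong (_⊕ t ⊗ eval p′ t) root ⟩
      0F ⊕ t ⊗ eval p′ t ≡⟨ trans (⊕-identityˡ _) (⊗-comm t _) ⟩
      eval p′ t ⊗ t ∎
      where open ≡-Reasoning
    open ≤-Reasoning
    split : ∀ t → ⟦ eval p t ≟ 0F ⟧ ≤ ⟦ t ≟ t₁ ⟧ + ⟦ eval p′ t ≟ 0F ⟧
    split t with eval p t ≟ 0F | eval p′ t ≟ 0F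
    ... | no _ | _ = z≤n
    ... | yes _ | yes _ = m≤n+m 1 _
    ... | yes e | no nz = ≤-trans (≤-reflexive (sym (⟦⟧-yes (t ≟ t₁) (sym (⊗-cancelˡ nz (at-root t e)))))) (m≤m+n _ _)

  -- `d` counts coefficients, so the degree is below `d`.
  Polynomial : ℕ → (Carrier → Carrier) → Set
  Polynomial d φ = ∃[ p ] (∀ t → φ t ≡ eval {d} p t)

  Polynomial-zero : ∀ {d} → Polynomial d (λ _ → 0F)
  Polynomial-zero {d} = Vec.replicate d 0F , go d
    where
    go : ∀ d t → 0F ≡ eval (Vec.replicate d 0F) t
    go zero t = refl
    go (suc d) t = sym (trans (⊕-identityˡ _) (trans (cong (t ⊗_) (sym (go d t))) (⊗-zeroʳ t)))

  Polynomial-+ : ∀ {d φ ψ} → Polynomial d φ → Polynomial d ψ → Polynomial d (λ t → φ t ⊕ ψ t)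
  Polynomial-+ (p , P) (p′ , P′) = Vec.zipWith _⊕_ p p′ , λ t → trans (cong₂ _⊕_ (P t) (P′ t)) (go p p′ t)
    where
    go : ∀ {d} (p p′ : Vec Carrier d) t → eval p t ⊕ eval p′ t ≡ eval (Vec.zipWith _⊕_ p p′) t
    go [] [] t = ⊕-identityˡ 0F
    go (a ∷ p) (b ∷ p′) t = trans (solve 5 (λ a b t x y → (a :+ t :* x) :+ (b :+ t :* y) := (a :+ b) :+ t :* (x :+ y)) refl a b t (eval p t) (eval p′ t))
      (cong (λ z → (a ⊕ b) ⊕ t ⊗ z) (go p p′ t))

  Polynomial-scale : ∀ {d φ} c → Polynomial d φ → Polynomial d (λ t → c ⊗ φ t)
  Polynomial-scale c (p , P) = Vec.map (c ⊗_) p , λ t → trans (cong (c ⊗_) (P t)) (go p t)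
    where
    go : ∀ {d} (p : Vec Carrier d) t → c ⊗ eval p t ≡ eval (Vec.map (c ⊗_) p) t
    go [] t = ⊗-zeroʳ c
    go (a ∷ p) t = trans (solve 4 (λ a t x c → c :* (a :+ t :* x) := c :* a :+ t :* (c :* x)) refl a t (eval p t) c)
      (cong (λ z → c ⊗ a ⊕ t ⊗ z) (go p t))

  Polynomial-shift : ∀ {d φ} → Polynomial d φ → Polynomial (suc d) (λ t → t ⊗ φ t)
  Polynomial-shift (p , P) = 0F ∷ p , λ t → trans (cong (t ⊗_) (P t)) (sym (⊕-identityˡ _))

  Polynomial-weaken : ∀ {d φ} → Polynomial d φ → Polynomial (suc d) φ
  Polynomial-weaken (p , P) = p Vec.∷ʳ 0F , λ t → trans (P t) (go p t)
    where
    go : ∀ {d} (p : Vec Carrier d) t → eval p t ≡ eval (p Vec.∷ʳ 0F) t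
    go [] t = sym (trans (⊕-identityˡ _) (⊗-zeroʳ t))
    go (a ∷ p) t = cong (λ z → a ⊕ t ⊗ z) (go p t)

  Polynomial-cong : ∀ {d φ ψ} → (∀ t → φ t ≡ ψ t) → Polynomial d φ → Polynomial d ψ
  Polynomial-cong e (p , P) = p , λ t → trans (sym (e t)) (P t)

  Polynomial-roots : ∀ {d φ t₀} → Polynomial (suc d) φ → φ t₀ ≢ 0F → ∑ F (λ t → ⟦ φ t ≟ 0F ⟧) ≤ d
  Polynomial-roots {φ = φ} (p , P) ne = ≤-trans
    (≤-reflexive (∑-cong F (λ t → ⟦⟧-cong (φ t ≟ 0F) (eval p t ≟ 0F) (trans (sym (P t))) (trans (P t)))))
    (roots≤degree p (λ e → ne (trans (P _) e)))

-- The recurrence that recovers one factor from the labels.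

module Recurrence (𝔽 : DiscreteFiniteField) where
  open FieldTheory 𝔽
  open Solver using (solve; _:+_; _:*_; _:=_; con)
  open PolynomialFunctions 𝔽
  open SecondMoment 𝔽
  open Algebra.Properties.Ring (CommutativeRing.ring commutativeRing) using (-1*x≈-x)

  -- The lengths may differ: at the start `hs` has few entries, and coefficients above the leading
  -- one count as 0.
  dot : ∀ {m} → Vec Carrier m → List Carrier → Carrier
  dot [] hs = 0F
  dot (x ∷ g) [] = 0F
  dot (x ∷ g) (h ∷ hs) = x ⊗ h ⊕ dot g hs

  next : ∀ {m} → Vec Carrier m → Carrier → List Carrier → Carrier → Carrier
  next g h hs r = r ⊗ h ⊕ ⊖ dot g hs

  -- The state (h, hs) holds the coefficients of the second factor read so far, most recent first;
  -- a label (b, r) records the square class b of h and the ratio r of the coefficient of the product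
  -- at c = 0 to h.
  generate : ∀ {m k} → Vec Carrier m → Carrier → List Carrier → Vec Label k → Vec Carrier k
  generate g h hs [] = []
  generate g h hs ((b , r) ∷ z) = next g h hs r ∷ generate g (next g h hs r) (h ∷ hs) z

  -- The coefficient after the last one according to the recurrence, which has to be zero.
  closing : ∀ {m k} → Vec Carrier m → Carrier → List Carrier → Vec Label k → Carrier → Carrier
  closing g h hs [] ρ = next g h hs ρ
  closing g h hs ((b , r) ∷ z) ρ = closing g (next g h hs r) (h ∷ hs) z ρ

  data AllNonzero : ∀ {k} → Vec Label k → Set where
    [] : AllNonzero []
    _∷_ : ∀ {k b r} {z : Vec Label k} → r ≢ 0F → AllNonzero z → AllNonzero ((b , r) ∷ z)

  scaleV : ∀ {m} → Carrier → Vec Carrier m → Vec Carrier m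
  scaleV t = Vec.map (t ⊗_)

  dot-scaleV : ∀ {m} t (γ : Vec Carrier m) hs → dot (scaleV t γ) hs ≡ t ⊗ dot γ hs
  dot-scaleV t [] hs = sym (⊗-zeroʳ t)
  dot-scaleV t (x ∷ γ) [] = sym (⊗-zeroʳ t)
  dot-scaleV t (x ∷ γ) (h ∷ hs) = trans (cong (t ⊗ x ⊗ h ⊕_) (dot-scaleV t γ hs))
    (solve 4 (λ t x h d → t :* x :* h :+ t :* d := t :* (x :* h :+ d)) refl t x h (dot γ hs))

  at : Carrier → List (Carrier → Carrier) → List Carrier
  at t = map (λ φ → φ t)

  dot-polynomial : ∀ {m d} (γ : Vec Carrier m) {φs} → All (Polynomial d) φs → Polynomial d (λ t → dot γ (at t φs))
  dot-polynomial [] _ = Polynomial-zero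
  dot-polynomial (x ∷ γ) [] = Polynomial-zero
  dot-polynomial (x ∷ γ) (P ∷ Ps) = Polynomial-+ (Polynomial-scale x P) (dot-polynomial γ Ps)

  All-weaken : ∀ {d φs} → All (Polynomial d) φs → All (Polynomial (suc d)) φs
  All-weaken [] = []
  All-weaken (P ∷ Ps) = Polynomial-weaken P ∷ All-weaken Ps

  next-polynomial : ∀ {m d} (γ : Vec Carrier m) {φ φs} → Polynomial d φ → All (Polynomial d) φs → ∀ r →
                    Polynomial (suc d) (λ t → next (scaleV t γ) (φ t) (at t φs) r)
  next-polynomial γ P Ps r = Polynomial-+ (Polynomial-scale r (Polynomial-weaken P))
    (Polynomial-cong (λ t → trans (-1*x≈-x _) (cong ⊖_ (sym (dot-scaleV t γ _))))
      (Polynomial-scale (⊖ 1F) (Polynomial-shift (dot-polynomial γ Ps))))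

  -- At t = 0 the recurrence loses its memory and only multiplies by `r`. This is where the ratios
  -- have to be nonzero.
  next-at-0 : ∀ {m} (γ : Vec Carrier m) {h} hs {r} → h ≢ 0F → r ≢ 0F → next (scaleV 0F γ) h hs r ≢ 0F
  next-at-0 γ {h} hs {r} h≢0 r≢0 e = ⊗≢0 r≢0 h≢0 (begin
    r ⊗ h ≡⟨ ⊖-⊕ (r ⊗ h) (dot (scaleV 0F γ) hs) ⟨
    next (scaleV 0F γ) h hs r ⊕ dot (scaleV 0F γ) hs ≡⟨ cong₂ _⊕_ e (trans (dot-scaleV 0F γ hs) (⊗-zeroˡ _)) ⟩
    0F ⊕ 0F ≡⟨ ⊕-identityʳ 0F ⟩
    0F ∎)
    where open ≡-Reasoning

  -- Along the recurrence for t γ the state stays polynomial in t: each step raises the degree by at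
  -- most one, and the newest coefficient stays nonzero at t = 0. So the closing value is a nonzero
  -- polynomial in t of degree at most k + d.
  closing-roots : ∀ {m k d} (γ : Vec Carrier m) {φ φs} → Polynomial d φ → All (Polynomial d) φs → φ 0F ≢ 0F →
                  {z : Vec Label k} → AllNonzero z → ∀ {ρ} → ρ ≢ 0F →
                  ∑ F (λ t → ⟦ closing (scaleV t γ) (φ t) (at t φs) z ρ ≟ 0F ⟧) ≤ k + d
  closing-roots γ {φs = φs} P Ps φ0≢0 [] {ρ} ρ≢0 =
    Polynomial-roots {t₀ = 0F} (next-polynomial γ P Ps ρ) (next-at-0 γ (at 0F φs) φ0≢0 ρ≢0)
  closing-roots {k = suc k} {d} γ {φs = φs} P Ps φ0≢0 {z = (b , r) ∷ z} (r≢0 ∷ nz) ρ≢0 = ≤-trans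
    (closing-roots γ (next-polynomial γ P Ps r) (Polynomial-weaken P ∷ All-weaken Ps) (next-at-0 γ (at 0F φs) φ0≢0 r≢0) nz ρ≢0)
    (≤-reflexive (+-suc k d))

  vectors : ∀ k → List (Vec Carrier k)
  vectors k = Finite.elems (Vec-finite finite k)

  vectors-size : ∀ k → length (vectors k) ≡ q ^ k
  vectors-size k = Vec-size finite k

  2≤q : 2 ≤ q
  2≤q = ≤-trans (≤-reflexive (sym (trans (∑-+ F _ _) (cong₂ _+_ (Finite.once finite 0F) (Finite.once finite 1F)))))
    (≤-trans (∑-mono F separate) (≤-reflexive (∑-one F)))
    where
    separate : ∀ x → ⟦ x ≟ 0F ⟧ + ⟦ x ≟ 1F ⟧ ≤ 1
    separate x with x ≟ 0F
    ... | no _ = ⟦⟧≤1 (x ≟ 1F)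
    ... | yes refl = ≤-reflexive (cong suc (⟦⟧-no (0F ≟ 1F) (λ e → 1≢0 (sym e))))

  ∑-scaleV : ∀ {t} → t ≢ 0F → ∀ m (f : Vec Carrier m → ℕ) → ∑ (vectors m) (λ γ → f (scaleV t γ)) ≡ ∑ (vectors m) f
  ∑-scaleV {t} t≢0 m = reindex (Vec-finite finite m) (Vec-finite finite m) (scaleV t) (scaleV (inv t≢0)) there′ back
    where
    there′ : ∀ {m} (v : Vec Carrier m) → scaleV (inv t≢0) (scaleV t v) ≡ v
    there′ [] = refl
    there′ (x ∷ v) = cong₂ _∷_ (inv-⊗-⊗ t≢0 x) (there′ v)
    back : ∀ {m} (v : Vec Carrier m) → scaleV t (scaleV (inv t≢0) v) ≡ v
    back [] = refl
    back (x ∷ v) = cong₂ _∷_ (⊗-inv-⊗ t≢0 x) (back v)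

  -- Averaging over g ↦ t g turns the closing condition into a polynomial equation in t with nonzero constant term.
  closing-count : ∀ {k} m {z : Vec Label k} → AllNonzero z → ∀ {ρ} → ρ ≢ 0F →
                  q * ∑ (vectors m) (λ g → ⟦ closing g 1F [] z ρ ≟ 0F ⟧) ≤ 2 * ((k + 1) * q ^ m)
  closing-count {k} m {z} nz {ρ} ρ≢0 = begin
    q * N ≤⟨ qN≤A+N ⟩
    -- At t = 0 there is no root count, which leaves the term N. Since q ≥ 2, also N ≤ A, and the
    -- constant doubles.
    A + N ≤⟨ +-monoʳ-≤ A (+-cancelʳ-≤ N N A (≤-trans (≤-trans (≤-reflexive (cong (N +_) (sym (+-identityʳ N)))) (*-monoˡ-≤ N 2≤q)) qN≤A+N)) ⟩
    A + A ≡⟨ cong (A +_) (+-identityʳ A) ⟨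
    2 * A ∎
    where
    open ≤-Reasoning
    A = (k + 1) * q ^ m
    N = ∑ (vectors m) (λ g → ⟦ closing g 1F [] z ρ ≟ 0F ⟧)
    one-polynomial : Polynomial 1 (λ _ → 1F)
    one-polynomial = 1F ∷ [] , λ t → sym (trans (cong (1F ⊕_) (⊗-zeroʳ t)) (⊕-identityʳ 1F))
    pointwise : ∀ t → N ≤ ∑ (vectors m) (λ γ → ⟦ closing (scaleV t γ) 1F [] z ρ ≟ 0F ⟧) + ⟦ t ≟ 0F ⟧ * N
    pointwise t with t ≟ 0F
    ... | yes refl = ≤-trans (≤-reflexive (sym (+-identityʳ N))) (m≤n+m (N + 0) (∑ (vectors m) (λ γ → ⟦ closing (scaleV 0F γ) 1F [] z ρ ≟ 0F ⟧)))
    ... | no t≢0 = ≤-trans (≤-reflexive (sym (∑-scaleV t≢0 m (λ g → ⟦ closing g 1F [] z ρ ≟ 0F ⟧)))) (m≤m+n _ 0)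
    qN≤A+N : q * N ≤ A + N
    qN≤A+N = begin
      q * N ≡⟨ ∑-const F N ⟨
      ∑ F (λ t → N) ≤⟨ ∑-mono F pointwise ⟩
      ∑ F (λ t → ∑ (vectors m) (λ γ → ⟦ closing (scaleV t γ) 1F [] z ρ ≟ 0F ⟧) + ⟦ t ≟ 0F ⟧ * N)
        ≡⟨ trans (∑-+ F _ _) (cong₂ _+_ (∑-swap F (vectors m) _) (∑-δ 0F (λ _ → N))) ⟩
      ∑ (vectors m) (λ γ → ∑ F (λ t → ⟦ closing (scaleV t γ) 1F [] z ρ ≟ 0F ⟧)) + N
        ≤⟨ +-monoˡ-≤ N (∑-bound (vectors m) (λ γ → closing-roots γ {φs = []} one-polynomial [] 1≢0 nz ρ≢0)) ⟩
      length (vectors m) * (k + 1) + N ≡⟨ cong (_+ N) (trans (cong (_* (k + 1)) (vectors-size m)) (*-comm _ (k + 1))) ⟩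
      A + N ∎

varianceConstant : ℕ → ℕ
varianceConstant l = 2 ^ l * (excess l + 1)

-- 2 l pays for `degenerate` and 1 for `collapse`. In the last summand 2 (l + 1) is the fibre bound
-- of `closing-count`, and the remaining 2 stands for the two square classes of the last label.
deviationConstant : ℕ → ℕ
deviationConstant l = 2 * l + 1 + 4 * (l + 1) * varianceConstant l

-- Products of two monic polynomials with square coefficients.

module BilinearSums (𝔽 : DiscreteFiniteField) where
  open FieldTheory 𝔽
  open Solver using (solve; _:+_; _:*_; _:=_; con)
  open SecondMoment 𝔽
  open Recurrence 𝔽

  -- Once the second factor is exhausted, each further coefficient of the product drops one more
  -- leading entry of `g` against the same list.
  tails : ∀ {m} → Vec Carrier m → List Carrier → Vec Carrier m
  tails [] hs = []
  tails (x ∷ g) hs = dot (x ∷ g) hs ∷ tails g hs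

  -- The vector (ξ₁, …, ξₙ) stands for the monic polynomial xⁿ + ξ₁ xⁿ⁻¹ + … + ξₙ, and mul is
  -- the product of monic polynomials.
  mulFrom : ∀ {m k} → Vec Carrier m → List Carrier → Vec Carrier k → Vec Carrier (k + m)
  mulFrom g hs [] = tails g hs
  mulFrom g hs (x ∷ v) = (x ⊕ dot g hs) ∷ mulFrom g (x ∷ hs) v

  mul : ∀ {m l} → Vec Carrier m → Vec Carrier l → Vec Carrier (l + m)
  mul g h = mulFrom g (1F ∷ []) h

  w : ∀ {n} → Vec Carrier n → ℕ
  w [] = 1
  w (x ∷ v) = sq x * w v

  w≤1 : ∀ {n} (v : Vec Carrier n) → w v ≤ 1
  w≤1 [] = ≤-refl
  w≤1 (x ∷ v) = *-mono-≤ (sq≤1 x) (w≤1 v)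

  lastH : ∀ {k} → Carrier → Vec Carrier k → Carrier
  lastH h [] = h
  lastH h (x ∷ v) = lastH x v

  lastHs : ∀ {k} → Carrier → List Carrier → Vec Carrier k → List Carrier
  lastHs h hs [] = hs
  lastHs h hs (x ∷ v) = lastHs x (h ∷ hs) v

  -- With c the first coefficient of the first factor, W₁ weights the coefficients of the product that
  -- involve c, and W₂ the others.
  W₁ : ∀ {m k} → Carrier → Vec Carrier m → Carrier → List Carrier → Vec Carrier k → ℕ
  W₁ c g h hs [] = sq (c ⊗ h ⊕ dot g hs)
  W₁ c g h hs (x ∷ v) = sq (x ⊕ (c ⊗ h ⊕ dot g hs)) * W₁ c g x (h ∷ hs) v

  W₂ : ∀ {m k} → Vec Carrier m → Carrier → List Carrier → Vec Carrier k → ℕ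
  W₂ g h hs v = w (tails g (lastH h v ∷ lastHs h hs v))

  w-mulFrom : ∀ {m k} c (g : Vec Carrier m) h hs (v : Vec Carrier k) →
              w (mulFrom (c ∷ g) (h ∷ hs) v) ≡ W₁ c g h hs v * W₂ g h hs v
  w-mulFrom c g h hs [] = refl
  w-mulFrom c g h hs (x ∷ v) = trans (cong (sq (x ⊕ (c ⊗ h ⊕ dot g hs)) *_) (w-mulFrom c g x (h ∷ hs) v))
    (sym (*-assoc (sq (x ⊕ (c ⊗ h ⊕ dot g hs))) _ _))

  W₁≤1 : ∀ {m k} c (g : Vec Carrier m) h hs (v : Vec Carrier k) → W₁ c g h hs v ≤ 1
  W₁≤1 c g h hs [] = sq≤1 _
  W₁≤1 c g h hs (x ∷ v) = *-mono-≤ (sq≤1 (x ⊕ (c ⊗ h ⊕ dot g hs))) (W₁≤1 c g x (h ∷ hs) v)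

  -- The system is triangular: the head `x` of the vector occurs in its own coefficient only, with
  -- factor h ≠ 0, so for every choice of the later entries that coefficient runs through the whole
  -- field.
  ∑-tails : ∀ m {h} hs → h ≢ 0F → ∑ (vectors m) (λ g → w (tails g (h ∷ hs))) ≡ s ^ m
  ∑-tails zero hs h≢0 = refl
  ∑-tails (suc m) {h} hs h≢0 = begin
    ∑ (vectors (suc m)) (λ g → w (tails g (h ∷ hs))) ≡⟨ ∑-∷ finite m _ ⟩
    ∑ F (λ x → ∑ (vectors m) (λ g → sq (x ⊗ h ⊕ dot g hs) * w (tails g (h ∷ hs)))) ≡⟨ ∑-swap F (vectors m) _ ⟩
    ∑ (vectors m) (λ g → ∑ F (λ x → sq (x ⊗ h ⊕ dot g hs) * w (tails g (h ∷ hs)))) ≡⟨ ∑-cong (vectors m) (λ g → trans (∑-*ʳ F _ (w (tails g (h ∷ hs))))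
                                                                                                   (cong (_* w (tails g (h ∷ hs))) (first g))) ⟩
    ∑ (vectors m) (λ g → s * w (tails g (h ∷ hs))) ≡⟨ trans (∑-*ˡ (vectors m) s _) (cong (s *_) (∑-tails m hs h≢0)) ⟩
    s ^ suc m ∎
    where
    open ≡-Reasoning
    first : ∀ g → ∑ F (λ x → sq (x ⊗ h ⊕ dot g hs)) ≡ s
    first g = trans (∑-cong F (λ x → cong (λ y → sq (y ⊕ dot g hs)) (⊗-comm x h))) (∑-affine h≢0 (dot g hs) sq)

  ∑-lastH : ∀ k h → ∑ (vectors (suc k)) (λ v → ⟦ lastH h v ≟ 0F ⟧) ≡ q ^ k
  ∑-lastH zero h = trans (∑-∷ finite 0 (λ v → ⟦ lastH h v ≟ 0F ⟧)) (trans (∑-cong F (λ x → +-identityʳ _)) (Finite.once finite 0F))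
  ∑-lastH (suc k) h = trans (∑-∷ finite (suc k) (λ v → ⟦ lastH h v ≟ 0F ⟧)) (trans (∑-cong F (λ x → ∑-lastH k x)) (∑-const F (q ^ k)))

  -- Positive exactly when some step has no square class (h vanishes) or the ratio 0.
  degenerate : ∀ {m k} → Vec Carrier m → Carrier → List Carrier → Vec Carrier k → ℕ
  degenerate g h hs [] = 0
  degenerate g h hs (x ∷ v) = ⟦ x ≟ 0F ⟧ + ⟦ x ⊕ dot g hs ≟ 0F ⟧ + degenerate g x (h ∷ hs) v

  -- Every step marks the two values `x` = 0 and `x` = - `dot g hs`, that is, two out of q.
  ∑-degenerate : ∀ {m} k (g : Vec Carrier m) h hs → q * ∑ (vectors k) (degenerate g h hs) ≤ 2 * k * q ^ k
  ∑-degenerate zero g h hs = ≤-reflexive (*-zeroʳ q)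
  ∑-degenerate (suc k) g h hs = begin
    q * ∑ (vectors (suc k)) (degenerate g h hs) ≡⟨ cong (q *_) (∑-∷ finite k (degenerate g h hs)) ⟩
    q * ∑ F (λ x → ∑ (vectors k) (λ v → a x + degenerate g x (h ∷ hs) v))
      ≡⟨ cong (q *_) (trans (∑-cong F (λ x → trans (∑-+ (vectors k) _ _) (cong (_+ D x) (trans (∑-const (vectors k) (a x)) (cong (_* a x) (vectors-size k))))))
            (trans (∑-+ F _ _) (cong (_+ ∑ F D) (trans (∑-*ˡ F (q ^ k) a) (cong (q ^ k *_) ∑a))))) ⟩
    q * (q ^ k * 2 + ∑ F D) ≡⟨ trans (*-distribˡ-+ q _ _) (cong (q * (q ^ k * 2) +_) (sym (∑-*ˡ F q D))) ⟩
    q * (q ^ k * 2) + ∑ F (λ x → q * D x) ≤⟨ +-monoʳ-≤ (q * (q ^ k * 2)) (∑-bound F (λ x → ∑-degenerate k g x (h ∷ hs))) ⟩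
    q * (q ^ k * 2) + q * (2 * k * q ^ k) ≡⟨ arith q (q ^ k) k ⟩
    2 * suc k * q ^ suc k ∎
    where
    open ≤-Reasoning
    a : Carrier → ℕ
    a x = ⟦ x ≟ 0F ⟧ + ⟦ x ⊕ dot g hs ≟ 0F ⟧
    D : Carrier → ℕ
    D x = ∑ (vectors k) (degenerate g x (h ∷ hs))
    ∑a : ∑ F a ≡ 2
    ∑a = trans (∑-+ F _ _) (cong₂ _+_ (Finite.once finite 0F) (trans (∑-translate (dot g hs) (λ x → ⟦ x ≟ 0F ⟧)) (Finite.once finite 0F)))
    arith : ∀ q x k → q * (x * 2) + q * (2 * k * x) ≡ 2 * suc k * (q * x)
    arith = solve-∀

  ratio : ∀ {h} → h ≢ 0F → ∀ A → ∃[ ζ ] proj₂ ζ ⊗ h ≡ A × (∀ c → sq (A ⊕ c ⊗ h) ≡ u ζ c)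
  ratio {h} h≢0 A = (b , r) , rh , λ c → trans (cong sq (begin
      A ⊕ c ⊗ h ≡⟨ cong (_⊕ c ⊗ h) rh ⟨
      r ⊗ h ⊕ c ⊗ h ≡⟨ solve 3 (λ r h c → r :* h :+ c :* h := h :* (r :+ c)) refl r h c ⟩
      h ⊗ (r ⊕ c) ∎)) (e (r ⊕ c))
    where
    open ≡-Reasoning
    r = inv h≢0 ⊗ A
    b = proj₁ (classify h≢0)
    e = proj₂ (classify h≢0)
    rh : r ⊗ h ≡ A
    rh = trans (⊗-comm r h) (⊗-inv-⊗ h≢0 A)

  -- `z` produces the coefficients of the second factor, and `ζ` is the label of the last
  -- coefficient of the product that involves c. The second factor has no further coefficient, which
  -- `closes` expresses as a constraint on the ratio of `ζ`; `final` computes that ratio directly.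
  record Parametrization {m k} (g : Vec Carrier m) (h : Carrier) (hs : List Carrier) (v : Vec Carrier k) : Set where
    field
      z : Vec Label k
      ζ : Label
      generates : generate g h hs z ≡ v
      weight : ∀ c → W₁ c g h hs v ≡ u ζ c * U z c
      nonzero : AllNonzero z
      closes : closing g h hs z (proj₂ ζ) ≡ 0F
      final : proj₂ ζ ⊗ lastH h v ≡ dot g (lastHs h hs v)

  parametrize : ∀ {m k} (g : Vec Carrier m) h hs (v : Vec Carrier k) → h ≢ 0F → degenerate g h hs v ≡ 0 →
                Parametrization g h hs v
  parametrize g h hs [] h≢0 _ with ratio h≢0 (dot g hs)
  ... | ζ , e , E = record
    { z = [] ; ζ = ζ ; generates = refl ; nonzero = []
    ; weight = λ c → trans (cong sq (⊕-comm (c ⊗ h) _)) (trans (E c) (sym (*-identityʳ _)))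
    ; closes = trans (cong (_⊕ ⊖ dot g hs) e) (⊖-inverseʳ _)
    ; final = e }
  parametrize g h hs (x ∷ v) h≢0 nd with ratio h≢0 (x ⊕ dot g hs)
  ... | (b , r) , e , E = record
    { z = (b , r) ∷ P.z
    ; ζ = P.ζ
    ; generates = cong₂ _∷_ x′≡x (trans (cong (λ y → generate g y (h ∷ hs) P.z) x′≡x) P.generates)
    ; weight = λ c → trans (cong₂ _*_ (trans (cong sq (rearrange x (c ⊗ h) (dot g hs))) (E c)) (P.weight c)) (*-swap (u (b , r) c) (u P.ζ c) (U P.z c))
    ; nonzero = r≢0 ∷ P.nonzero
    ; closes = trans (cong (λ y → closing g y (h ∷ hs) P.z (proj₂ P.ζ)) x′≡x) P.closes
    ; final = P.final }
    where
    front : ⟦ x ≟ 0F ⟧ + ⟦ x ⊕ dot g hs ≟ 0F ⟧ ≡ 0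
    front = m+n≡0⇒m≡0 _ nd
    absurd : ∀ {y} → ⟦ y ≟ 0F ⟧ ≡ 0 → y ≢ 0F
    absurd {y} z e = 1+n≢0 (trans (sym (⟦⟧-yes (y ≟ 0F) e)) z)
    module P = Parametrization (parametrize g x (h ∷ hs) v (absurd (m+n≡0⇒m≡0 _ front)) (m+n≡0⇒n≡0 (⟦ x ≟ 0F ⟧ + ⟦ x ⊕ dot g hs ≟ 0F ⟧) nd))
    r≢0 : r ≢ 0F
    r≢0 refl = absurd (m+n≡0⇒n≡0 ⟦ x ≟ 0F ⟧ front) (trans (sym e) (⊗-zeroˡ h))
    x′≡x : next g h hs r ≡ x
    x′≡x = trans (cong (_⊕ ⊖ dot g hs) e) (⊕-⊖ x _)
    rearrange : ∀ x y d → x ⊕ (y ⊕ d) ≡ x ⊕ d ⊕ y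
    rearrange = solve 3 (λ x y d → x :+ (y :+ d) := x :+ d :+ y) refl

  allNonzero? : ∀ {k} (z : Vec Label k) → Dec (AllNonzero z)
  allNonzero? [] = yes []
  allNonzero? ((b , r) ∷ z) with r ≟ 0F | allNonzero? z
  ... | yes e | _ = no λ { (ne ∷ _) → ne e }
  ... | no ne | yes nz = yes (ne ∷ nz)
  ... | no _ | no nnz = no λ { (_ ∷ nz) → nnz nz }

  module _ (k : ℕ) where

    private
      l = suc k
      M = s ^ suc l
      x = q ^ l
      V = varianceConstant l

    -- Scaled so that the expected value is M = s^(l+1).
    mass : ∀ {m} → Vec Carrier m → Vec Carrier l → ℕ
    mass g h = q ^ l * ∑ F (λ c → W₁ c g 1F [] h)

    deviation : ∀ {m} → Vec Carrier m → Vec Carrier l → ℕ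
    deviation g h = ∣ mass g h - M ∣

    labelDeviation : Label → Vec Label l → ℕ
    labelDeviation ζ z = ∣ q ^ l * ∑ F (λ c → u ζ c * U z c) - M ∣

    labelVariance : ∀ ζ → ∑ (labels l) (λ z → labelDeviation ζ z * labelDeviation ζ z) ≤ V * (q * (x * x * x))
    labelVariance (b , r) = variance (u (b , r)) (λ c → sq≤1 (class b ⊗ (r ⊕ c)))
      (trans (∑-cong F (λ c → cong (λ y → sq (class b ⊗ y)) (⊕-comm r c))) (∑-sq-label b r)) l

    deviation≤ : ∀ {m} (g : Vec Carrier m) h → deviation g h ≤ q * x
    deviation≤ g h = ≤-trans (∣m-n∣≤m⊔n (mass g h) M) (⊔-lub
      (≤-trans (*-monoʳ-≤ x (≤-trans (∑-bound F (λ c → W₁≤1 c g 1F [] h)) (≤-reflexive (*-identityʳ q)))) (≤-reflexive (*-comm x q)))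
      (^-monoˡ-≤ (suc l) s≤q))

    deviation-label : ∀ {m} (g : Vec Carrier m) h (P : Parametrization g 1F [] h) →
                      deviation g h ≡ labelDeviation (Parametrization.ζ P) (Parametrization.z P)
    deviation-label g h P = cong (λ y → ∣ q ^ l * y - M ∣) (∑-cong F (Parametrization.weight P))

    -- Summing over h collapses the indicator; this implements the change of variables from h to labels.
    majorant : ∀ {m} → (Vec Carrier m → Label → Vec Label l → ℕ) → Vec Carrier m → Vec Carrier l → ℕ
    majorant admissible g h = ∑ Label-list (λ ζ → ∑ (labels l) (λ z →
      ⟦ Finite._≟_ (Vec-finite finite l) h (generate g 1F [] z) ⟧ * (admissible g ζ z * (labelDeviation ζ z * labelDeviation ζ z))))

    -- The term at the labels of `h` suffices, and all other terms are nonnegative.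
    deviation≤majorant : ∀ {m} (admissible : Vec Carrier m → Label → Vec Label l → ℕ) g h (P : Parametrization g 1F [] h) →
                         1 ≤ admissible g (Parametrization.ζ P) (Parametrization.z P) →
                         deviation g h * deviation g h ≤ majorant admissible g h
    deviation≤majorant admissible g h P adm = begin
      deviation g h * deviation g h ≡⟨ cong (λ d → d * d) (deviation-label g h P) ⟩
      δ ≡⟨ *-identityˡ δ ⟨
      1 * δ ≤⟨ *-monoˡ-≤ δ adm ⟩
      admissible g ζ z * δ ≡⟨ *-identityˡ _ ⟨
      1 * (admissible g ζ z * δ) ≡⟨ cong (_* (admissible g ζ z * δ)) (⟦⟧-yes (Finite._≟_ (Vec-finite finite l) h (generate g 1F [] z)) (sym (Parametrization.generates P))) ⟨
      term ζ z ≤⟨ Finite.term≤ (Vec-finite Label-finite l) (term ζ) z ⟩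
      ∑ (labels l) (term ζ) ≤⟨ Finite.term≤ Label-finite (λ ζ → ∑ (labels l) (term ζ)) ζ ⟩
      majorant admissible g h ∎
      where
      open ≤-Reasoning
      ζ = Parametrization.ζ P
      z = Parametrization.z P
      δ = labelDeviation ζ z * labelDeviation ζ z
      term : Label → Vec Label l → ℕ
      term ζ z = ⟦ Finite._≟_ (Vec-finite finite l) h (generate g 1F [] z) ⟧ * (admissible g ζ z * (labelDeviation ζ z * labelDeviation ζ z))

    -- Since `g` and `z` determine `h`, the fibre over the labels is counted by the admissible `g`
    -- alone.
    ∑-majorant : ∀ {m} (admissible : Vec Carrier m → Label → Vec Label l → ℕ) →
                 ∑ (vectors m) (λ g → ∑ (vectors l) (majorant admissible g)) ≡
                 ∑ Label-list (λ ζ → ∑ (labels l) (λ z → ∑ (vectors m) (λ g → admissible g ζ z) * (labelDeviation ζ z * labelDeviation ζ z)))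
    ∑-majorant {m} admissible = begin
      ∑ (vectors m) (λ g → ∑ (vectors l) (majorant admissible g))
        ≡⟨ ∑-cong (vectors m) (λ g → trans (∑-swap (vectors l) Label-list _) (∑-cong Label-list (λ ζ → trans (∑-swap (vectors l) (labels l) _)
             (∑-cong (labels l) (λ z → Finite.pick (Vec-finite finite l) (λ _ → admissible g ζ z * (labelDeviation ζ z * labelDeviation ζ z)) (generate g 1F [] z)))))) ⟩
      ∑ (vectors m) (λ g → ∑ Label-list (λ ζ → ∑ (labels l) (λ z → admissible g ζ z * (labelDeviation ζ z * labelDeviation ζ z))))
        ≡⟨ trans (∑-swap (vectors m) Label-list _) (∑-cong Label-list (λ ζ → trans (∑-swap (vectors m) (labels l) _)
             (∑-cong (labels l) (λ z → ∑-*ʳ (vectors m) _ _)))) ⟩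
      ∑ Label-list (λ ζ → ∑ (labels l) (λ z → ∑ (vectors m) (λ g → admissible g ζ z) * (labelDeviation ζ z * labelDeviation ζ z))) ∎
      where open ≡-Reasoning

    -- When c is the only coefficient of the first factor there is nothing to average over in
    -- `closing-count`. But then the last ratio is forced to be 0, and two labels `ζ` remain out of
    -- 2 q.
    variance-bound₀ : q * ∑ (vectors 0) (λ g → ∑ (vectors l) (λ h → deviation g h * deviation g h)) ≤
                      q * (deviationConstant l * (q * (x * x * x) * 1))
    variance-bound₀ = begin
      q * ∑ (vectors 0) (λ g → ∑ (vectors l) (λ h → deviation g h * deviation g h))
        ≤⟨ *-monoʳ-≤ q (≤-trans (∑-mono (vectors 0) (λ g → ∑-mono (vectors l) (pointwise g))) (≤-reflexive
             (trans (∑-cong (vectors 0) (λ g → ∑-+ (vectors l) (λ h → q * x * (q * x) * degenerate g 1F [] h) (majorant adm g)))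
             (∑-+ (vectors 0) (λ g → ∑ (vectors l) (λ h → q * x * (q * x) * degenerate g 1F [] h)) (λ g → ∑ (vectors l) (majorant adm g)))))) ⟩
      q * (∑ (vectors 0) (λ g → ∑ (vectors l) (λ h → q * x * (q * x) * degenerate g 1F [] h)) + ∑ (vectors 0) (λ g → ∑ (vectors l) (majorant adm g)))
        ≡⟨ cong₂ (λ a b → q * (a + b)) (trans (+-identityʳ _) (∑-*ˡ (vectors l) (q * x * (q * x)) _)) (∑-majorant adm) ⟩
      q * (q * x * (q * x) * D + ∑ Label-list (λ ζ → ∑ (labels l) (λ z → (adm [] ζ z + 0) * (labelDeviation ζ z * labelDeviation ζ z))))
        ≤⟨ *-monoʳ-≤ q (+-monoʳ-≤ (q * x * (q * x) * D) (≤-trans (∑-mono Label-list per-label) (≤-reflexive ∑-adm))) ⟩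
      q * (q * x * (q * x) * D + 2 * (V * (q * (x * x * x))))
        ≡⟨ arith₁ q x D V ⟩
      q * x * (q * x) * (q * D) + 2 * V * (q * q * (x * x * x))
        ≤⟨ +-monoˡ-≤ _ (*-monoʳ-≤ (q * x * (q * x)) (∑-degenerate l [] 1F [])) ⟩
      q * x * (q * x) * (2 * l * x) + 2 * V * (q * q * (x * x * x))
        -- Slack, to reach the same constant as for longer `g`.
        ≤⟨ m≤m+n _ ((1 + 2 * V + 4 * l * V) * (q * q * (x * x * x))) ⟩
      q * x * (q * x) * (2 * l * x) + 2 * V * (q * q * (x * x * x)) + (1 + 2 * V + 4 * l * V) * (q * q * (x * x * x))
        ≡⟨ arith₂ q x l V ⟩
      q * (deviationConstant l * (q * (x * x * x) * 1)) ∎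
      where
      open ≤-Reasoning
      D = ∑ (vectors l) (degenerate [] 1F [])
      adm : Vec Carrier 0 → Label → Vec Label l → ℕ
      adm g ζ z = ⟦ proj₂ ζ ≟ 0F ⟧
      arith₁ : ∀ q x D V → q * (q * x * (q * x) * D + 2 * (V * (q * (x * x * x)))) ≡ q * x * (q * x) * (q * D) + 2 * V * (q * q * (x * x * x))
      arith₁ = solve-∀
      arith₂ : ∀ q x l V → q * x * (q * x) * (2 * l * x) + 2 * V * (q * q * (x * x * x)) + (1 + 2 * V + 4 * l * V) * (q * q * (x * x * x))
               ≡ q * ((2 * l + 1 + 4 * (l + 1) * V) * (q * (x * x * x) * 1))
      arith₂ = solve-∀
      per-label : ∀ ζ → ∑ (labels l) (λ z → (adm [] ζ z + 0) * (labelDeviation ζ z * labelDeviation ζ z)) ≤ ⟦ proj₂ ζ ≟ 0F ⟧ * (V * (q * (x * x * x)))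
      per-label ζ = ≤-trans (≤-reflexive (trans (∑-*ˡ (labels l) (⟦ proj₂ ζ ≟ 0F ⟧ + 0) _) (cong (_* ∑ (labels l) (λ z → labelDeviation ζ z * labelDeviation ζ z)) (+-identityʳ ⟦ proj₂ ζ ≟ 0F ⟧))))
        (*-monoʳ-≤ ⟦ proj₂ ζ ≟ 0F ⟧ (labelVariance ζ))
      ∑-adm : ∑ Label-list (λ ζ → ⟦ proj₂ ζ ≟ 0F ⟧ * (V * (q * (x * x * x)))) ≡ 2 * (V * (q * (x * x * x)))
      ∑-adm = trans (∑-*ʳ Label-list (λ ζ → ⟦ proj₂ ζ ≟ 0F ⟧) _) (cong (_* (V * (q * (x * x * x)))) (trans (∑-Label (λ ζ → ⟦ proj₂ ζ ≟ 0F ⟧)) (cong₂ _+_ (Finite.once finite 0F) (Finite.once finite 0F))))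
      pointwise : ∀ g h → deviation g h * deviation g h ≤ q * x * (q * x) * degenerate g 1F [] h + majorant adm g h
      pointwise [] h with degenerate [] 1F [] h in eq
      ... | suc d = ≤-trans (*-mono-≤ (deviation≤ [] h) (deviation≤ [] h)) (≤-trans (≤-trans (≤-reflexive (sym (*-identityʳ _))) (*-monoʳ-≤ (q * x * (q * x)) (s≤s z≤n))) (m≤m+n _ (majorant adm [] h)))
      ... | zero = ≤-trans (deviation≤majorant adm [] h P (≤-reflexive (sym (⟦⟧-yes (proj₂ ζ ≟ 0F) ζ≡0)))) (m≤n+m (majorant adm [] h) (q * x * (q * x) * 0))
        where
        P = parametrize [] 1F [] h 1≢0 eq
        ζ = Parametrization.ζ P
        lastH≢0 : ∀ {k} h hs (v : Vec Carrier k) → h ≢ 0F → degenerate [] h hs v ≡ 0 → lastH h v ≢ 0F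
        lastH≢0 h hs [] h≢0 _ = h≢0
        lastH≢0 h hs (x ∷ v) h≢0 nd = lastH≢0 x (h ∷ hs) v
          (λ e → 1+n≢0 (trans (sym (⟦⟧-yes (x ≟ 0F) e)) (m+n≡0⇒m≡0 _ (m+n≡0⇒m≡0 _ nd))))
          (m+n≡0⇒n≡0 (⟦ x ≟ 0F ⟧ + ⟦ x ⊕ 0F ≟ 0F ⟧) nd)
        ζ≡0 : proj₂ ζ ≡ 0F
        ζ≡0 with proj₂ ζ ≟ 0F
        ... | yes e = e
        ... | no ne = ⊥-elim (⊗≢0 ne (lastH≢0 1F [] h 1≢0 eq) (Parametrization.final P))

    headOr0 : List Carrier → Carrier
    headOr0 [] = 0F
    headOr0 (h ∷ hs) = h

    -- The case headOr0 hs = 0 is already covered by degenerate.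
    collapseAt : ∀ {m} → Vec Carrier m → List Carrier → ℕ
    collapseAt g hs with headOr0 hs ≟ 0F
    ... | yes _ = 0
    ... | no _ = ⟦ dot g hs ≟ 0F ⟧

    -- Among the nondegenerate pairs it marks those with last ratio 0, which `closing-count`
    -- excludes.
    collapse : ∀ {m} → Vec Carrier m → Vec Carrier l → ℕ
    collapse g h = collapseAt g (lastHs 1F [] h)

    -- If the head of `hs` is nonzero, exactly one value of the first entry of `g` solves `dot g hs`
    -- = 0.
    ∑-collapseAt : ∀ m hs → ∑ (vectors (suc m)) (λ g → collapseAt g hs) ≤ q ^ m
    ∑-collapseAt m [] with 0F ≟ 0F
    ... | yes _ = ≤-trans (≤-reflexive (∑-zero (vectors (suc m)))) z≤n
    ... | no ne = ⊥-elim (ne refl)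
    ∑-collapseAt m (h′ ∷ hs) with h′ ≟ 0F
    ... | yes _ = ≤-trans (≤-reflexive (∑-zero (vectors (suc m)))) z≤n
    ... | no ne = ≤-reflexive (begin
      ∑ (vectors (suc m)) (λ g → ⟦ dot g (h′ ∷ hs) ≟ 0F ⟧) ≡⟨ ∑-∷ finite m (λ g → ⟦ dot g (h′ ∷ hs) ≟ 0F ⟧) ⟩
      ∑ F (λ d → ∑ (vectors m) (λ g → ⟦ d ⊗ h′ ⊕ dot g hs ≟ 0F ⟧)) ≡⟨ ∑-swap F (vectors m) (λ d g → ⟦ d ⊗ h′ ⊕ dot g hs ≟ 0F ⟧) ⟩
      ∑ (vectors m) (λ g → ∑ F (λ d → ⟦ d ⊗ h′ ⊕ dot g hs ≟ 0F ⟧)) ≡⟨ ∑-cong (vectors m) (λ g → trans (∑-cong F (λ d → cong (λ y → ⟦ y ⊕ dot g hs ≟ 0F ⟧) (⊗-comm d h′)))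
                                                                                      (trans (∑-affine ne (dot g hs) (λ y → ⟦ y ≟ 0F ⟧)) (Finite.once finite 0F))) ⟩
      ∑ (vectors m) (λ g → 1) ≡⟨ trans (∑-one (vectors m)) (vectors-size m) ⟩
      q ^ m ∎)
      where open ≡-Reasoning

    ∑-collapse : ∀ m h → ∑ (vectors (suc m)) (λ g → collapse g h) ≤ q ^ m
    ∑-collapse m h = ∑-collapseAt m (lastHs 1F [] h)

    collapse-head : ∀ {m} (g : Vec Carrier m) hs → headOr0 hs ≢ 0F → collapseAt g hs ≡ 0 → dot g hs ≢ 0F
    collapse-head g hs ne z e with headOr0 hs ≟ 0F
    ... | yes y = ne y
    ... | no _ = 1+n≢0 (trans (sym (⟦⟧-yes (dot g hs ≟ 0F) e)) z)

    headOr0≢0 : ∀ {m k} (g : Vec Carrier m) h hs (v : Vec Carrier k) → h ≢ 0F → headOr0 hs ≢ 0F → degenerate g h hs v ≡ 0 →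
                headOr0 (lastHs h hs v) ≢ 0F
    headOr0≢0 g h hs [] h≢0 hs≢0 _ = hs≢0
    headOr0≢0 g h hs (x ∷ v) h≢0 hs≢0 nd = headOr0≢0 g x (h ∷ hs) v
      (λ e → 1+n≢0 (trans (sym (⟦⟧-yes (x ≟ 0F) e)) (m+n≡0⇒m≡0 _ (m+n≡0⇒m≡0 _ nd)))) h≢0
      (m+n≡0⇒n≡0 (⟦ x ≟ 0F ⟧ + ⟦ x ⊕ dot g hs ≟ 0F ⟧) nd)

    headOr0≢0′ : ∀ {m} (g : Vec Carrier m) (h : Vec Carrier l) → degenerate g 1F [] h ≡ 0 → headOr0 (lastHs 1F [] h) ≢ 0F
    headOr0≢0′ g (x ∷ v) nd = headOr0≢0 g x (1F ∷ []) v
      (λ e → 1+n≢0 (trans (sym (⟦⟧-yes (x ≟ 0F) e)) (m+n≡0⇒m≡0 _ (m+n≡0⇒m≡0 _ nd)))) 1≢0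
      (m+n≡0⇒n≡0 (⟦ x ≟ 0F ⟧ + ⟦ x ⊕ dot g [] ≟ 0F ⟧) nd)

    -- Degenerate and collapsed pairs have density O(1/q), so the trivial bound q x for the
    -- deviation is affordable there. All other pairs go to the majorant, whose fibres have at most
    -- 2 (l + 1) q^m / q elements; the sum over the 2 q labels `ζ` returns this q, and each of them
    -- contributes `labelVariance`.
    variance-bound₊ : ∀ m′ → let m = suc m′ ; y = q ^ m in
                      q * ∑ (vectors m) (λ g → ∑ (vectors l) (λ h → deviation g h * deviation g h)) ≤
                      q * (deviationConstant l * (q * (x * x * x) * y))
    variance-bound₊ m′ = begin
      q * ∑ (vectors m) (λ g → ∑ (vectors l) (λ h → deviation g h * deviation g h))
        ≤⟨ *-monoʳ-≤ q (≤-trans (∑-mono (vectors m) (λ g → ∑-mono (vectors l) (pointwise g))) (≤-reflexive (trans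
             (∑-cong (vectors m) (λ g → ∑-+ (vectors l) (λ h → q * x * (q * x) * (degenerate g 1F [] h + collapse g h)) (majorant adm g)))
             (∑-+ (vectors m) (λ g → ∑ (vectors l) (λ h → q * x * (q * x) * (degenerate g 1F [] h + collapse g h))) (λ g → ∑ (vectors l) (majorant adm g)))))) ⟩
      q * (∑ (vectors m) (λ g → ∑ (vectors l) (λ h → q * x * (q * x) * (degenerate g 1F [] h + collapse g h))) + ∑ (vectors m) (λ g → ∑ (vectors l) (majorant adm g)))
        ≡⟨ cong₂ (λ a b → q * (a + b))
             (trans (∑-cong (vectors m) (λ g → trans (∑-*ˡ (vectors l) (q * x * (q * x)) (λ h → degenerate g 1F [] h + collapse g h)) (cong (q * x * (q * x) *_) (∑-+ (vectors l) (degenerate g 1F []) (collapse g)))))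
             (trans (∑-*ˡ (vectors m) (q * x * (q * x)) (λ g → ∑ (vectors l) (degenerate g 1F []) + ∑ (vectors l) (collapse g))) (cong (q * x * (q * x) *_) (∑-+ (vectors m) (λ g → ∑ (vectors l) (degenerate g 1F [])) (λ g → ∑ (vectors l) (collapse g))))))
             (∑-majorant adm) ⟩
      q * (q * x * (q * x) * (D + K) + ∑ Label-list (λ ζ → ∑ (labels l) (λ z → count ζ z * (labelDeviation ζ z * labelDeviation ζ z))))
        ≡⟨ trans (distribute q x D K _) (cong (q * x * (q * x) * (q * D + q * K) +_) (trans (sym (∑-*ˡ Label-list q _))
             (∑-cong Label-list (λ ζ → trans (sym (∑-*ˡ (labels l) q _)) (∑-cong (labels l) (λ z → sym (*-assoc q (count ζ z) _))))))) ⟩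
      q * x * (q * x) * (q * D + q * K) + ∑ Label-list (λ ζ → ∑ (labels l) (λ z → q * count ζ z * (labelDeviation ζ z * labelDeviation ζ z)))
        ≤⟨ +-mono-≤ (*-monoʳ-≤ (q * x * (q * x)) (+-mono-≤ qD≤ qK≤)) (∑-mono Label-list (λ ζ → ∑-mono (labels l) (λ z → *-monoˡ-≤ (labelDeviation ζ z * labelDeviation ζ z) (count≤ ζ z)))) ⟩
      q * x * (q * x) * (y * (2 * l * x) + x * y) + ∑ Label-list (λ ζ → ∑ (labels l) (λ z → 2 * ((l + 1) * y) * (labelDeviation ζ z * labelDeviation ζ z)))
        ≤⟨ +-monoʳ-≤ (q * x * (q * x) * (y * (2 * l * x) + x * y)) (≤-trans (∑-bound Label-list (λ ζ → ≤-trans (≤-reflexive (∑-*ˡ (labels l) (2 * ((l + 1) * y)) _)) (*-monoʳ-≤ (2 * ((l + 1) * y)) (labelVariance ζ))))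
             (≤-reflexive (cong (_* (2 * ((l + 1) * y) * (V * (q * (x * x * x))))) (×-size Bool-finite finite)))) ⟩
      q * x * (q * x) * (y * (2 * l * x) + x * y) + 2 * q * (2 * ((l + 1) * y) * (V * (q * (x * x * x))))
        ≡⟨ arith q x y l V ⟩
      q * (deviationConstant l * (q * (x * x * x) * y)) ∎
      where
      open ≤-Reasoning
      m = suc m′
      y = q ^ m
      D = ∑ (vectors m) (λ g → ∑ (vectors l) (degenerate g 1F []))
      K = ∑ (vectors m) (λ g → ∑ (vectors l) (collapse g))
      adm : Vec Carrier m → Label → Vec Label l → ℕ
      adm g ζ z = ⟦ allNonzero? z ⟧ * (⟦ ¬? (proj₂ ζ ≟ 0F) ⟧ * ⟦ closing g 1F [] z (proj₂ ζ) ≟ 0F ⟧)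
      count : Label → Vec Label l → ℕ
      count ζ z = ∑ (vectors m) (λ g → adm g ζ z)
      distribute : ∀ q x D K R → q * (q * x * (q * x) * (D + K) + R) ≡ q * x * (q * x) * (q * D + q * K) + q * R
      distribute = solve-∀
      arith : ∀ q x y l V → q * x * (q * x) * (y * (2 * l * x) + x * y) + 2 * q * (2 * ((l + 1) * y) * (V * (q * (x * x * x))))
              ≡ q * ((2 * l + 1 + 4 * (l + 1) * V) * (q * (x * x * x) * y))
      arith = solve-∀
      qD≤ : q * D ≤ y * (2 * l * x)
      qD≤ = ≤-trans (≤-reflexive (sym (∑-*ˡ (vectors m) q _))) (≤-trans (∑-bound (vectors m) (λ g → ∑-degenerate l g 1F []))
        (≤-reflexive (cong (_* (2 * l * x)) (vectors-size m))))
      qK≤ : q * K ≤ x * y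
      qK≤ = ≤-trans (*-monoʳ-≤ q (≤-trans (≤-reflexive (∑-swap (vectors m) (vectors l) collapse)) (∑-bound (vectors l) (∑-collapse m′))))
        (≤-reflexive (trans (cong (λ t → q * (t * q ^ m′)) (vectors-size l)) (*-swap q x (q ^ m′))))
      count≤ : ∀ ζ z → q * count ζ z ≤ 2 * ((l + 1) * y)
      count≤ ζ z with allNonzero? z | proj₂ ζ ≟ 0F
      ... | no _ | _ = ≤-trans (≤-reflexive (trans (cong (q *_) (∑-zero (vectors m))) (*-zeroʳ q))) z≤n
      ... | yes _ | yes _ = ≤-trans (≤-reflexive (trans (cong (q *_) (∑-zero (vectors m))) (*-zeroʳ q))) z≤n
      ... | yes nz | no ne = ≤-trans (≤-reflexive (cong (q *_) (∑-cong (vectors m) (λ g → trans (+-identityʳ _) (+-identityʳ _))))) (closing-count m nz ne)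
      big : ∀ g h → 1 ≤ degenerate g 1F [] h + collapse g h →
            deviation g h * deviation g h ≤ q * x * (q * x) * (degenerate g 1F [] h + collapse g h) + majorant adm g h
      big g h one = ≤-trans (*-mono-≤ (deviation≤ g h) (deviation≤ g h)) (≤-trans (≤-trans (≤-reflexive (sym (*-identityʳ _))) (*-monoʳ-≤ (q * x * (q * x)) one)) (m≤m+n _ (majorant adm g h)))
      pointwise : ∀ g h → deviation g h * deviation g h ≤ q * x * (q * x) * (degenerate g 1F [] h + collapse g h) + majorant adm g h
      pointwise g h with degenerate g 1F [] h in eq | collapse g h in eq′
      ... | suc d | c = subst₂ (λ a b → deviation g h * deviation g h ≤ q * x * (q * x) * (a + b) + majorant adm g h) eq eq′
                          (big g h (≤-trans (≤-trans (s≤s z≤n) (≤-reflexive (sym eq))) (m≤m+n _ _)))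
      ... | zero | suc c = subst₂ (λ a b → deviation g h * deviation g h ≤ q * x * (q * x) * (a + b) + majorant adm g h) eq eq′
                          (big g h (≤-trans (≤-trans (s≤s z≤n) (≤-reflexive (sym eq′))) (m≤n+m _ (degenerate g 1F [] h))))
      ... | zero | zero = ≤-trans (deviation≤majorant adm g h P (≤-reflexive (sym (cong₂ _*_ (⟦⟧-yes (allNonzero? (Parametrization.z P)) (Parametrization.nonzero P))
                            (cong₂ _*_ (⟦⟧-yes (¬? (proj₂ ζ ≟ 0F)) ζ≢0) (⟦⟧-yes (closing g 1F [] (Parametrization.z P) (proj₂ ζ) ≟ 0F) (Parametrization.closes P)))))))
                            (m≤n+m (majorant adm g h) (q * x * (q * x) * (0 + 0)))
        where
        P = parametrize g 1F [] h 1≢0 eq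
        ζ = Parametrization.ζ P
        ζ≢0 : proj₂ ζ ≢ 0F
        ζ≢0 e = collapse-head g (lastHs 1F [] h) (headOr0≢0′ g h eq) eq′ (trans (sym (Parametrization.final P)) (trans (cong (_⊗ lastH 1F h) e) (⊗-zeroˡ _)))

    variance-bound : ∀ m → ∑ (vectors m) (λ g → ∑ (vectors l) (λ h → deviation g h * deviation g h)) ≤
                     deviationConstant l * (q * (x * x * x) * q ^ m)
    variance-bound zero = *-cancelˡ-≤ q {{>-nonZero 1≤q}} variance-bound₀
    variance-bound (suc m) = *-cancelˡ-≤ q {{>-nonZero 1≤q}} (variance-bound₊ m)

    module _ (m : ℕ) (β : Vec Carrier l → ℕ) (β≤1 : ∀ h → β h ≤ 1) where

      private
        y = q ^ m
        C = deviationConstant l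

      bilinear : ℕ
      bilinear = ∑ (vectors (suc m)) (λ g → ∑ (vectors l) (λ h → β h * w (mul g h)))

      totalDeviation : ℕ
      totalDeviation = ∑ (vectors m) (λ g → ∑ (vectors l) (deviation g))

      -- Cauchy-Schwarz over the pairs. The trivial bound has q² in place of q, and this is the
      -- whole saving of order q^(-1/2).
      totalDeviation² : totalDeviation * totalDeviation ≤ C * (q * (x * x * x * x) * (y * y))
      totalDeviation² = begin
        totalDeviation * totalDeviation ≡⟨ cong₂ _*_ flat flat ⟨
        ∑ pairs dev * ∑ pairs dev ≤⟨ cauchy-schwarz pairs dev ⟩
        length pairs * ∑ pairs (λ p → dev p * dev p) ≡⟨ cong₂ _*_ (trans (×-size (Vec-finite finite m) (Vec-finite finite l)) (cong₂ _*_ (vectors-size m) (vectors-size l)))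
                                                              (∑-cartesian _,_ (vectors m) (vectors l) (λ p → dev p * dev p)) ⟩
        y * x * ∑ (vectors m) (λ g → ∑ (vectors l) (λ h → deviation g h * deviation g h)) ≤⟨ *-monoʳ-≤ (y * x) (variance-bound m) ⟩
        y * x * (C * (q * (x * x * x) * y)) ≡⟨ arith y x C q ⟩
        C * (q * (x * x * x * x) * (y * y)) ∎
        where
        open ≤-Reasoning
        pairs = Finite.elems (×-finite (Vec-finite finite m) (Vec-finite finite l))
        dev : Vec Carrier m × Vec Carrier l → ℕ
        dev (g , h) = deviation g h
        flat : ∑ pairs dev ≡ totalDeviation
        flat = ∑-cartesian _,_ (vectors m) (vectors l) dev
        arith : ∀ y x C q → y * x * (C * (q * (x * x * x) * y)) ≡ C * (q * (x * x * x * x) * (y * y))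
        arith = solve-∀

      -- c is the head of the first factor in `bilinear`. Summing over it first leaves `mass`,
      -- because neither `β` nor `W₂` involves c.
      main-sum : q ^ l * bilinear ≡ ∑ (vectors l) (λ h → ∑ (vectors m) (λ g → β h * W₂ g 1F [] h * mass g h))
      main-sum = begin
        q ^ l * bilinear
          ≡⟨ cong (q ^ l *_) (trans (∑-∷ finite m (λ g → ∑ (vectors l) (λ h → β h * w (mul g h)))) (trans (∑-swap F (vectors m) (λ c g → ∑ (vectors l) (λ h → β h * w (mul (c ∷ g) h))))
               (trans (∑-cong (vectors m) (λ g → ∑-swap F (vectors l) (λ c h → β h * w (mul (c ∷ g) h)))) (∑-swap (vectors m) (vectors l) (λ g h → ∑ F (λ c → β h * w (mul (c ∷ g) h))))))) ⟩
        q ^ l * ∑ (vectors l) (λ h → ∑ (vectors m) (λ g → ∑ F (λ c → β h * w (mul (c ∷ g) h))))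
          ≡⟨ trans (sym (∑-*ˡ (vectors l) (q ^ l) _)) (∑-cong (vectors l) (λ h → trans (sym (∑-*ˡ (vectors m) (q ^ l) _)) (∑-cong (vectors m) (λ g → inner g h)))) ⟩
        ∑ (vectors l) (λ h → ∑ (vectors m) (λ g → β h * W₂ g 1F [] h * mass g h)) ∎
        where
        open ≡-Reasoning
        shuffle : ∀ b a c → b * (a * c) ≡ b * c * a
        shuffle = solve-∀
        inner : ∀ g h → q ^ l * ∑ F (λ c → β h * w (mul (c ∷ g) h)) ≡ β h * W₂ g 1F [] h * mass g h
        inner g h = trans (cong (q ^ l *_) (trans (∑-cong F (λ c → trans (cong (β h *_) (w-mulFrom c g 1F [] h)) (shuffle (β h) (W₁ c g 1F [] h) (W₂ g 1F [] h))))
          (∑-*ˡ F (β h * W₂ g 1F [] h) (λ c → W₁ c g 1F [] h)))) (*-swap (q ^ l) (β h * W₂ g 1F [] h) (∑ F (λ c → W₁ c g 1F [] h)))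

      middle : ℕ
      middle = ∑ (vectors l) (λ h → ∑ (vectors m) (λ g → β h * W₂ g 1F [] h * M))

      βW₂≤1 : ∀ g h → β h * W₂ {m} g 1F [] h ≤ 1
      βW₂≤1 g h = *-mono-≤ (β≤1 h) (w≤1 (tails g (lastH 1F h ∷ lastHs 1F [] h)))

      main-middle : ∣ q ^ l * bilinear - middle ∣ ≤ totalDeviation
      main-middle = begin
        ∣ q ^ l * bilinear - middle ∣ ≡⟨ cong (λ a → ∣ a - middle ∣) main-sum ⟩
        ∣ ∑ (vectors l) (λ h → ∑ (vectors m) (λ g → β h * W₂ g 1F [] h * mass g h)) - middle ∣
          ≤⟨ ≤-trans (∑-∣-∣ (vectors l) _ _) (∑-mono (vectors l) (λ h → ≤-trans (∑-∣-∣ (vectors m) _ _) (∑-mono (vectors m) (λ g →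
               ≤-trans (≤-reflexive (sym (*-distribˡ-∣-∣ (β h * W₂ g 1F [] h) _ _))) (≤-trans (*-monoˡ-≤ _ (βW₂≤1 g h)) (≤-reflexive (*-identityˡ _))))))) ⟩
        ∑ (vectors l) (λ h → ∑ (vectors m) (λ g → deviation g h)) ≡⟨ ∑-swap (vectors l) (vectors m) _ ⟩
        totalDeviation ∎
        where open ≤-Reasoning

      target : ℕ
      target = s ^ (l + suc m) * ∑ (vectors l) β

      -- `∑-tails` evaluates the sum of `W₂` exactly unless the last coefficient of `h` is 0, and
      -- only one in q of the `h` is exceptional.
      middle-target : ∣ middle - target ∣ ≤ x * x * y
      middle-target = begin
        ∣ middle - target ∣
          ≡⟨ cong₂ ∣_-_∣ (∑-cong (vectors l) (λ h → trans (∑-cong (vectors m) (λ g → shuffle (β h) (W₂ g 1F [] h) M)) (∑-*ˡ (vectors m) (β h * M) _)))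
               (trans (cong (_* ∑ (vectors l) β) (trans (cong (s ^_) (+-suc l m)) (^-distribˡ-+-* s (suc l) m))) (trans (sym (∑-*ˡ (vectors l) (M * s ^ m) β)) (∑-cong (vectors l) (λ h → shuffle₂ M (s ^ m) (β h))))) ⟩
        ∣ ∑ (vectors l) (λ h → β h * M * S h) - ∑ (vectors l) (λ h → β h * M * s ^ m) ∣
          ≤⟨ ≤-trans (∑-∣-∣ (vectors l) _ _) (∑-mono (vectors l) (λ h → ≤-trans (≤-reflexive (sym (*-distribˡ-∣-∣ (β h * M) _ _)))
               (≤-trans (*-mono-≤ (*-monoˡ-≤ M (β≤1 h)) (defect h)) (≤-reflexive (shuffle₃ M ⟦ lastH 1F h ≟ 0F ⟧ y))))) ⟩
        ∑ (vectors l) (λ h → M * y * ⟦ lastH 1F h ≟ 0F ⟧)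
          ≡⟨ trans (∑-*ˡ (vectors l) (M * y) _) (cong (M * y *_) (∑-lastH k 1F)) ⟩
        M * y * q ^ k
          ≤⟨ *-monoˡ-≤ (q ^ k) (*-monoˡ-≤ y (^-monoˡ-≤ (suc l) s≤q)) ⟩
        q * x * y * q ^ k
          ≡⟨ arith q x y (q ^ k) ⟩
        x * x * y ∎
        where
        open ≤-Reasoning
        S : Vec Carrier l → ℕ
        S h = ∑ (vectors m) (λ g → W₂ g 1F [] h)
        shuffle : ∀ a b c → a * b * c ≡ a * c * b
        shuffle = solve-∀
        shuffle₂ : ∀ a b c → a * b * c ≡ c * a * b
        shuffle₂ = solve-∀
        shuffle₃ : ∀ a b c → 1 * a * (b * c) ≡ a * c * b
        shuffle₃ = solve-∀
        arith : ∀ q x y z → q * x * y * z ≡ x * (q * z) * y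
        arith = solve-∀
        defect : ∀ h → ∣ S h - s ^ m ∣ ≤ ⟦ lastH 1F h ≟ 0F ⟧ * y
        defect h with lastH 1F h ≟ 0F
        ... | no ne = ≤-reflexive (trans (cong (λ a → ∣ a - s ^ m ∣) (∑-tails m (lastHs 1F [] h) ne)) (∣n-n∣≡0 (s ^ m)))
        ... | yes e = ≤-trans (∣m-n∣≤m⊔n (S h) (s ^ m)) (≤-trans (⊔-lub
                (≤-trans (∑-bound (vectors m) (λ g → w≤1 (tails g (lastH 1F h ∷ lastHs 1F [] h)))) (≤-reflexive (trans (*-identityʳ _) (vectors-size m))))
                (^-monoˡ-≤ m s≤q)) (≤-reflexive (sym (+-identityʳ y))))

      bilinear-estimate : ∣ q ^ l * bilinear - target ∣ * ∣ q ^ l * bilinear - target ∣ * q ≤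
                          2 * (C + 1) * (q ^ (l + suc m) * q ^ l * (q ^ (l + suc m) * q ^ l))
      bilinear-estimate = begin
        e * e * q ≤⟨ *-monoˡ-≤ q (*-mono-≤ e≤ e≤) ⟩
        (T + R) * (T + R) * q ≤⟨ *-monoˡ-≤ q (square-+ T R) ⟩
        2 * (T * T + R * R) * q ≤⟨ *-monoˡ-≤ q (*-monoʳ-≤ 2 (+-mono-≤ totalDeviation² (≤-trans (≤-reflexive (sym (*-identityˡ (R * R)))) (*-monoˡ-≤ (R * R) 1≤q)))) ⟩
        2 * (C * (q * (x * x * x * x) * (y * y)) + q * (R * R)) * q ≡⟨ arith C q x y ⟩
        2 * (C + 1) * (x * (q * y) * x * (x * (q * y) * x)) ≡⟨ cong (λ t → 2 * (C + 1) * (t * x * (t * x))) (^-distribˡ-+-* q l (suc m)) ⟨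
        2 * (C + 1) * (q ^ (l + suc m) * q ^ l * (q ^ (l + suc m) * q ^ l)) ∎
        where
        open ≤-Reasoning
        e = ∣ q ^ l * bilinear - target ∣
        T = totalDeviation
        R = x * x * y
        e≤ : e ≤ T + R
        e≤ = ≤-trans (∣-∣-triangle (q ^ l * bilinear) middle target) (+-mono-≤ main-middle middle-target)
        arith : ∀ C q x y → 2 * (C * (q * (x * x * x * x) * (y * y)) + q * (x * x * y * (x * x * y))) * q
                ≡ 2 * (C + 1) * (x * (q * y) * x * (x * (q * y) * x))
        arith = solve-∀

-- The polynomial ring: division, Bézout and Euclid's lemma.

module PolynomialRing (𝔽 : DiscreteFiniteField) where
  open FieldTheory 𝔽
  open Solver using (solve; _:+_; _:*_; _:=_; con)

  Series : Set
  Series = ℕ → Carrier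

  conv : Series → Series → Series
  conv p r zero = p 0 ⊗ r 0
  conv p r (suc i) = p 0 ⊗ r (suc i) ⊕ conv (p ∘ suc) r i

  conv-cong : ∀ {p p′ r r′ : Series} → (∀ i → p i ≡ p′ i) → (∀ i → r i ≡ r′ i) → ∀ i → conv p r i ≡ conv p′ r′ i
  conv-cong e f zero = cong₂ _⊗_ (e 0) (f 0)
  conv-cong e f (suc i) = cong₂ _⊕_ (cong₂ _⊗_ (e 0) (f (suc i))) (conv-cong (e ∘ suc) f i)

  conv-zeroˡ : ∀ {p : Series} r → (∀ i → p i ≡ 0F) → ∀ i → conv p r i ≡ 0F
  conv-zeroˡ r e zero = trans (cong (_⊗ r 0) (e 0)) (⊗-zeroˡ _)
  conv-zeroˡ r e (suc i) = trans (cong₂ _⊕_ (trans (cong (_⊗ r (suc i)) (e 0)) (⊗-zeroˡ _)) (conv-zeroˡ r (e ∘ suc) i)) (⊕-identityˡ _)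

  conv-scaleˡ : ∀ a p r i → conv (λ j → a ⊗ p j) r i ≡ a ⊗ conv p r i
  conv-scaleˡ a p r zero = ⊗-assoc a _ _
  conv-scaleˡ a p r (suc i) = trans (cong₂ _⊕_ (⊗-assoc a _ _) (conv-scaleˡ a (p ∘ suc) r i)) (sym (⊗-distribˡ a _ _))

  conv-⊕ˡ : ∀ p p′ r i → conv (λ j → p j ⊕ p′ j) r i ≡ conv p r i ⊕ conv p′ r i
  conv-⊕ˡ p p′ r zero = ⊗-distribʳ _ _ _
  conv-⊕ˡ p p′ r (suc i) = trans (cong₂ _⊕_ (⊗-distribʳ _ _ _) (conv-⊕ˡ (p ∘ suc) (p′ ∘ suc) r i))
    (solve 4 (λ a b c d → (a :+ b) :+ (c :+ d) := (a :+ c) :+ (b :+ d)) refl _ _ _ _)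

  conv-sucʳ : ∀ p r i → conv p r (suc i) ≡ conv p (r ∘ suc) i ⊕ p (suc i) ⊗ r 0
  conv-sucʳ p r zero = refl
  conv-sucʳ p r (suc i) = trans (cong (p 0 ⊗ r (suc (suc i)) ⊕_) (conv-sucʳ (p ∘ suc) r i)) (sym (⊕-assoc _ _ _))

  conv-comm : ∀ p r i → conv p r i ≡ conv r p i
  conv-comm p r zero = ⊗-comm _ _
  conv-comm p r (suc i) = begin
    p 0 ⊗ r (suc i) ⊕ conv (p ∘ suc) r i ≡⟨ cong₂ _⊕_ (⊗-comm _ _) (conv-comm (p ∘ suc) r i) ⟩
    r (suc i) ⊗ p 0 ⊕ conv r (p ∘ suc) i ≡⟨ ⊕-comm _ _ ⟩
    conv r (p ∘ suc) i ⊕ r (suc i) ⊗ p 0 ≡⟨ conv-sucʳ r p i ⟨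
    conv r p (suc i) ∎
    where open ≡-Reasoning

  conv-assoc : ∀ p r t i → conv (conv p r) t i ≡ conv p (conv r t) i
  conv-assoc p r t zero = ⊗-assoc _ _ _
  conv-assoc p r t (suc i) = begin
    (p 0 ⊗ r 0) ⊗ t (suc i) ⊕ conv (λ j → p 0 ⊗ r (suc j) ⊕ conv (p ∘ suc) r j) t i
      ≡⟨ cong ((p 0 ⊗ r 0) ⊗ t (suc i) ⊕_) (trans (conv-⊕ˡ _ _ t i) (cong₂ _⊕_ (conv-scaleˡ (p 0) (r ∘ suc) t i) (conv-assoc (p ∘ suc) r t i))) ⟩
    (p 0 ⊗ r 0) ⊗ t (suc i) ⊕ (p 0 ⊗ conv (r ∘ suc) t i ⊕ conv (p ∘ suc) (conv r t) i)
      ≡⟨ solve 5 (λ a b c d e → (a :* b) :* c :+ (a :* d :+ e) := a :* (b :* c :+ d) :+ e) refl (p 0) (r 0) (t (suc i)) _ _ ⟩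
    p 0 ⊗ (r 0 ⊗ t (suc i) ⊕ conv (r ∘ suc) t i) ⊕ conv (p ∘ suc) (conv r t) i ∎
    where open ≡-Reasoning

  Below : ℕ → Series → Set
  Below N p = ∀ i → N ≤ i → p i ≡ 0F

  Below-weaken : ∀ {M N p} → M ≤ N → Below M p → Below N p
  Below-weaken M≤N b i N≤i = b i (≤-trans M≤N N≤i)

  conv-below : ∀ a b {p r} → Below (suc a) p → Below (suc b) r → Below (suc (a + b)) (conv p r)
  conv-below zero b P R (suc i) (s≤s le) = trans (cong₂ _⊕_ (trans (cong (_ ⊗_) (R (suc i) (s≤s le))) (⊗-zeroʳ _))
    (conv-zeroˡ _ (λ j → P (suc j) (s≤s z≤n)) i)) (⊕-identityˡ _)
  conv-below (suc a) b P R (suc i) (s≤s le) = trans (cong₂ _⊕_ (trans (cong (_ ⊗_) (R (suc i) (s≤s (≤-trans (m≤n+m b (suc a)) le)))) (⊗-zeroʳ _))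
    (conv-below a b (λ j le′ → P (suc j) (s≤s le′)) R i le)) (⊕-identityˡ _)

  conv-top : ∀ a b {p r} → Below (suc a) p → Below (suc b) r → conv p r (a + b) ≡ p a ⊗ r b
  conv-top zero zero P R = refl
  conv-top zero (suc b) P R = trans (cong (_ ⊕_) (conv-zeroˡ _ (λ j → P (suc j) (s≤s z≤n)) b)) (⊕-identityʳ _)
  conv-top (suc a) b P R = trans (cong₂ _⊕_ (trans (cong (_ ⊗_) (R (suc (a + b)) (s≤s (m≤n+m b a)))) (⊗-zeroʳ _))
    (conv-top a b (λ j le → P (suc j) (s≤s le)) R)) (⊕-identityˡ _)

  -- `bound` need not be sharp, and `_≈_` ignores it; it gives the search for a leading coefficient
  -- a starting point.
  record Pol : Set where
    constructor pol
    field
      co : Series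
      bound : ℕ
      below : Below bound co
  open Pol public

  infix 4 _≈_
  infixl 6 _+ₚ_
  infixl 7 _*ₚ_

  record _≈_ (p r : Pol) : Set where
    constructor coefficientwise
    field coefficients : ∀ i → co p i ≡ co r i
  open _≈_ public

  constant : Carrier → Pol
  constant a = pol (λ { zero → a ; (suc _) → 0F }) 1 (λ { (suc i) _ → refl })

  0ₚ 1ₚ : Pol
  0ₚ = pol (λ _ → 0F) 0 (λ _ _ → refl)
  1ₚ = constant 1F

  open Algebra.Properties.Ring (CommutativeRing.ring commutativeRing) using (-0#≈0#)

  conv-constantˡ : ∀ a r i → conv (co (constant a)) r i ≡ a ⊗ r i
  conv-constantˡ a r zero = refl
  conv-constantˡ a r (suc i) = trans (cong (_ ⊕_) (conv-zeroˡ r (λ _ → refl) i)) (⊕-identityʳ _)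

  ≈-isEquivalence : IsEquivalence _≈_
  ≈-isEquivalence = record
    { refl = coefficientwise (λ _ → refl)
    ; sym = λ e → coefficientwise (λ i → sym (coefficients e i))
    ; trans = λ e f → coefficientwise (λ i → trans (coefficients e i) (coefficients f i)) }

  -- Opaque, so that unification does not look into the degree bounds.
  opaque
    _+ₚ_ _*ₚ_ : Pol → Pol → Pol
    p +ₚ r = pol (λ i → co p i ⊕ co r i) (bound p + bound r) (λ i le → trans
      (cong₂ _⊕_ (below p i (≤-trans (m≤m+n _ _) le)) (below r i (≤-trans (m≤n+m _ (bound p)) le))) (⊕-identityʳ _))
    p *ₚ r = pol (conv (co p) (co r)) (suc (bound p + bound r))
      (conv-below (bound p) (bound r) (Below-weaken (n≤1+n _) (below p)) (Below-weaken (n≤1+n _) (below r)))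

    -ₚ_ : Pol → Pol
    -ₚ p = pol (λ i → ⊖ co p i) (bound p) (λ i le → trans (cong ⊖_ (below p i le)) -0#≈0#)

    co-+ : ∀ p r i → co (p +ₚ r) i ≡ co p i ⊕ co r i
    co-+ p r i = refl

    co-* : ∀ p r i → co (p *ₚ r) i ≡ conv (co p) (co r) i
    co-* p r i = refl

    co-neg : ∀ p i → co (-ₚ p) i ≡ ⊖ co p i
    co-neg p i = refl

    pol-isCommutativeRing : IsCommutativeRing _≈_ _+ₚ_ _*ₚ_ -ₚ_ 0ₚ 1ₚ
    pol-isCommutativeRing = record
      { isRing = record
        { +-isAbelianGroup = record
          { isGroup = record
            { isMonoid = record
              { isSemigroup = record
                { isMagma = record
                  { isEquivalence = ≈-isEquivalence
                  ; ∙-cong = λ e f → coefficientwise (λ i → cong₂ _⊕_ (coefficients e i) (coefficients f i)) }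
                ; assoc = λ p r t → coefficientwise (λ i → ⊕-assoc _ _ _) }
              ; identity = (λ p → coefficientwise (λ i → ⊕-identityˡ _)) , (λ p → coefficientwise (λ i → ⊕-identityʳ _)) }
            ; inverse = (λ p → coefficientwise (λ i → ⊖-inverseˡ _)) , (λ p → coefficientwise (λ i → ⊖-inverseʳ _))
            ; ⁻¹-cong = λ e → coefficientwise (λ i → cong ⊖_ (coefficients e i)) }
          ; comm = λ p r → coefficientwise (λ i → ⊕-comm _ _) }
        ; *-cong = λ e f → coefficientwise (conv-cong (coefficients e) (coefficients f))
        ; *-assoc = λ p r t → coefficientwise (conv-assoc (co p) (co r) (co t))
        ; *-identity = (λ p → coefficientwise (one (co p))) , (λ p → coefficientwise (λ i → trans (conv-comm (co p) (co 1ₚ) i) (one (co p) i)))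
        ; distrib = (λ p r t → coefficientwise (λ i → trans (conv-comm (co p) _ i) (trans (conv-⊕ˡ (co r) (co t) (co p) i)
                      (cong₂ _⊕_ (conv-comm (co r) (co p) i) (conv-comm (co t) (co p) i)))))
                  , (λ p r t → coefficientwise (λ i → conv-⊕ˡ (co r) (co t) (co p) i)) }
      ; *-comm = λ p r → coefficientwise (conv-comm (co p) (co r)) }
      where
      one : ∀ r i → conv (co 1ₚ) r i ≡ r i
      one r i = trans (conv-constantˡ 1F r i) (⊗-identityˡ _)

  polynomialRing : CommutativeRing 0ℓ 0ℓ
  polynomialRing = record { isCommutativeRing = pol-isCommutativeRing }

  *-below : ∀ a b {p r} → Below (suc a) (co p) → Below (suc b) (co r) → Below (suc (a + b)) (co (p *ₚ r))
  *-below a b P R i le = trans (co-* _ _ i) (conv-below a b P R i le)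

  *-top : ∀ a b {p r} → Below (suc a) (co p) → Below (suc b) (co r) → co (p *ₚ r) (a + b) ≡ co p a ⊗ co r b
  *-top a b P R = trans (co-* _ _ (a + b)) (conv-top a b P R)

  constant-* : ∀ a r i → co (constant a *ₚ r) i ≡ a ⊗ co r i
  constant-* a r i = trans (co-* _ r i) (conv-constantˡ a (co r) i)

  module ℙ = CommutativeRing polynomialRing
  module PolySolver = Algebra.Solver.Ring.NaturalCoefficients.Default ℙ.commutativeSemiring
  open PolySolver public using () renaming (solve to solveₚ; _:+_ to _⊞_; _:*_ to _⊠_; _:=_ to _≜_)
  module PolyReasoning = Relation.Binary.Reasoning.Setoid ℙ.setoid

  monomial : Carrier → ℕ → Pol
  monomial a zero = constant a
  monomial a (suc k) = pol (λ { zero → 0F ; (suc i) → co (monomial a k) i }) (suc (bound (monomial a k)))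
    (λ { (suc i) (s≤s le) → below (monomial a k) i le })

  monomial-top : ∀ a k → co (monomial a k) k ≡ a
  monomial-top a zero = refl
  monomial-top a (suc k) = monomial-top a k

  monomial-below : ∀ a k → Below (suc k) (co (monomial a k))
  monomial-below a zero = λ { (suc i) _ → refl }
  monomial-below a (suc k) = λ { (suc i) (s≤s le) → monomial-below a k i le }

  Monic : ℕ → Pol → Set
  Monic n p = co p n ≡ 1F × Below (suc n) (co p)

  leading : ∀ N (p : Pol) → Below N (co p) → p ≈ 0ₚ ⊎ ∃[ e ] e < N × co p e ≢ 0F × Below (suc e) (co p)
  leading zero p b = inj₁ (coefficientwise (λ i → b i z≤n))
  leading (suc N) p b with co p N ≟ 0F
  ... | no ne = inj₂ (N , ≤-refl , ne , b)
  ... | yes z with leading N p (λ i N≤i → case i N≤i)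
    where
    case : ∀ i → N ≤ i → co p i ≡ 0F
    case i N≤i with m≤n⇒m<n∨m≡n N≤i
    ... | inj₁ N<i = b i N<i
    ... | inj₂ refl = z
  ... | inj₁ e = inj₁ e
  ... | inj₂ (e , e<N , rest) = inj₂ (e , <-trans e<N ≤-refl , rest)

  normalize : ∀ {e} (r : Pol) → co r e ≢ 0F → Below (suc e) (co r) → ∃[ a ] Monic e (constant a *ₚ r)
  normalize {e} r ne b = inv ne , trans (constant-* _ r e) (trans (⊗-comm _ _) (⊗-inv ne)) ,
    λ i le → trans (constant-* _ r i) (trans (cong (inv ne ⊗_) (b i le)) (⊗-zeroʳ _))

  divide : ∀ {l h} → Monic l h → ∀ N p → Below N (co p) → ∃[ c ] ∃[ r ] Below l (co r) × p ≈ c *ₚ h +ₚ r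
  divide {l} {h} (top , bh) N p b with N ≤? l
  ... | yes N≤l = 0ₚ , p , Below-weaken N≤l b , ℙ.sym (ℙ.trans (ℙ.+-cong (ℙ.zeroˡ h) ℙ.refl) (ℙ.+-identityˡ p))
  divide {l} {h} (top , bh) zero p b | no N≰l = ⊥-elim (N≰l z≤n)
  divide {l} {h} (top , bh) (suc N) p b | no N≰l with m≤n⇒∃[o]m+o≡n (s≤s⁻¹ (≰⇒> N≰l))
  ... | k , refl with divide {l} {h} (top , bh) (l + k) p′ below′
    where
    lead = monomial (co p (l + k)) k
    p′ = p +ₚ -ₚ (lead *ₚ h)
    coefficient : ∀ i → co p′ i ≡ co p i ⊕ ⊖ co (lead *ₚ h) i
    coefficient i = trans (co-+ p _ i) (cong (co p i ⊕_) (co-neg (lead *ₚ h) i))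
    product-top : co (lead *ₚ h) (l + k) ≡ co p (l + k)
    product-top = trans (cong (co (lead *ₚ h)) (+-comm l k)) (trans (*-top k l (monomial-below _ k) bh)
      (trans (cong₂ _⊗_ (monomial-top _ k) top) (⊗-identityʳ _)))
    below′ : Below (l + k) (co p′)
    below′ i le with m≤n⇒m<n∨m≡n le
    ... | inj₂ refl = trans (coefficient i) (trans (cong (λ z → co p (l + k) ⊕ ⊖ z) product-top) (⊖-inverseʳ _))
    ... | inj₁ lt = trans (coefficient i) (trans (cong₂ (λ a z → a ⊕ ⊖ z) (b i lt) (*-below k l (monomial-below _ k) bh i (subst (λ z → suc z ≤ i) (+-comm l k) lt)))
                      (⊖-inverseʳ 0F))
  ... | c , r , br , e = c +ₚ lead , r , br , (begin
      p ≈⟨ ℙ.+-identityʳ p ⟨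
      p +ₚ 0ₚ ≈⟨ ℙ.+-cong (ℙ.refl {p}) (ℙ.-‿inverseˡ (lead *ₚ h)) ⟨
      p +ₚ (-ₚ (lead *ₚ h) +ₚ lead *ₚ h) ≈⟨ ℙ.+-assoc p _ _ ⟨
      p +ₚ -ₚ (lead *ₚ h) +ₚ lead *ₚ h ≈⟨ ℙ.+-cong e (ℙ.refl {lead *ₚ h}) ⟩
      c *ₚ h +ₚ r +ₚ lead *ₚ h ≈⟨ solveₚ 4 (λ c h r d → (c ⊠ h ⊞ r) ⊞ d ⊠ h
                                                         ≜ (c ⊞ d) ⊠ h ⊞ r) ℙ.refl c h r lead ⟩
      (c +ₚ lead) *ₚ h +ₚ r ∎)
    where
    open PolyReasoning
    lead = monomial (co p (l + k)) k

  infix 4 _∣ₚ_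
  _∣ₚ_ : Pol → Pol → Set
  h ∣ₚ p = ∃[ c ] c *ₚ h ≈ p

  cofactor-monic : ∀ {c r h e l} → Monic e r → Monic l h → c *ₚ r ≈ h → ∃[ k ] k + e ≡ l × Monic k c
  cofactor-monic {c} {r} {h} {e} {l} (tr , br) (th , bh) eq with leading (bound c) c (below c)
  ... | inj₁ z = ⊥-elim (1≢0 (trans (sym th) (trans (sym (coefficients eq l)) (coefficients (ℙ.trans (ℙ.*-cong z (ℙ.refl {r})) (ℙ.zeroˡ r)) l))))
  ... | inj₂ (k , _ , ne , bc) = k , k+e≡l , trans (sym ck) (trans (coefficients eq (k + e)) (trans (cong (co h) k+e≡l) th)) , bc
    where
    ck : co (c *ₚ r) (k + e) ≡ co c k
    ck = trans (*-top k e bc br) (trans (cong (_ ⊗_) tr) (⊗-identityʳ _))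
    k+e≡l : k + e ≡ l
    k+e≡l with <-cmp (k + e) l
    ... | tri≈ _ e _ = e
    ... | tri< lt _ _ = ⊥-elim (1≢0 (trans (sym th) (trans (sym (coefficients eq l)) (*-below k e bc br l lt))))
    ... | tri> _ _ gt = ⊥-elim (ne (trans (sym ck) (trans (coefficients eq (k + e)) (bh (k + e) gt))))

  monic-cancel : ∀ {c c′ h l} → Monic l h → c *ₚ h ≈ c′ *ₚ h → c ≈ c′
  monic-cancel {c} {c′} {h} {l} (th , bh) eq with leading (bound d) d (below d)
    where d = c +ₚ -ₚ c′
  ... | inj₁ z = coefficientwise (λ i → ⊕≡0 (trans (sym (trans (co-+ c _ i) (cong (co c i ⊕_) (co-neg c′ i)))) (coefficients z i)) (⊖-inverseʳ _))
  ... | inj₂ (k , _ , ne , bd) = ⊥-elim (ne (begin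
      co d k ≡⟨ trans (cong (co d k ⊗_) th) (⊗-identityʳ _) ⟨
      co d k ⊗ co h l ≡⟨ *-top k l bd bh ⟨
      co (d *ₚ h) (k + l) ≡⟨ coefficients (ℙ.trans (ℙ.distribʳ h c (-ₚ c′)) (ℙ.trans (ℙ.+-cong eq (ℙ.sym (-‿distribˡ-* c′ h))) (ℙ.-‿inverseʳ (c′ *ₚ h)))) (k + l) ⟩
      0F ∎))
    where
    open ≡-Reasoning
    open Algebra.Properties.Ring ℙ.ring using (-‿distribˡ-*)
    d = c +ₚ -ₚ c′

  monic₀ : ∀ {p} → Monic 0 p → p ≈ 1ₚ
  monic₀ (t , b) = coefficientwise λ { zero → t ; (suc i) → b (suc i) (s≤s z≤n) }

  -- Only monic factorizations are tested: any factorization of a monic `h` can be rescaled to one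
  -- of these.
  record Irr (l : ℕ) (h : Pol) : Set where
    field
      positive : 1 ≤ l
      monic : Monic l h
      split : ∀ {a b p r} → Monic a p → Monic b r → p *ₚ r ≈ h → a ≡ 0 ⊎ b ≡ 0

  module _ (p h : Pol) where

    Combination : Pol → Set
    Combination r = ∃[ a ] ∃[ b ] r ≈ a *ₚ p +ₚ b *ₚ h

    combination-subtract : ∀ c {r r′} → Combination r → Combination r′ → ∀ {t} → r′ ≈ c *ₚ r +ₚ t → Combination t
    combination-subtract c {r} {r′} (a , b , e) (a′ , b′ , e′) {t} f = a′ +ₚ -ₚ (c *ₚ a) , b′ +ₚ -ₚ (c *ₚ b) , (begin
      t ≈⟨ ℙ.+-identityˡ t ⟨
      0ₚ +ₚ t ≈⟨ ℙ.+-cong (ℙ.-‿inverseˡ (c *ₚ r)) (ℙ.refl {t}) ⟨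
      -ₚ (c *ₚ r) +ₚ c *ₚ r +ₚ t ≈⟨ ℙ.+-assoc _ _ t ⟩
      -ₚ (c *ₚ r) +ₚ (c *ₚ r +ₚ t) ≈⟨ ℙ.+-cong (ℙ.-‿cong (ℙ.*-cong (ℙ.refl {c}) e)) (ℙ.trans (ℙ.sym f) e′) ⟩
      -ₚ (c *ₚ (a *ₚ p +ₚ b *ₚ h)) +ₚ (a′ *ₚ p +ₚ b′ *ₚ h) ≈⟨ ℙ.+-cong (ℙ.-‿cong (ℙ.trans (ℙ.distribˡ c _ _) (ℙ.+-cong (ℙ.sym (ℙ.*-assoc c a p)) (ℙ.sym (ℙ.*-assoc c b h))))) ℙ.refl ⟩
      -ₚ (c *ₚ a *ₚ p +ₚ c *ₚ b *ₚ h) +ₚ (a′ *ₚ p +ₚ b′ *ₚ h) ≈⟨ ℙ.+-cong (ℙ.trans (ℙ.sym (⁻¹-∙-comm _ _)) (ℙ.+-cong (-‿distribˡ-* _ p) (-‿distribˡ-* _ h))) ℙ.refl ⟩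
      -ₚ (c *ₚ a) *ₚ p +ₚ -ₚ (c *ₚ b) *ₚ h +ₚ (a′ *ₚ p +ₚ b′ *ₚ h) ≈⟨ solveₚ 6 (λ x y a b p h → (x ⊠ p ⊞ y ⊠ h) ⊞ (a ⊠ p ⊞ b ⊠ h)
                                                                           ≜ (a ⊞ x) ⊠ p ⊞ (b ⊞ y) ⊠ h) ℙ.refl (-ₚ (c *ₚ a)) (-ₚ (c *ₚ b)) a′ b′ p h ⟩
      (a′ +ₚ -ₚ (c *ₚ a)) *ₚ p +ₚ (b′ +ₚ -ₚ (c *ₚ b)) *ₚ h ∎)
      where
      open PolyReasoning
      open Algebra.Properties.Ring ℙ.ring using (-‿distribˡ-*)
      open Algebra.Properties.AbelianGroup ℙ.+-abelianGroup using (⁻¹-∙-comm)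

    combination-h : Combination h
    combination-h = 0ₚ , 1ₚ , ℙ.sym (ℙ.trans (ℙ.+-cong (ℙ.zeroˡ p) (ℙ.*-identityˡ h)) (ℙ.+-identityˡ h))

    combination-p : Combination p
    combination-p = 1ₚ , 0ₚ , ℙ.sym (ℙ.trans (ℙ.+-cong (ℙ.*-identityˡ p) (ℙ.zeroˡ h)) (ℙ.+-identityʳ p))

    combination-scale : ∀ c {r} → Combination r → Combination (c *ₚ r)
    combination-scale c {r} (a , b , e) = c *ₚ a , c *ₚ b , ℙ.trans (ℙ.*-cong (ℙ.refl {c}) e)
      (ℙ.trans (ℙ.distribˡ c _ _) (ℙ.+-cong (ℙ.sym (ℙ.*-assoc c a p)) (ℙ.sym (ℙ.*-assoc c b h))))

    combination-cong : ∀ {r t} → r ≈ t → Combination r → Combination t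
    combination-cong f (a , b , e) = a , b , ℙ.trans (ℙ.sym f) e

    -- Unlike in the Euclidean algorithm, the dividend is always `h`. A zero remainder would make
    -- `r` a monic factor of `h` of degree strictly between 0 and l, so the degree decreases until
    -- the combination is constant.
    descend : ∀ {l} → Irr l h → ∀ fuel {e r} → e < fuel → e < l → Monic e r → Combination r → Combination 1ₚ
    descend I (suc fuel) {zero} lt lt′ m C = combination-cong (monic₀ m) C
    descend {l} I (suc fuel) {suc e} {r} (s≤s lt) lt′ m C with divide m (bound h) h (below h)
    ... | c , t , bt , eq with leading (suc e) t bt
    ... | inj₁ z = ⊥-elim (no-split (cofactor-monic m (Irr.monic I) c*r≈h))
      where
      c*r≈h : c *ₚ r ≈ h
      c*r≈h = ℙ.sym (ℙ.trans eq (ℙ.trans (ℙ.+-cong (ℙ.refl {c *ₚ r}) z) (ℙ.+-identityʳ (c *ₚ r))))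
      no-split : ¬ (∃[ k ] k + suc e ≡ l × Monic k c)
      no-split (k , ke , mc) with Irr.split I mc m c*r≈h
      ... | inj₁ refl = <-irrefl ke lt′
      ... | inj₂ ()
    ... | inj₂ (e′ , e′<e , ne , bt′) with normalize t ne bt′
    ... | a , mt = descend I fuel (≤-trans e′<e lt) (<-trans e′<e lt′) mt
                (combination-scale (constant a) (combination-subtract c {r} {h} C combination-h eq))

    bezout : ∀ {l} → Irr l h → ¬ (h ∣ₚ p) → Combination 1ₚ
    bezout {l} I h∤p with divide (Irr.monic I) (bound p) p (below p)
    ... | c , t , bt , eq with leading l t bt
    ... | inj₁ z = ⊥-elim (h∤p (c , ℙ.sym (ℙ.trans eq (ℙ.trans (ℙ.+-cong (ℙ.refl {c *ₚ h}) z) (ℙ.+-identityʳ (c *ₚ h))))))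
    ... | inj₂ (e , e<l , ne , bt′) with normalize t ne bt′
    ... | a , mt = descend I (suc e) ≤-refl e<l mt (combination-scale (constant a) (combination-subtract c {h} {p} combination-h combination-p eq))

    euclid : ∀ {l} → Irr l h → ¬ (h ∣ₚ p) → ∀ {k} → h ∣ₚ p *ₚ k → h ∣ₚ k
    euclid I h∤p {k} (c , e) with bezout I h∤p
    ... | a , b , f = a *ₚ c +ₚ b *ₚ k , (begin
      (a *ₚ c +ₚ b *ₚ k) *ₚ h ≈⟨ solveₚ 5 (λ a c b k h → (a ⊠ c ⊞ b ⊠ k) ⊠ h
                                                  ≜ a ⊠ (c ⊠ h) ⊞ b ⊠ h ⊠ k) ℙ.refl a c b k h ⟩
      a *ₚ (c *ₚ h) +ₚ b *ₚ h *ₚ k ≈⟨ ℙ.+-cong (ℙ.*-cong (ℙ.refl {a}) e) (ℙ.refl {b *ₚ h *ₚ k}) ⟩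
      a *ₚ (p *ₚ k) +ₚ b *ₚ h *ₚ k ≈⟨ solveₚ 5 (λ a p b k h → a ⊠ (p ⊠ k) ⊞ b ⊠ h ⊠ k
                                                  ≜ (a ⊠ p ⊞ b ⊠ h) ⊠ k) ℙ.refl a p b k h ⟩
      (a *ₚ p +ₚ b *ₚ h) *ₚ k ≈⟨ ℙ.*-cong f (ℙ.refl {k}) ⟨
      1ₚ *ₚ k ≈⟨ ℙ.*-identityˡ k ⟩
      k ∎)
      where open PolyReasoning

-- Coefficient vectors as monic polynomials.

module MonicPolynomials (𝔽 : DiscreteFiniteField) where
  open FieldTheory 𝔽
  open Recurrence 𝔽
  open BilinearSums 𝔽
  open PolynomialRing 𝔽

  -- Coefficient lists read from the top (high) are reversals of those of the polynomials they encode.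

  high : ∀ {k} → Vec Carrier k → Series
  high [] i = 0F
  high (a ∷ v) zero = a
  high (a ∷ v) (suc i) = high v i

  high-below : ∀ {k} (v : Vec Carrier k) → Below k (high v)
  high-below [] i _ = refl
  high-below (a ∷ v) (suc i) (s≤s le) = high-below v i le

  reversal : ℕ → Series → Pol
  reversal zero t = 0ₚ
  reversal (suc N) t = monomial (t 0) N +ₚ reversal N (t ∘ suc)

  reversal-cong : ∀ N {t t′ : Series} → (∀ i → t i ≡ t′ i) → reversal N t ≈ reversal N t′
  reversal-cong zero e = ℙ.refl
  reversal-cong (suc N) {t} e = ℙ.+-cong (subst (λ a → monomial (t 0) N ≈ monomial a N) (e 0) ℙ.refl) (reversal-cong N (e ∘ suc))

  X^ : ℕ → Pol
  X^ = monomial 1F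

  monomial-shift : ∀ j {p : Pol} {a} → (∀ i → co p (suc i) ≡ co (monomial a j) i) → co p 0 ≡ 0F → p ≈ monomial a (suc j)
  monomial-shift j e z = coefficientwise λ { zero → z ; (suc i) → e i }

  monomial-* : ∀ a k N j → k + j ≡ N → X^ k *ₚ monomial a j ≈ monomial a N
  monomial-* a zero N j refl = ℙ.*-identityˡ (monomial a j)
  monomial-* a (suc k) (suc N) j refl = monomial-shift N
    (λ i → trans (co-* (X^ (suc k)) (monomial a j) (suc i)) (trans (cong₂ _⊕_ (⊗-zeroˡ _)
       (trans (sym (co-* (X^ k) (monomial a j) i)) (coefficients (monomial-* a k N j refl) i))) (⊕-identityˡ _)))
    (trans (co-* (X^ (suc k)) (monomial a j) 0) (⊗-zeroˡ _))

  monomial-scale : ∀ a b k → constant a *ₚ monomial b k ≈ monomial (a ⊗ b) k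
  monomial-scale a b k = coefficientwise (λ i → trans (constant-* a (monomial b k) i) (go k i))
    where
    go : ∀ k i → a ⊗ co (monomial b k) i ≡ co (monomial (a ⊗ b) k) i
    go zero zero = refl
    go zero (suc i) = ⊗-zeroʳ a
    go (suc k) zero = ⊗-zeroʳ a
    go (suc k) (suc i) = go k i

  monomial-⊕ : ∀ a b k → monomial (a ⊕ b) k ≈ monomial a k +ₚ monomial b k
  monomial-⊕ a b k = coefficientwise (λ i → trans (go k i) (sym (co-+ (monomial a k) (monomial b k) i)))
    where
    go : ∀ k i → co (monomial (a ⊕ b) k) i ≡ co (monomial a k) i ⊕ co (monomial b k) i
    go zero zero = refl
    go zero (suc i) = sym (⊕-identityʳ 0F)
    go (suc k) zero = sym (⊕-identityʳ 0F)
    go (suc k) (suc i) = go k i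

  monomial-0 : ∀ k → monomial 0F k ≈ 0ₚ
  monomial-0 k = coefficientwise (go k)
    where
    go : ∀ k i → co (monomial 0F k) i ≡ 0F
    go zero zero = refl
    go zero (suc i) = refl
    go (suc k) zero = refl
    go (suc k) (suc i) = go k i

  reversal-0 : ∀ N {t : Series} → (∀ i → t i ≡ 0F) → reversal N t ≈ 0ₚ
  reversal-0 zero e = ℙ.refl
  reversal-0 (suc N) {t} e = ℙ.trans (ℙ.+-cong (subst (λ a → monomial a N ≈ 0ₚ) (sym (e 0)) (monomial-0 N)) (reversal-0 N (e ∘ suc))) (ℙ.+-identityˡ 0ₚ)

  reversal-⊕ : ∀ N (t t′ : Series) → reversal N (λ i → t i ⊕ t′ i) ≈ reversal N t +ₚ reversal N t′
  reversal-⊕ zero t t′ = ℙ.sym (ℙ.+-identityˡ 0ₚ)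
  reversal-⊕ (suc N) t t′ = ℙ.trans (ℙ.+-cong (monomial-⊕ (t 0) (t′ 0) N) (reversal-⊕ N (t ∘ suc) (t′ ∘ suc)))
    (solveₚ 4 (λ a b c d → (a ⊞ b) ⊞ (c ⊞ d) ≜ (a ⊞ c) ⊞ (b ⊞ d))
      ℙ.refl (monomial (t 0) N) (monomial (t′ 0) N) (reversal N (t ∘ suc)) (reversal N (t′ ∘ suc)))

  reversal-scale : ∀ N a (t : Series) → reversal N (λ i → a ⊗ t i) ≈ constant a *ₚ reversal N t
  reversal-scale zero a t = ℙ.sym (ℙ.zeroʳ (constant a))
  reversal-scale (suc N) a t = ℙ.trans (ℙ.+-cong (ℙ.sym (monomial-scale a (t 0) N)) (reversal-scale N a (t ∘ suc)))
    (ℙ.sym (ℙ.distribˡ (constant a) (monomial (t 0) N) (reversal N (t ∘ suc))))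

  reversal-pad : ∀ k N {t : Series} → Below N t → reversal (N + k) t ≈ X^ k *ₚ reversal N t
  reversal-pad k zero {t} b = ℙ.trans (reversal-0 k (λ i → b i z≤n)) (ℙ.sym (ℙ.zeroʳ (X^ k)))
  reversal-pad k (suc N) {t} b = ℙ.trans
    (ℙ.+-cong (ℙ.sym (monomial-* (t 0) k (N + k) N (+-comm k N))) (reversal-pad k N (λ i le → b (suc i) (s≤s le))))
    (ℙ.sym (ℙ.distribˡ (X^ k) (monomial (t 0) N) (reversal N (t ∘ suc))))

  -- Induction on k, splitting off the leading term of `t`. It contributes `t 0` times X^(k+1),
  -- where the power of X comes from reading `r` beyond its last coefficient, as in `reversal-pad`.
  reversal-conv : ∀ k l {t r : Series} → Below (suc k) t → Below (suc l) r →
                  reversal (suc (k + l)) (conv t r) ≈ reversal (suc k) t *ₚ reversal (suc l) r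
  reversal-conv zero l {t} {r} bt br = begin
    reversal (suc l) (conv t r) ≈⟨ reversal-cong (suc l) {conv t r} {λ i → t 0 ⊗ r i} (λ { zero → refl ; (suc i) → trans (cong (t 0 ⊗ r (suc i) ⊕_) (conv-zeroˡ r (λ j → bt (suc j) (s≤s z≤n)) i)) (⊕-identityʳ _) }) ⟩
    reversal (suc l) (λ i → t 0 ⊗ r i) ≈⟨ reversal-scale (suc l) (t 0) r ⟩
    constant (t 0) *ₚ reversal (suc l) r ≈⟨ ℙ.*-cong (ℙ.+-identityʳ (constant (t 0))) (ℙ.refl {reversal (suc l) r}) ⟨
    reversal 1 t *ₚ reversal (suc l) r ∎
    where open PolyReasoning
  reversal-conv (suc k) l {t} {r} bt br = begin
    reversal (suc (suc k + l)) (conv t r)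
      ≈⟨ reversal-cong (suc (suc k + l)) {conv t r} {λ i → t 0 ⊗ r i ⊕ shifted i} (λ { zero → sym (⊕-identityʳ _) ; (suc i) → refl }) ⟩
    reversal (suc (suc k + l)) (λ i → t 0 ⊗ r i ⊕ shifted i)
      ≈⟨ reversal-⊕ (suc (suc k + l)) (λ i → t 0 ⊗ r i) shifted ⟩
    reversal (suc (suc k + l)) (λ i → t 0 ⊗ r i) +ₚ (monomial 0F (suc k + l) +ₚ reversal (suc (k + l)) (conv (t ∘ suc) r))
      ≈⟨ ℙ.+-cong (ℙ.trans (reversal-scale (suc (suc k + l)) (t 0) r) (ℙ.*-cong (ℙ.refl {constant (t 0)}) padded))
                  (ℙ.trans (ℙ.+-cong (monomial-0 (suc k + l)) (reversal-conv k l (λ i le → bt (suc i) (s≤s le)) br)) (ℙ.+-identityˡ _)) ⟩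
    constant (t 0) *ₚ (X^ (suc k) *ₚ R) +ₚ reversal (suc k) (t ∘ suc) *ₚ R
      ≈⟨ ℙ.+-cong (ℙ.trans (ℙ.sym (ℙ.*-assoc (constant (t 0)) (X^ (suc k)) R)) (ℙ.*-cong (ℙ.trans (monomial-scale (t 0) 1F (suc k))
           (subst (λ a → monomial (t 0 ⊗ 1F) (suc k) ≈ monomial a (suc k)) (⊗-identityʳ (t 0)) ℙ.refl)) (ℙ.refl {R}))) (ℙ.refl {reversal (suc k) (t ∘ suc) *ₚ R}) ⟩
    monomial (t 0) (suc k) *ₚ R +ₚ reversal (suc k) (t ∘ suc) *ₚ R
      ≈⟨ ℙ.distribʳ R (monomial (t 0) (suc k)) (reversal (suc k) (t ∘ suc)) ⟨
    reversal (suc (suc k)) t *ₚ R ∎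
    where
    open PolyReasoning
    R = reversal (suc l) r
    shifted : Series
    shifted zero = 0F
    shifted (suc i) = conv (t ∘ suc) r i
    padded : reversal (suc (suc k + l)) r ≈ X^ (suc k) *ₚ R
    padded = subst (λ N → reversal (suc N) r ≈ X^ (suc k) *ₚ R) (+-comm l (suc k)) (reversal-pad (suc k) (suc l) br)

  -- The list that `mulFrom` holds once `t i` has been read.
  window : Series → ℕ → List Carrier
  window t zero = t 0 ∷ []
  window t (suc i) = t (suc i) ∷ window t i

  dot-[] : ∀ {m} (g : Vec Carrier m) → dot g [] ≡ 0F
  dot-[] [] = refl
  dot-[] (x ∷ g) = refl

  dot-window : ∀ {m} (g : Vec Carrier m) t i → dot g (window t i) ≡ conv (high g) t i
  dot-window [] t i = sym (conv-zeroˡ t (λ _ → refl) i)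
  dot-window (x ∷ g) t zero = trans (cong (x ⊗ t 0 ⊕_) (dot-[] g)) (⊕-identityʳ _)
  dot-window (x ∷ g) t (suc i) = cong (x ⊗ t (suc i) ⊕_) (dot-window g t i)

  high-tails : ∀ {m} (g : Vec Carrier m) t i → (∀ j → t (suc i + j) ≡ 0F) → ∀ j → high (tails g (window t i)) j ≡ conv (high g) t (i + j)
  high-tails [] t i z j = sym (conv-zeroˡ t (λ _ → refl) (i + j))
  high-tails (x ∷ g) t i z zero = trans (dot-window (x ∷ g) t i) (cong (conv (high (x ∷ g)) t) (sym (+-identityʳ i)))
  high-tails (x ∷ g) t i z (suc j) = trans (high-tails g t i z j) (sym (trans (cong (conv (high (x ∷ g)) t) (+-suc i j))
    (trans (cong (_⊕ conv (high g) t (i + j)) (trans (cong (x ⊗_) (z j)) (⊗-zeroʳ x))) (⊕-identityˡ _))))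

  -- The invariant of `mulFrom`: its list is a window of `t`, and `v` is what remains of `t` after
  -- it.
  high-mulFrom : ∀ {m k} (g : Vec Carrier m) t i (v : Vec Carrier k) → (∀ j → t (suc i + j) ≡ high v j) →
                 ∀ j → high (mulFrom g (window t i) v) j ≡ conv (high (1F ∷ g)) t (suc i + j)
  high-mulFrom g t i [] e j = trans (high-tails g t i e j) (sym (trans (cong (_⊕ conv (high g) t (i + j))
    (trans (⊗-identityˡ _) (e j))) (⊕-identityˡ _)))
  high-mulFrom g t i (x ∷ v) e zero = sym (trans (cong (conv (high (1F ∷ g)) t) (+-identityʳ (suc i)))
    (cong₂ _⊕_ (trans (⊗-identityˡ _) (trans (cong t (sym (+-identityʳ (suc i)))) (e 0))) (sym (dot-window g t i))))
  high-mulFrom g t i (x ∷ v) e (suc j) = trans (cong (λ y → high (mulFrom g (y ∷ window t i) v) j) (trans (sym (e 0)) (cong t (+-identityʳ (suc i)))))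
    (trans (high-mulFrom g t (suc i) v (λ j → trans (cong t (sym (+-suc (suc i) j))) (e (suc j))) j)
      (cong (conv (high (1F ∷ g)) t) (sym (+-suc (suc i) j))))

  high-mul : ∀ {m l} (g : Vec Carrier m) (h : Vec Carrier l) i → high (1F ∷ mul g h) i ≡ conv (high (1F ∷ g)) (high (1F ∷ h)) i
  high-mul g h zero = sym (⊗-identityˡ 1F)
  high-mul g h (suc i) = high-mulFrom g (high (1F ∷ h)) 0 h (λ j → refl) i

  polynomial : ∀ {n} → Vec Carrier n → Pol
  polynomial {n} v = reversal (suc n) (high (1F ∷ v))

  polynomial-mul : ∀ {m l} (g : Vec Carrier m) (h : Vec Carrier l) → polynomial (mul g h) ≈ polynomial g *ₚ polynomial h
  polynomial-mul {m} {l} g h = ℙ.trans (reversal-cong (suc (l + m)) (high-mul g h))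
    (subst (λ N → reversal (suc N) (conv (high (1F ∷ g)) (high (1F ∷ h))) ≈ polynomial g *ₚ polynomial h) (+-comm m l)
      (reversal-conv m l (high-below (1F ∷ g)) (high-below (1F ∷ h))))

  lower : ∀ {k} → Vec Carrier k → Pol
  lower {k} v = reversal k (high v)

  lower-below : ∀ {k} (v : Vec Carrier k) → Below k (co (lower v))
  lower-below [] i _ = refl
  lower-below {suc k} (a ∷ v) i le = trans (co-+ (monomial a k) (lower v) i) (trans (cong₂ _⊕_ (monomial-below a k i le)
    (lower-below v i (≤-trans (n≤1+n k) le))) (⊕-identityʳ _))

  lower-top : ∀ {k} a (v : Vec Carrier k) → co (lower (a ∷ v)) k ≡ a
  lower-top {k} a v = trans (co-+ (monomial a k) (lower v) k) (trans (cong₂ _⊕_ (monomial-top a k) (lower-below v k ≤-refl)) (⊕-identityʳ a))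

  polynomial-monic : ∀ {n} (v : Vec Carrier n) → Monic n (polynomial v)
  polynomial-monic v = lower-top 1F v , lower-below (1F ∷ v)

  lower-injective : ∀ {k} (v v′ : Vec Carrier k) → lower v ≈ lower v′ → v ≡ v′
  lower-injective [] [] e = refl
  lower-injective {suc k} (a ∷ v) (b ∷ v′) e with trans (sym (lower-top a v)) (trans (coefficients e k) (lower-top b v′))
  ... | refl = cong (a ∷_) (lower-injective v v′ (coefficientwise (λ i → ⊕-cancelʳ (co (monomial a k) i) _ _ (begin
      co (lower v) i ⊕ co (monomial a k) i ≡⟨ ⊕-comm _ _ ⟩
      co (monomial a k) i ⊕ co (lower v) i ≡⟨ co-+ (monomial a k) (lower v) i ⟨
      co (lower (a ∷ v)) i ≡⟨ coefficients e i ⟩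
      co (lower (a ∷ v′)) i ≡⟨ co-+ (monomial a k) (lower v′) i ⟩
      co (monomial a k) i ⊕ co (lower v′) i ≡⟨ ⊕-comm _ _ ⟩
      co (lower v′) i ⊕ co (monomial a k) i ∎))))
    where open ≡-Reasoning

  lower-surjective : ∀ k p → Below k (co p) → ∃[ v ] lower {k} v ≈ p
  lower-surjective zero p b = [] , coefficientwise (λ i → sym (b i z≤n))
  lower-surjective (suc k) p b with lower-surjective k (p +ₚ -ₚ monomial (co p k) k) below′
    where
    below′ : Below k (co (p +ₚ -ₚ monomial (co p k) k))
    below′ i le = trans (co-+ p _ i) (trans (cong (co p i ⊕_) (co-neg _ i)) (cancel (m≤n⇒m<n∨m≡n le)))
      where
      cancel : k < i ⊎ k ≡ i → co p i ⊕ ⊖ co (monomial (co p k) k) i ≡ 0F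
      cancel (inj₁ lt) = trans (cong₂ (λ x y → x ⊕ ⊖ y) (b i lt) (monomial-below (co p k) k i lt)) (⊖-inverseʳ 0F)
      cancel (inj₂ refl) = trans (cong (λ y → co p k ⊕ ⊖ y) (monomial-top (co p k) k)) (⊖-inverseʳ _)
  ... | v , e = co p k ∷ v , (begin
      M +ₚ lower v ≈⟨ ℙ.+-cong (ℙ.refl {M}) e ⟩
      M +ₚ (p +ₚ -ₚ M) ≈⟨ ℙ.+-comm M _ ⟩
      p +ₚ -ₚ M +ₚ M ≈⟨ ℙ.+-assoc p (-ₚ M) M ⟩
      p +ₚ (-ₚ M +ₚ M) ≈⟨ ℙ.+-cong (ℙ.refl {p}) (ℙ.-‿inverseˡ M) ⟩
      p +ₚ 0ₚ ≈⟨ ℙ.+-identityʳ p ⟩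
      p ∎)
    where
    open PolyReasoning
    M = monomial (co p k) k

  polynomial-injective : ∀ {n} {v v′ : Vec Carrier n} → polynomial v ≈ polynomial v′ → v ≡ v′
  polynomial-injective {v = v} {v′} e = ∷-injʳ (lower-injective (1F ∷ v) (1F ∷ v′) e)

  polynomial-surjective : ∀ {n p} → Monic n p → ∃[ v ] polynomial {n} v ≈ p
  polynomial-surjective {n} {p} (t , b) with lower-surjective (suc n) p b
  ... | a ∷ v , e with trans (sym (lower-top a v)) (trans (coefficients e n) t)
  ... | refl = v , e

  polynomial-mul≡ : ∀ {m l} (g : Vec Carrier m) (h : Vec Carrier l) f → polynomial g *ₚ polynomial h ≈ polynomial f → f ≡ mul g h
  polynomial-mul≡ g h f e = polynomial-injective (ℙ.trans (ℙ.sym e) (ℙ.sym (polynomial-mul g h)))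

  infix 4 _divides_
  _divides_ : ∀ {l n} → Vec Carrier l → Vec Carrier n → Set
  h divides f = polynomial h ∣ₚ polynomial f

  cofactor : ∀ {l n} {h : Vec Carrier l} {f : Vec Carrier n} → h divides f →
             ∃[ m ] Σ (l + m ≡ n) λ e → ∃[ g ] subst (Vec Carrier) (sym e) f ≡ mul {m} g h × polynomial g *ₚ polynomial h ≈ polynomial f
  cofactor {l} {n} {h} {f} (c , e) with cofactor-monic {c} (polynomial-monic h) (polynomial-monic f) e
  ... | m , me , mc with polynomial-surjective {p = c} mc | trans (+-comm l m) me
  ... | g , ge | refl = m , refl , g , polynomial-mul≡ g h f gh , gh
    where gh = ℙ.trans (ℙ.*-cong ge (ℙ.refl {polynomial h})) e

  divides-degree : ∀ {l n} {h : Vec Carrier l} {f : Vec Carrier n} → h divides f → l ≤ n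
  divides-degree {l} {n} {h} {f} d with cofactor {h = h} {f} d
  ... | m , refl , _ = m≤m+n l m

  mul-divides : ∀ {m l} (g : Vec Carrier m) (h : Vec Carrier l) → h divides mul g h
  mul-divides g h = polynomial g , ℙ.sym (polynomial-mul g h)

  divides? : ∀ {l n} (h : Vec Carrier l) (f : Vec Carrier n) → Dec (h divides f)
  divides? {l} {n} h f with l ≤? n
  ... | no l≰n = no (λ d → l≰n (divides-degree {h = h} {f} d))
  ... | yes l≤n with m≤n⇒∃[o]m+o≡n l≤n
  ... | m , refl = map′ (λ { (g , refl) → mul-divides g h }) back (∃? (Vec-finite finite m) (λ g → Finite._≟_ (Vec-finite finite (l + m)) f (mul g h)))
    where
    back : h divides f → ∃[ g ] f ≡ mul {m} g h
    back (c , e) with cofactor-monic (polynomial-monic h) (polynomial-monic f) e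
    ... | m′ , me , mc with +-cancelʳ-≡ l m′ m (trans me (+-comm l m))
    ... | refl with polynomial-surjective {p = c} mc
    ... | g , ge = g , polynomial-mul≡ g h f (ℙ.trans (ℙ.*-cong ge (ℙ.refl {polynomial h})) e)

  mul-injective : ∀ {m l} {g g′ : Vec Carrier m} (h : Vec Carrier l) → mul g h ≡ mul g′ h → g ≡ g′
  mul-injective {g = g} {g′} h e = polynomial-injective (monic-cancel (polynomial-monic h)
    (ℙ.trans (ℙ.sym (polynomial-mul g h)) (ℙ.trans (ℙ.reflexive (cong polynomial e)) (polynomial-mul g′ h))))

  -- By `mul-injective` a multiple of `h` has exactly one cofactor, so the multiples are indexed by
  -- `g`.
  ∑-multiples : ∀ m {l} (h : Vec Carrier l) (φ : Vec Carrier (l + m) → ℕ) →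
                ∑ (vectors (l + m)) (λ f → φ f * ⟦ divides? h f ⟧) ≡ ∑ (vectors m) (λ g → φ (mul g h))
  ∑-multiples m {l} h φ = begin
    ∑ (vectors (l + m)) (λ f → φ f * ⟦ divides? h f ⟧) ≡⟨ ∑-cong (vectors (l + m)) (λ f → trans (cong (φ f *_) (indicator f)) (*-comm (φ f) _)) ⟩
    ∑ (vectors (l + m)) (λ f → ∑ (vectors m) (λ g → ⟦ f ≟ᵥ mul g h ⟧) * φ f) ≡⟨ ∑-cong (vectors (l + m)) (λ f → sym (∑-*ʳ (vectors m) _ (φ f))) ⟩
    ∑ (vectors (l + m)) (λ f → ∑ (vectors m) (λ g → ⟦ f ≟ᵥ mul g h ⟧ * φ f)) ≡⟨ ∑-swap (vectors (l + m)) (vectors m) _ ⟩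
    ∑ (vectors m) (λ g → ∑ (vectors (l + m)) (λ f → ⟦ f ≟ᵥ mul g h ⟧ * φ f)) ≡⟨ ∑-cong (vectors m) (λ g → Finite.pick (Vec-finite finite (l + m)) φ (mul g h)) ⟩
    ∑ (vectors m) (λ g → φ (mul g h)) ∎
    where
    open ≡-Reasoning
    _≟ᵥ_ = Finite._≟_ (Vec-finite finite (l + m))
    _≟ₘ_ = Finite._≟_ (Vec-finite finite m)
    indicator : ∀ f → ⟦ divides? h f ⟧ ≡ ∑ (vectors m) (λ g → ⟦ f ≟ᵥ mul g h ⟧)
    indicator f with ∃? (Vec-finite finite m) (λ g → f ≟ᵥ mul g h)
    ... | yes (g₀ , refl) = trans (⟦⟧-yes (divides? h (mul g₀ h)) (mul-divides g₀ h)) (sym (trans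
            (∑-cong (vectors m) (λ g → ⟦⟧-cong (mul g₀ h ≟ᵥ mul g h) (g ≟ₘ g₀) (λ e → sym (mul-injective h e)) (λ e → cong (λ g → mul g h) (sym e))))
            (Finite.once (Vec-finite finite m) g₀)))
    ... | no none = trans (⟦⟧-no (divides? h f) ¬div) (sym (trans (∑-cong (vectors m) (λ g → ⟦⟧-no (f ≟ᵥ mul g h) (λ e → none (g , e)))) (∑-zero (vectors m))))
      where
      ¬div : ¬ (h divides f)
      ¬div (c , e) with cofactor-monic (polynomial-monic h) (polynomial-monic f) e
      ... | m′ , me , mc with +-cancelʳ-≡ l m′ m (trans me (+-comm l m))
      ... | refl with polynomial-surjective {p = c} mc
      ... | g , ge = none (g , polynomial-mul≡ g h f (ℙ.trans (ℙ.*-cong ge (ℙ.refl {polynomial h})) e))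

-- The sum over 1 ≤ l ≤ N.
∑≤ : ℕ → (ℕ → ℕ) → ℕ
∑≤ zero f = 0
∑≤ (suc N) f = f (suc N) + ∑≤ N f

∑≤-cong : ∀ N {f g : ℕ → ℕ} → (∀ l → 1 ≤ l → l ≤ N → f l ≡ g l) → ∑≤ N f ≡ ∑≤ N g
∑≤-cong zero e = refl
∑≤-cong (suc N) e = cong₂ _+_ (e (suc N) (s≤s z≤n) ≤-refl) (∑≤-cong N (λ l p r → e l p (≤-trans r (n≤1+n N))))

∑≤-mono : ∀ N {f g : ℕ → ℕ} → (∀ l → 1 ≤ l → l ≤ N → f l ≤ g l) → ∑≤ N f ≤ ∑≤ N g
∑≤-mono zero e = z≤n
∑≤-mono (suc N) e = +-mono-≤ (e (suc N) (s≤s z≤n) ≤-refl) (∑≤-mono N (λ l p r → e l p (≤-trans r (n≤1+n N))))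

∑≤-+ : ∀ N (f g : ℕ → ℕ) → ∑≤ N (λ l → f l + g l) ≡ ∑≤ N f + ∑≤ N g
∑≤-+ zero f g = refl
∑≤-+ (suc N) f g = trans (cong (f (suc N) + g (suc N) +_) (∑≤-+ N f g)) (+-interchange (f (suc N)) (g (suc N)) _ _)

∑≤-*ˡ : ∀ N c (f : ℕ → ℕ) → ∑≤ N (λ l → c * f l) ≡ c * ∑≤ N f
∑≤-*ˡ zero c f = sym (*-zeroʳ c)
∑≤-*ˡ (suc N) c f = trans (cong (c * f (suc N) +_) (∑≤-*ˡ N c f)) (sym (*-distribˡ-+ c (f (suc N)) _))

∑≤-const : ∀ N c → ∑≤ N (λ _ → c) ≡ N * c
∑≤-const zero c = refl
∑≤-const (suc N) c = cong (c +_) (∑≤-const N c)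

∑≤-zero : ∀ N {f : ℕ → ℕ} → (∀ l → 1 ≤ l → l ≤ N → f l ≡ 0) → ∑≤ N f ≡ 0
∑≤-zero N e = trans (∑≤-cong N e) (trans (∑≤-const N 0) (*-zeroʳ N))

∑≤-only : ∀ N {f : ℕ → ℕ} k → 1 ≤ k → k ≤ N → (∀ l → l ≢ k → f l ≡ 0) → ∑≤ N f ≡ f k
∑≤-only zero k 1≤k k≤N e = ⊥-elim (<-irrefl refl (≤-trans 1≤k k≤N))
∑≤-only (suc N) {f} k 1≤k k≤N e with m≤n⇒m<n∨m≡n k≤N
... | inj₂ refl = trans (cong (f k +_) (∑≤-zero N (λ l _ l≤N → e l (λ { refl → <-irrefl refl l≤N })))) (+-identityʳ _)
... | inj₁ (s≤s k≤N′) = trans (cong (_+ ∑≤ N f) (e (suc N) (λ { refl → <-irrefl refl k≤N′ }))) (∑≤-only N k 1≤k k≤N′ e)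

∑≤-term : ∀ N (f : ℕ → ℕ) k → 1 ≤ k → k ≤ N → f k ≤ ∑≤ N f
∑≤-term zero f k 1≤k k≤N = ⊥-elim (<-irrefl refl (≤-trans 1≤k k≤N))
∑≤-term (suc N) f k 1≤k k≤N with m≤n⇒m<n∨m≡n k≤N
... | inj₂ refl = m≤m+n _ _
... | inj₁ (s≤s k≤N′) = ≤-trans (∑≤-term N f k 1≤k k≤N′) (m≤n+m _ (f (suc N)))

∑-∑≤ : {A : Set} (xs : List A) (N : ℕ) (f : A → ℕ → ℕ) → ∑ xs (λ x → ∑≤ N (f x)) ≡ ∑≤ N (λ l → ∑ xs (λ x → f x l))
∑-∑≤ xs zero f = ∑-zero xs
∑-∑≤ xs (suc N) f = trans (∑-+ xs _ _) (cong (∑ xs (λ x → f x (suc N)) +_) (∑-∑≤ xs N f))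

∑≤-∣-∣ : ∀ N (f g : ℕ → ℕ) → ∣ ∑≤ N f - ∑≤ N g ∣ ≤ ∑≤ N (λ l → ∣ f l - g l ∣)
∑≤-∣-∣ zero f g = z≤n
∑≤-∣-∣ (suc N) f g = ≤-trans (∣-∣-+ (f (suc N)) (g (suc N)) _ _) (+-monoʳ-≤ ∣ f (suc N) - g (suc N) ∣ (∑≤-∣-∣ N f g))

-- Irreducible divisors and square factors.

module IrreducibleDivisors (𝔽 : DiscreteFiniteField) where
  open FieldTheory 𝔽
  open Recurrence 𝔽
  open BilinearSums 𝔽
  open PolynomialRing 𝔽
  open MonicPolynomials 𝔽

  monic-degree : ∀ {a b p} → Monic a p → Monic b p → a ≡ b
  monic-degree {a} {b} (ta , ba) (tb , bb) with <-cmp a b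
  ... | tri≈ _ e _ = e
  ... | tri< lt _ _ = ⊥-elim (1≢0 (trans (sym tb) (ba b lt)))
  ... | tri> _ _ gt = ⊥-elim (1≢0 (trans (sym ta) (bb a gt)))

  -- There are finitely many candidates, which makes irreducibility decidable and hence usable as an
  -- indicator in sums.
  ProperDivisor : ∀ {n} → Vec Carrier n → Set
  ProperDivisor {n} f = ∃[ a ] a < n × 1 ≤ a × ∃[ g ] _divides_ {a} g f

  properDivisor? : ∀ {n} (f : Vec Carrier n) → Dec (ProperDivisor f)
  properDivisor? {n} f = anyUpTo? (λ a → 1 ≤? a ×-dec ∃? (Vec-finite finite a) (λ g → divides? g f)) n

  irreducible-if : ∀ {n} (f : Vec Carrier n) → 1 ≤ n → ¬ ProperDivisor f → Irr n (polynomial f)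
  irreducible-if {n} f 1≤n none = record { positive = 1≤n ; monic = polynomial-monic f ; split = split }
    where
    split : ∀ {a b p r} → Monic a p → Monic b r → p *ₚ r ≈ polynomial f → a ≡ 0 ⊎ b ≡ 0
    split {zero} _ _ _ = inj₁ refl
    split {suc a} {zero} _ _ _ = inj₂ refl
    split {suc a} {suc b} {p} {r} mp mr e with cofactor-monic {p} mr (polynomial-monic f) e
    ... | k , refl , mk with monic-degree {p = p} mp mk | polynomial-surjective {p = p} mp
    ... | refl | g , ge = ⊥-elim (none (suc a , m<m+n (suc a) (s≤s z≤n) , s≤s z≤n , g ,
              r , ℙ.trans (ℙ.*-cong (ℙ.refl {r}) ge) (ℙ.trans (ℙ.*-comm r p) e)))

  not-irreducible-if : ∀ {n} {f : Vec Carrier n} → ProperDivisor f → ¬ Irr n (polynomial f)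
  not-irreducible-if {n} {f} (a , a<n , 1≤a , g , c , e) I with cofactor-monic {c} (polynomial-monic g) (polynomial-monic f) e
  ... | k , refl , mk with Irr.split I mk (polynomial-monic g) e
  ... | inj₁ refl = <-irrefl refl a<n
  ... | inj₂ refl = <-irrefl refl 1≤a

  irr? : ∀ {n} (f : Vec Carrier n) → Dec (Irr n (polynomial f))
  irr? {n} f with 1 ≤? n | properDivisor? f
  ... | no ¬1≤n | _ = no (¬1≤n ∘ Irr.positive)
  ... | yes _ | yes d = no (not-irreducible-if {f = f} d)
  ... | yes 1≤n | no none = yes (irreducible-if f 1≤n none)

  irr : ∀ {n} → Vec Carrier n → ℕ
  irr f = ⟦ irr? f ⟧

  ∣ₚ-trans : ∀ {p r t} → p ∣ₚ r → r ∣ₚ t → p ∣ₚ t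
  ∣ₚ-trans {p} (c , e) (d , f) = d *ₚ c , ℙ.trans (ℙ.*-assoc d c p) (ℙ.trans (ℙ.*-cong (ℙ.refl {d}) e) f)

  irreducible-divisor : ∀ fuel {n} (f : Vec Carrier n) → n ≤ fuel → 1 ≤ n → ∃[ k ] ∃[ p ] Irr k (polynomial p) × _divides_ {k} p f
  irreducible-divisor zero f n≤0 1≤n = ⊥-elim (<-irrefl refl (≤-trans 1≤n n≤0))
  irreducible-divisor (suc fuel) {n} f n≤ 1≤n with properDivisor? f
  ... | no none = n , f , irreducible-if f 1≤n none , 1ₚ , ℙ.*-identityˡ (polynomial f)
  ... | yes (a , a<n , 1≤a , g , d) with irreducible-divisor fuel g (s≤s⁻¹ (≤-trans a<n n≤)) 1≤a
  ... | k , p , I , d′ = k , p , I , ∣ₚ-trans {polynomial p} {polynomial g} {polynomial f} d′ d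

  -- An equality indicator across different lengths. The decision on the lengths is an argument so
  -- that proofs can match on it.
  same-at : ∀ {l k} → Dec (l ≡ k) → Vec Carrier l → Vec Carrier k → ℕ
  same-at (no _) h p = 0
  same-at {k = k} (yes refl) h p = ⟦ Finite._≟_ (Vec-finite finite k) h p ⟧

  same : ∀ {l k} → Vec Carrier l → Vec Carrier k → ℕ
  same {l} {k} h p = same-at (l ℕ.≟ k) h p

  same-at-refl : ∀ {k} (d : Dec (k ≡ k)) (h p : Vec Carrier k) → same-at d h p ≡ ⟦ Finite._≟_ (Vec-finite finite k) h p ⟧
  same-at-refl (no ne) h p = ⊥-elim (ne refl)
  same-at-refl (yes refl) h p = refl

  same-refl : ∀ {k} (p : Vec Carrier k) → same p p ≡ 1
  same-refl {k} p = trans (same-at-refl (k ℕ.≟ k) p p) (⟦⟧-yes (Finite._≟_ (Vec-finite finite k) p p) refl)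

  same-at-case : ∀ {l k} (d : Dec (l ≡ k)) (h : Vec Carrier l) (p : Vec Carrier k) →
                 (Σ (l ≡ k) λ e → subst (Vec Carrier) e h ≡ p) ⊎ same-at d h p ≡ 0 × (∀ (e : l ≡ k) → subst (Vec Carrier) e h ≢ p)
  same-at-case (no ne) h p = inj₂ (refl , λ e → ⊥-elim (ne e))
  same-at-case {k = k} (yes refl) h p with Finite._≟_ (Vec-finite finite k) h p
  ... | yes e = inj₁ (refl , e)
  ... | no ne = inj₂ (refl , λ { refl → ne })

  same-case : ∀ {l k} (h : Vec Carrier l) (p : Vec Carrier k) →
              (Σ (l ≡ k) λ e → subst (Vec Carrier) e h ≡ p) ⊎ same h p ≡ 0 × (∀ (e : l ≡ k) → subst (Vec Carrier) e h ≢ p)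
  same-case {l} {k} = same-at-case (l ℕ.≟ k)

  ∑-same : ∀ N {k} (p : Vec Carrier k) → 1 ≤ k → k ≤ N → ∑≤ N (λ l → l * ∑ (vectors l) (λ h → same h p)) ≡ k
  ∑-same N {k} p 1≤k k≤N = trans (∑≤-only N k 1≤k k≤N off) (trans (cong (k *_) on) (*-identityʳ k))
    where
    off : ∀ l → l ≢ k → l * ∑ (vectors l) (λ h → same h p) ≡ 0
    off l ne = trans (cong (l *_) (trans (∑-cong (vectors l) (λ h → differ (l ℕ.≟ k) h)) (∑-zero (vectors l)))) (*-zeroʳ l)
      where
      differ : ∀ (d : Dec (l ≡ k)) h → same-at d h p ≡ 0
      differ (no _) h = refl
      differ (yes e) h = ⊥-elim (ne e)
    on : ∑ (vectors k) (λ h → same h p) ≡ 1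
    on = trans (∑-cong (vectors k) (λ h → same-at-refl (k ℕ.≟ k) h p)) (Finite.once (Vec-finite finite k) p)

  -- The cutoff `N` is kept apart from n so that it stays the same when `f` is replaced by a
  -- cofactor.
  ω : ℕ → ∀ {n} → Vec Carrier n → ℕ
  ω N f = ∑≤ N (λ l → l * ∑ (vectors l) (λ h → irr h * ⟦ divides? h f ⟧))

  HasSquareFactor : ∀ {n} → Vec Carrier n → Set
  HasSquareFactor f = ∃[ k ] 1 ≤ k × ∃[ p ] mul {k} {k} p p divides f

  module _ {k} (p : Vec Carrier k) (I : Irr k (polynomial p)) {m n} (e : Vec Carrier m) (f : Vec Carrier n)
           (e*p≈f : polynomial e *ₚ polynomial p ≈ polynomial f) where

    irreducible-divides-irreducible : ∀ {l} (h : Vec Carrier l) → Irr l (polynomial h) → h divides p →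
                                      Σ (l ≡ k) λ e → subst (Vec Carrier) e h ≡ p
    irreducible-divides-irreducible {l} h J (c , c*h≈p) with cofactor-monic {c} (polynomial-monic h) (polynomial-monic p) c*h≈p
    ... | j , j+l≡k , mj with Irr.split I mj (polynomial-monic h) c*h≈p
    ... | inj₂ refl = ⊥-elim (<-irrefl refl (Irr.positive J))
    ... | inj₁ refl with j+l≡k
    ... | refl = refl , polynomial-injective (ℙ.trans (ℙ.sym (ℙ.trans (ℙ.*-cong (monic₀ mj) (ℙ.refl {polynomial h})) (ℙ.*-identityˡ (polynomial h)))) c*h≈p)

    divides-product : ∀ {l} (h : Vec Carrier l) → h divides e → h divides f
    divides-product h (c , c*h≈e) = c *ₚ polynomial p , ℙ.trans
      (solveₚ 3 (λ c p h → (c ⊠ p) ⊠ h ≜ (c ⊠ h) ⊠ p) ℙ.refl c (polynomial p) (polynomial h))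
      (ℙ.trans (ℙ.*-cong c*h≈e (ℙ.refl {polynomial p})) e*p≈f)

    p-divides-product : p divides f
    p-divides-product = polynomial e , e*p≈f

    divides-factor : ∀ {l} (h : Vec Carrier l) → Irr l (polynomial h) → ¬ (h divides p) → h divides f → h divides e
    divides-factor h J h∤p (c , c*h≈f) = euclid (polynomial p) (polynomial h) J h∤p {polynomial e}
      (c , ℙ.trans c*h≈f (ℙ.trans (ℙ.sym e*p≈f) (ℙ.*-comm (polynomial e) (polynomial p))))

    -- By Euclid's lemma an irreducible divisor of e p divides e or is p itself, and here the two
    -- cases exclude each other.
    new-divisor : ¬ (p divides e) → ∀ {l} (h : Vec Carrier l) →
                  irr h * ⟦ divides? h f ⟧ ≡ irr h * ⟦ divides? h e ⟧ + same h p
    new-divisor p∤e h with same-case h p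
    ... | inj₁ (refl , refl) = begin
      irr p * ⟦ divides? p f ⟧ ≡⟨ cong₂ _*_ (⟦⟧-yes (irr? p) I) (⟦⟧-yes (divides? p f) p-divides-product) ⟩
      1 ≡⟨ cong₂ _+_ (trans (cong (irr p *_) (⟦⟧-no (divides? p e) p∤e)) (*-zeroʳ (irr p))) (same-refl p) ⟨
      irr p * ⟦ divides? p e ⟧ + same p p ∎
      where open ≡-Reasoning
    ... | inj₂ (z , ne) with irr? h
    ... | no _ = sym z
    ... | yes J = trans (cong (1 *_) (⟦⟧-cong (divides? h f) (divides? h e)
              (divides-factor h J (λ d → ne (proj₁ (irreducible-divides-irreducible h J d)) (proj₂ (irreducible-divides-irreducible h J d))))
              (divides-product h))) (trans (sym (+-identityʳ _)) (cong (1 * ⟦ divides? h e ⟧ +_) (sym z)))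

    old-divisor : p divides e → ∀ {l} (h : Vec Carrier l) → irr h * ⟦ divides? h f ⟧ ≡ irr h * ⟦ divides? h e ⟧
    old-divisor p∣e h with irr? h
    ... | no _ = refl
    ... | yes J = cong (1 *_) (⟦⟧-cong (divides? h f) (divides? h e) back (divides-product h))
      where
      back : h divides f → h divides e
      back d with same-case h p
      ... | inj₁ (refl , refl) = p∣e
      ... | inj₂ (_ , ne) = divides-factor h J (λ d′ → ne (proj₁ (irreducible-divides-irreducible h J d′)) (proj₂ (irreducible-divides-irreducible h J d′))) d

    square-factor : p divides e → HasSquareFactor f
    square-factor (c , c*p≈e) = k , Irr.positive I , p , c , (begin
      c *ₚ polynomial (mul p p) ≈⟨ ℙ.*-cong (ℙ.refl {c}) (polynomial-mul p p) ⟩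
      c *ₚ (polynomial p *ₚ polynomial p) ≈⟨ ℙ.*-assoc c _ _ ⟨
      c *ₚ polynomial p *ₚ polynomial p ≈⟨ ℙ.*-cong c*p≈e (ℙ.refl {polynomial p}) ⟩
      polynomial e *ₚ polynomial p ≈⟨ e*p≈f ⟩
      polynomial f ∎)
      where open PolyReasoning

  -- Strip one irreducible factor p of degree k from `f`. If p does not divide the cofactor, `ω` and
  -- the degree both grow by k. If it does, then p² divides `f`, `ω` is unchanged, and only the
  -- inequality survives.
  ω-degree : ∀ fuel N {n} (f : Vec Carrier n) → n ≤ fuel → n ≤ N → ω N f ≤ n × (ω N f ≡ n ⊎ HasSquareFactor f)
  ω-degree fuel N {zero} f n≤ n≤N = ≤-reflexive ω≡0 , inj₁ ω≡0
    where
    ω≡0 : ω N f ≡ 0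
    ω≡0 = ∑≤-zero N (λ l 1≤l _ → trans (cong (l *_) (trans (∑-cong (vectors l) (λ h →
      trans (cong (irr h *_) (⟦⟧-no (divides? h f) (λ d → <-irrefl refl (≤-trans 1≤l (divides-degree {h = h} {f} d))))) (*-zeroʳ (irr h)))) (∑-zero (vectors l)))) (*-zeroʳ l))
  ω-degree zero N {suc n} f () n≤N
  ω-degree (suc fuel) N {suc n} f n≤ n≤N with irreducible-divisor (suc n) f ≤-refl (s≤s z≤n)
  ... | k , p , I , d with cofactor {h = p} {f} d
  ... | m , k+m≡n , e , _ , e*p≈f with ω-degree fuel N e
            (s≤s⁻¹ (≤-trans (≤-trans (+-monoˡ-≤ m (Irr.positive I)) (≤-reflexive k+m≡n)) n≤))
            (≤-trans (≤-trans (m≤n+m m k) (≤-reflexive k+m≡n)) n≤N)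
  ... | ω≤m , eq with divides? p e
  ... | yes p∣e = ≤-trans (≤-reflexive ωf≡ωe) (≤-trans ω≤m (≤-trans (m≤n+m m k) (≤-reflexive k+m≡n))) , inj₂ (square-factor p I e f e*p≈f p∣e)
    where
    ωf≡ωe : ω N f ≡ ω N e
    ωf≡ωe = ∑≤-cong N (λ l _ _ → cong (l *_) (∑-cong (vectors l) (old-divisor p I e f e*p≈f p∣e)))
  ... | no p∤e = ≤-trans (≤-reflexive ωf≡ωe+k) (≤-trans (+-monoˡ-≤ k ω≤m) (≤-reflexive m+k≡n)) ,
                       [ (λ ω≡m → inj₁ (trans ωf≡ωe+k (trans (cong (_+ k) ω≡m) m+k≡n))) , (λ { (j , 1≤j , r , r²∣e) → inj₂ (j , 1≤j , r , divides-product p I e f e*p≈f (mul r r) r²∣e) }) ]′ eq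
    where
    m+k≡n : m + k ≡ suc n
    m+k≡n = trans (+-comm m k) k+m≡n
    ωf≡ωe+k : ω N f ≡ ω N e + k
    ωf≡ωe+k = begin
      ω N f
        ≡⟨ ∑≤-cong N (λ l _ _ → trans (cong (l *_) (trans (∑-cong (vectors l) (new-divisor p I e f e*p≈f p∤e)) (∑-+ (vectors l) _ _))) (*-distribˡ-+ l _ _)) ⟩
      ∑≤ N (λ l → l * ∑ (vectors l) (λ h → irr h * ⟦ divides? h e ⟧) + l * ∑ (vectors l) (λ h → same h p))
        ≡⟨ ∑≤-+ N _ _ ⟩
      ω N e + ∑≤ N (λ l → l * ∑ (vectors l) (λ h → same h p))
        ≡⟨ cong (ω N e +_) (∑-same N p (Irr.positive I) (≤-trans (≤-trans (m≤m+n k m) (≤-reflexive k+m≡n)) n≤N)) ⟩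
      ω N e + k ∎
      where open ≡-Reasoning

  -- An upper bound for the indicator of a square factor. All p of positive degree are counted,
  -- irreducible or not, which changes the order of magnitude of the total by nothing.
  squareFactors : ∀ {n} → Vec Carrier n → ℕ
  squareFactors {n} f = ∑≤ n (λ k → ∑ (vectors k) (λ p → ⟦ divides? (mul p p) f ⟧))

  squareFactors-positive : ∀ {n} {f : Vec Carrier n} → HasSquareFactor f → 1 ≤ squareFactors f
  squareFactors-positive {n} {f} (k , 1≤k , p , d) = begin
    1 ≡⟨ ⟦⟧-yes (divides? (mul p p) f) d ⟨
    ⟦ divides? (mul p p) f ⟧ ≤⟨ Finite.term≤ (Vec-finite finite k) (λ p → ⟦ divides? (mul p p) f ⟧) p ⟩
    ∑ (vectors k) (λ p → ⟦ divides? (mul p p) f ⟧) ≤⟨ ∑≤-term n _ k 1≤k (≤-trans (m≤m+n k k) (divides-degree {h = mul p p} {f} d)) ⟩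
    squareFactors f ∎
    where open ≤-Reasoning

  -- In each degree k there are q^k polynomials p, each with q^(n-2k) multiples of p²: together
  -- q^(n-k), at most q^(n-1).
  ∑-squareFactors : ∀ n → q * ∑ (vectors n) squareFactors ≤ n * q ^ n
  ∑-squareFactors n = begin
    q * ∑ (vectors n) squareFactors ≡⟨ cong (q *_) (∑-∑≤ (vectors n) n (λ f k → ∑ (vectors k) (λ p → ⟦ divides? (mul p p) f ⟧))) ⟩
    q * ∑≤ n (λ k → ∑ (vectors n) (λ f → ∑ (vectors k) (λ p → ⟦ divides? (mul p p) f ⟧))) ≡⟨ ∑≤-*ˡ n q _ ⟨
    ∑≤ n (λ k → q * ∑ (vectors n) (λ f → ∑ (vectors k) (λ p → ⟦ divides? (mul p p) f ⟧))) ≤⟨ ∑≤-mono n (λ k 1≤k _ → per-degree k 1≤k) ⟩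
    ∑≤ n (λ k → q ^ n) ≡⟨ ∑≤-const n (q ^ n) ⟩
    n * q ^ n ∎
    where
    open ≤-Reasoning
    per-degree : ∀ k → 1 ≤ k → q * ∑ (vectors n) (λ f → ∑ (vectors k) (λ p → ⟦ divides? (mul p p) f ⟧)) ≤ q ^ n
    per-degree k 1≤k = by-cases (k + k ≤? n)
      where
      q≤q^k : q ≤ q ^ k
      q≤q^k = ≤-trans (≤-reflexive (sym (*-identityʳ q))) (^-monoʳ-≤ q {{>-nonZero 1≤q}} 1≤k)
      by-cases : Dec (k + k ≤ n) → q * ∑ (vectors n) (λ f → ∑ (vectors k) (λ p → ⟦ divides? (mul p p) f ⟧)) ≤ q ^ n
      by-cases (no 2k≰n) = ≤-trans (≤-reflexive (trans (cong (q *_) (trans (∑-cong (vectors n) (λ f → trans (∑-cong (vectors k) (λ p →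
                      ⟦⟧-no (divides? (mul p p) f) (λ d → 2k≰n (divides-degree {h = mul p p} {f} d)))) (∑-zero (vectors k)))) (∑-zero (vectors n)))) (*-zeroʳ q))) z≤n
      by-cases (yes 2k≤n) with m≤n⇒∃[o]m+o≡n 2k≤n
      ... | m , refl = begin
        q * ∑ (vectors (k + k + m)) (λ f → ∑ (vectors k) (λ p → ⟦ divides? (mul p p) f ⟧)) ≡⟨ cong (q *_) (trans (∑-swap (vectors (k + k + m)) (vectors k) _)
             (trans (∑-cong (vectors k) (λ p → trans (∑-cong (vectors (k + k + m)) (λ f → sym (*-identityˡ _))) (trans (∑-multiples m (mul p p) (λ _ → 1)) (trans (∑-one (vectors m)) (vectors-size m)))))
               (trans (∑-const (vectors k) (q ^ m)) (cong (_* q ^ m) (vectors-size k))))) ⟩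
        q * (q ^ k * q ^ m) ≡⟨ *-assoc q (q ^ k) (q ^ m) ⟨
        q * q ^ k * q ^ m ≤⟨ *-monoˡ-≤ (q ^ m) (*-monoˡ-≤ (q ^ k) q≤q^k) ⟩
        q ^ k * q ^ k * q ^ m ≡⟨ trans (cong (_* q ^ m) (sym (^-distribˡ-+-* q k k))) (sym (^-distribˡ-+-* q (k + k) m)) ⟩
        q ^ (k + k + m) ∎

  -- Either `ω n f` equals n, or `f` has a square factor and the difference is at most n, because
  -- `ω` never exceeds the degree.
  weighted-degree : ∀ {n} (φ : Vec Carrier n → ℕ) → (∀ f → φ f ≤ 1) →
                    q * ∣ ∑ (vectors n) (λ f → φ f * ω n f) - n * ∑ (vectors n) φ ∣ ≤ n * (n * q ^ n)
  weighted-degree {n} φ φ≤1 = begin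
    q * ∣ ∑ (vectors n) (λ f → φ f * ω n f) - n * ∑ (vectors n) φ ∣ ≡⟨ cong (λ a → q * ∣ ∑ (vectors n) (λ f → φ f * ω n f) - a ∣) (trans (sym (∑-*ˡ (vectors n) n φ)) (∑-cong (vectors n) (λ f → *-comm n (φ f)))) ⟩
    q * ∣ ∑ (vectors n) (λ f → φ f * ω n f) - ∑ (vectors n) (λ f → φ f * n) ∣ ≤⟨ *-monoʳ-≤ q (≤-trans (∑-∣-∣ (vectors n) _ _) (∑-mono (vectors n) pointwise)) ⟩
    q * ∑ (vectors n) (λ f → n * squareFactors f) ≡⟨ trans (cong (q *_) (∑-*ˡ (vectors n) n squareFactors)) (*-swap q n _) ⟩
    n * (q * ∑ (vectors n) squareFactors) ≤⟨ *-monoʳ-≤ n (∑-squareFactors n) ⟩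
    n * (n * q ^ n) ∎
    where
    open ≤-Reasoning
    pointwise : ∀ f → ∣ φ f * ω n f - φ f * n ∣ ≤ n * squareFactors f
    pointwise f with ω-degree n n f ≤-refl ≤-refl
    ... | _ , inj₁ e = ≤-trans (≤-reflexive (trans (cong (λ a → ∣ φ f * a - φ f * n ∣) e) (∣n-n∣≡0 (φ f * n)))) z≤n
    ... | ω≤n , inj₂ sqf = ≤-trans (≤-reflexive (sym (*-distribˡ-∣-∣ (φ f) (ω n f) n)))
          (≤-trans (*-mono-≤ (φ≤1 f) (≤-trans (∣m-n∣≤m⊔n (ω n f) n) (⊔-lub ω≤n ≤-refl)))
            (≤-trans (≤-reflexive (*-comm 1 n)) (*-monoʳ-≤ n (squareFactors-positive sqf))))

  by-degree : ∀ {n} (φ : Vec Carrier n → ℕ) → ∑ (vectors n) (λ f → φ f * ω n f) ≡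
              ∑≤ n (λ l → l * ∑ (vectors l) (λ h → irr h * ∑ (vectors n) (λ f → φ f * ⟦ divides? h f ⟧)))
  by-degree {n} φ = begin
    ∑ (vectors n) (λ f → φ f * ω n f)
      ≡⟨ ∑-cong (vectors n) (λ f → sym (∑≤-*ˡ n (φ f) _)) ⟩
    ∑ (vectors n) (λ f → ∑≤ n (λ l → φ f * (l * ∑ (vectors l) (λ h → irr h * ⟦ divides? h f ⟧))))
      ≡⟨ ∑-∑≤ (vectors n) n _ ⟩
    ∑≤ n (λ l → ∑ (vectors n) (λ f → φ f * (l * ∑ (vectors l) (λ h → irr h * ⟦ divides? h f ⟧))))
      ≡⟨ ∑≤-cong n (λ l _ _ → trans (∑-cong (vectors n) (λ f → trans (*-swap (φ f) l _) (cong (l *_) (sym (∑-*ˡ (vectors l) (φ f) _)))))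
           (trans (∑-*ˡ (vectors n) l _) (cong (l *_) (trans (∑-swap (vectors n) (vectors l) _)
             (∑-cong (vectors l) (λ h → trans (∑-cong (vectors n) (λ f → *-swap (φ f) (irr h) _)) (∑-*ˡ (vectors n) (irr h) _))))))) ⟩
    ∑≤ n (λ l → l * ∑ (vectors l) (λ h → irr h * ∑ (vectors n) (λ f → φ f * ⟦ divides? h f ⟧))) ∎
    where
    open ≡-Reasoning

termConstant : ℕ → ℕ
termConstant l = l * l * (2 * (deviationConstant l + 1))

-- The inequality (a + b)² ≤ 2 (a² + b²) is applied once per degree, hence the doubling.
sumConstant : ℕ → ℕ
sumConstant zero = 0
sumConstant (suc p) = 2 * (termConstant (suc p) + sumConstant p)

-- With n = p + 1, the terms n² and p² come from the two uses of `weighted-degree`, in degrees n and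
-- p.
countConstant : ℕ → ℕ
countConstant p = 2 * ((suc p * suc p + p * p) * (suc p * suc p + p * p) + sumConstant p)

∑≤-square : ∀ p (x : ℕ → ℕ) q Y → (∀ l → 1 ≤ l → l ≤ p → x l * x l * q ≤ termConstant l * Y) →
            ∑≤ p x * ∑≤ p x * q ≤ sumConstant p * Y
∑≤-square zero x q Y b = z≤n
∑≤-square (suc p) x q Y b = begin
  (x (suc p) + R) * (x (suc p) + R) * q ≤⟨ *-monoˡ-≤ q (square-+ (x (suc p)) R) ⟩
  2 * (x (suc p) * x (suc p) + R * R) * q ≡⟨ expand (x (suc p)) R q ⟩
  2 * (x (suc p) * x (suc p) * q + R * R * q) ≤⟨ *-monoʳ-≤ 2 (+-mono-≤ (b (suc p) (s≤s z≤n) ≤-refl)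
                                                                          (∑≤-square p x q Y (λ l 1≤l l≤p → b l 1≤l (≤-trans l≤p (n≤1+n p))))) ⟩
  2 * (termConstant (suc p) * Y + sumConstant p * Y) ≡⟨ collect (termConstant (suc p)) (sumConstant p) Y ⟩
  2 * (termConstant (suc p) + sumConstant p) * Y ∎
  where
  open ≤-Reasoning
  R = ∑≤ p x
  expand : ∀ a b q → 2 * (a * a + b * b) * q ≡ 2 * (a * a * q + b * b * q)
  expand = solve-∀
  collect : ∀ a b y → 2 * (a * y + b * y) ≡ 2 * (a + b) * y
  collect = solve-∀

-- Combining the degrees into the count of irreducible polynomials.

module Counting (𝔽 : DiscreteFiniteField) where
  open FieldTheory 𝔽
  open Recurrence 𝔽
  open BilinearSums 𝔽
  open PolynomialRing 𝔽
  open MonicPolynomials 𝔽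
  open IrreducibleDivisors 𝔽

  ∑-w : ∀ n → ∑ (vectors n) w ≡ s ^ n
  ∑-w zero = refl
  ∑-w (suc n) = trans (∑-∷ finite n w) (trans (∑-cong F (λ x → ∑-*ˡ (vectors n) (sq x) w))
    (trans (∑-*ʳ F sq _) (cong (s *_) (∑-w n))))

  π : ℕ → ℕ
  π l = ∑ (vectors l) irr

  -- The number of pairs of an irreducible h of degree l and a multiple of h of degree n with square
  -- coefficients.
  T : ℕ → ℕ → ℕ
  T n l = ∑ (vectors l) (λ h → irr h * ∑ (vectors n) (λ f → w f * ⟦ divides? h f ⟧))

  irreducibleCount : ℕ → ℕ
  irreducibleCount n = ∑ (vectors n) (λ f → irr f * w f)

  divides-same : ∀ {n} {h f : Vec Carrier n} → h divides f → f ≡ h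
  divides-same {n} {h} {f} (c , e) with cofactor-monic {c} (polynomial-monic h) (polynomial-monic f) e
  ... | k , k+n≡n , mk with m+n≡n⇒m≡0 k k+n≡n
    where
    m+n≡n⇒m≡0 : ∀ m {n} → m + n ≡ n → m ≡ 0
    m+n≡n⇒m≡0 m {n} e = +-cancelʳ-≡ n m 0 e
  ... | refl = polynomial-injective (ℙ.trans (ℙ.sym e) (ℙ.trans (ℙ.*-cong (monic₀ mk) (ℙ.refl {polynomial h})) (ℙ.*-identityˡ (polynomial h))))

  T-top : ∀ n → T n n ≡ irreducibleCount n
  T-top n = ∑-cong (vectors n) (λ h → cong (irr h *_) (trans
    (∑-cong (vectors n) (λ f → trans (*-comm (w f) _) (cong (_* w f) (⟦⟧-cong (divides? h f) (Finite._≟_ (Vec-finite finite n) f h)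
      (divides-same {n} {h} {f}) (λ { refl → 1ₚ , ℙ.*-identityˡ (polynomial f) })))))
    (Finite.pick (Vec-finite finite n) w h)))

  T-bilinear : ∀ k m → T (suc k + suc m) (suc k) ≡ bilinear k m irr (λ h → ⟦⟧≤1 (irr? h))
  T-bilinear k m = trans (∑-cong (vectors (suc k)) (λ h → trans (cong (irr h *_) (∑-multiples (suc m) h w)) (sym (∑-*ˡ (vectors (suc m)) (irr h) _))))
    (∑-swap (vectors (suc k)) (vectors (suc m)) _)

  T-estimate : ∀ n l → 1 ≤ l → l < n → let e = ∣ q ^ l * T n l - s ^ n * π l ∣ in
               e * e * q ≤ 2 * (deviationConstant l + 1) * (q ^ n * q ^ l * (q ^ n * q ^ l))
  T-estimate n (suc k) (s≤s z≤n) l<n with m≤n⇒∃[o]m+o≡n l<n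
  ... | m , e with trans (sym e) (sym (+-suc (suc k) m))
  ... | refl = subst (λ t → let e = ∣ q ^ suc k * t - s ^ n * π (suc k) ∣ in
                   e * e * q ≤ 2 * (deviationConstant (suc k) + 1) * (q ^ n * q ^ suc k * (q ^ n * q ^ suc k)))
                   (sym (T-bilinear k m)) (bilinear-estimate k m irr (λ h → ⟦⟧≤1 (irr? h)))

  weighted-T : ∀ n → q * ∣ ∑≤ n (λ l → l * T n l) - n * s ^ n ∣ ≤ n * (n * q ^ n)
  weighted-T n = subst₂ (λ a b → q * ∣ a - n * b ∣ ≤ n * (n * q ^ n)) (by-degree {n} w) (∑-w n) (weighted-degree {n} w w≤1)

  -- The degree identity without weight: each `h` has q^(p-l) multiples of degree p. With p = n - 1
  -- it adds up the main terms of `T-estimate` for all l < n at once.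
  weighted-π : ∀ p → q * ∣ ∑≤ p (λ l → l * (π l * q ^ (p ∸ l))) - p * q ^ p ∣ ≤ p * (p * q ^ p)
  weighted-π p = subst₂ (λ a b → q * ∣ a - p * b ∣ ≤ p * (p * q ^ p))
    (trans (by-degree {p} (λ _ → 1)) (∑≤-cong p (λ l _ l≤p → cong (l *_) (trans (∑-cong (vectors l) (λ h → cong (irr h *_) (multiples l≤p h))) (∑-*ʳ (vectors l) irr _)))))
    (trans (∑-one (vectors p)) (vectors-size p)) (weighted-degree {p} (λ _ → 1) (λ _ → ≤-refl))
    where
    multiples : ∀ {l p} → l ≤ p → (h : Vec Carrier l) → ∑ (vectors p) (λ f → 1 * ⟦ divides? h f ⟧) ≡ q ^ (p ∸ l)
    multiples {l} l≤p h with m≤n⇒∃[o]m+o≡n l≤p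
    ... | m , refl = trans (∑-multiples m h (λ _ → 1)) (trans (∑-one (vectors m)) (trans (vectors-size m) (cong (q ^_) (sym (m+n∸m≡n l m)))))

  module _ (p : ℕ) where

    private
      n = suc p
      L = irreducibleCount n
      A = ∑≤ p (λ l → l * T n l)
      B = ∑≤ p (λ l → l * (π l * q ^ (p ∸ l)))
      P = q ^ p
      instance
        q-nonZero : NonZero q
        q-nonZero = >-nonZero 1≤q

    -- The factor q^(p-l) brings the errors of `T-estimate` for all l ≤ p to the common scale q^p.
    term : ℕ → ℕ
    term l = l * q ^ (p ∸ l) * ∣ q ^ l * T n l - s ^ n * π l ∣

    q^p-split : ∀ {l} → l ≤ p → q ^ (p ∸ l) * q ^ l ≡ P
    q^p-split {l} l≤p = trans (sym (^-distribˡ-+-* q (p ∸ l) l)) (cong (q ^_) (m∸n+n≡m l≤p))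

    term-estimate : ∀ l → 1 ≤ l → l ≤ p → term l * term l * q ≤ termConstant l * (P * q ^ n * (P * q ^ n))
    term-estimate l 1≤l l≤p = begin
      l * y * e * (l * y * e) * q ≡⟨ arith₁ l y e q ⟩
      l * l * (y * y) * (e * e * q) ≤⟨ *-monoʳ-≤ (l * l * (y * y)) (T-estimate n l 1≤l (s≤s l≤p)) ⟩
      l * l * (y * y) * (K * (q ^ n * q ^ l * (q ^ n * q ^ l))) ≡⟨ arith₂ l y K (q ^ n) (q ^ l) ⟩
      l * l * K * (y * q ^ l * q ^ n * (y * q ^ l * q ^ n)) ≡⟨ cong (λ z → l * l * K * (z * q ^ n * (z * q ^ n))) (q^p-split l≤p) ⟩
      termConstant l * (P * q ^ n * (P * q ^ n)) ∎
      where
      open ≤-Reasoning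
      y = q ^ (p ∸ l)
      e = ∣ q ^ l * T n l - s ^ n * π l ∣
      K = 2 * (deviationConstant l + 1)
      arith₁ : ∀ l y e q → l * y * e * (l * y * e) * q ≡ l * l * (y * y) * (e * e * q)
      arith₁ = solve-∀
      arith₂ : ∀ l y K a b → l * l * (y * y) * (K * (a * b * (a * b))) ≡ l * l * K * (y * b * a * (y * b * a))
      arith₂ = solve-∀

    G = ∑≤ p term

    AB : ∣ s ^ n * B - P * A ∣ ≤ G
    AB = begin
      ∣ s ^ n * B - P * A ∣
        ≡⟨ cong₂ ∣_-_∣ (sym (∑≤-*ˡ p (s ^ n) _)) (sym (∑≤-*ˡ p P _)) ⟩
      ∣ ∑≤ p (λ l → s ^ n * (l * (π l * q ^ (p ∸ l)))) - ∑≤ p (λ l → P * (l * T n l)) ∣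
        ≤⟨ ∑≤-∣-∣ p _ _ ⟩
      ∑≤ p (λ l → ∣ s ^ n * (l * (π l * q ^ (p ∸ l))) - P * (l * T n l) ∣)
        ≡⟨ ∑≤-cong p (λ l _ l≤p → trans (cong₂ ∣_-_∣ (arith₁ (s ^ n) l (π l) (q ^ (p ∸ l))) (trans (cong (_* (l * T n l)) (sym (q^p-split l≤p))) (arith₂ (q ^ (p ∸ l)) (q ^ l) l (T n l))))
             (trans (sym (*-distribˡ-∣-∣ (l * q ^ (p ∸ l)) (s ^ n * π l) (q ^ l * T n l))) (cong (l * q ^ (p ∸ l) *_) (∣-∣-comm (s ^ n * π l) (q ^ l * T n l))))) ⟩
      G ∎
      where
      open ≤-Reasoning
      arith₁ : ∀ a l b c → a * (l * (b * c)) ≡ l * c * (a * b)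
      arith₁ = solve-∀
      arith₂ : ∀ c d l t → c * d * (l * t) ≡ l * c * (d * t)
      arith₂ = solve-∀

    -- Up to the errors, A + n L = n sⁿ, P A = sⁿ B and B = p P. Hence P n L is about n P sⁿ - p P
    -- sⁿ = P sⁿ.
    scaled-error : P * ∣ n * L - s ^ n ∣ ≤ (n * n + p * p) * (P * P) + G
    scaled-error = begin
      P * ∣ n * L - s ^ n ∣ ≡⟨ *-distribˡ-∣-∣ P (n * L) (s ^ n) ⟩
      -- U is added to both sides, so that the three approximations can be chained without
      -- subtraction.
      ∣ X - Z ∣ ≡⟨ ∣m+n-m+o∣≡∣n-o∣ U X Z ⟨
      ∣ U + X - U + Z ∣ ≤⟨ ∣-∣-triangle (U + X) (n * Z) (U + Z) ⟩
      ∣ U + X - n * Z ∣ + ∣ Z + p * Z - U + Z ∣ ≤⟨ +-mono-≤ first (≤-trans (≤-reflexive (trans (cong (λ a → ∣ Z + p * Z - a ∣) (+-comm U Z)) (∣m+n-m+o∣≡∣n-o∣ Z (p * Z) U)))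
                                                         (∣-∣-triangle (p * Z) V U)) ⟩
      n * n * (P * P) + (∣ p * Z - V ∣ + ∣ V - U ∣) ≤⟨ +-monoʳ-≤ (n * n * (P * P)) (+-mono-≤ second AB) ⟩
      n * n * (P * P) + (p * p * (P * P) + G) ≡⟨ collect n p (P * P) G ⟩
      (n * n + p * p) * (P * P) + G ∎
      where
      open ≤-Reasoning
      X = P * (n * L)
      Z = P * s ^ n
      U = P * A
      V = s ^ n * B
      collect : ∀ n p x g → n * n * x + (p * p * x + g) ≡ (n * n + p * p) * x + g
      collect = solve-∀
      first : ∣ U + X - n * Z ∣ ≤ n * n * (P * P)
      first = begin
        ∣ U + X - n * Z ∣ ≡⟨ cong₂ ∣_-_∣ (trans (+-comm U X) (trans (sym (*-distribˡ-+ P (n * L) A)) (cong (λ t → P * (n * t + A)) (sym (T-top n))))) (*-swap n P (s ^ n)) ⟩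
        ∣ P * ∑≤ n (λ l → l * T n l) - P * (n * s ^ n) ∣ ≡⟨ *-distribˡ-∣-∣ P _ _ ⟨
        P * ∣ ∑≤ n (λ l → l * T n l) - n * s ^ n ∣ ≤⟨ *-monoʳ-≤ P (*-cancelˡ-≤ q (≤-trans (weighted-T n) (≤-reflexive (arith n q P)))) ⟩
        P * (n * (n * P)) ≡⟨ arith₂ n P ⟩
        n * n * (P * P) ∎
        where
        arith : ∀ n q x → n * (n * (q * x)) ≡ q * (n * (n * x))
        arith = solve-∀
        arith₂ : ∀ n x → x * (n * (n * x)) ≡ n * n * (x * x)
        arith₂ = solve-∀
      second : ∣ p * Z - V ∣ ≤ p * p * (P * P)
      second = *-cancelˡ-≤ q (begin
        q * ∣ p * Z - V ∣ ≡⟨ cong (λ t → q * ∣ t - V ∣) (arith p P (s ^ n)) ⟩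
        q * ∣ s ^ n * (p * P) - s ^ n * B ∣ ≡⟨ cong (q *_) (*-distribˡ-∣-∣ (s ^ n) (p * P) B) ⟨
        q * (s ^ n * ∣ p * P - B ∣) ≡⟨ trans (*-swap q (s ^ n) _) (cong (λ t → s ^ n * (q * t)) (∣-∣-comm (p * P) B)) ⟩
        s ^ n * (q * ∣ B - p * P ∣) ≤⟨ *-mono-≤ (^-monoˡ-≤ n s≤q) (weighted-π p) ⟩
        q ^ n * (p * (p * P)) ≡⟨ arith₂ p q P ⟩
        q * (p * p * (P * P)) ∎)
        where
        arith : ∀ p x s → p * (x * s) ≡ s * (p * x)
        arith = solve-∀
        arith₂ : ∀ p q x → q * x * (p * (p * x)) ≡ q * (p * p * (x * x))
        arith₂ = solve-∀

    irreducible-count : ∣ n * L - s ^ n ∣ * ∣ n * L - s ^ n ∣ * q ≤ countConstant p * (q ^ n * q ^ n)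
    irreducible-count = *-cancelˡ-≤ (P * P) {{m*n≢0 P P {{m^n≢0 q p}} {{m^n≢0 q p}}}} (begin
      P * P * (e * e * q) ≡⟨ arith₁ P e q ⟩
      P * e * (P * e) * q ≤⟨ *-monoˡ-≤ q (*-mono-≤ scaled-error scaled-error) ⟩
      (a + G) * (a + G) * q ≤⟨ *-monoˡ-≤ q (square-+ a G) ⟩
      2 * (a * a + G * G) * q ≡⟨ arith₂ a G q ⟩
      2 * (a * a * q + G * G * q) ≤⟨ *-monoʳ-≤ 2 (+-mono-≤ (*-monoʳ-≤ (a * a) (≤-trans (≤-reflexive (sym (*-identityʳ q))) (*-monoʳ-≤ q 1≤q)))
                                                            (∑≤-square p term q (P * q ^ n * (P * q ^ n)) term-estimate)) ⟩
      2 * (a * a * (q * q) + sumConstant p * (P * q ^ n * (P * q ^ n))) ≡⟨ arith₃ (n * n + p * p) P q (sumConstant p) ⟩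
      P * P * (countConstant p * (q ^ n * q ^ n)) ∎)
      where
      open ≤-Reasoning
      e = ∣ n * L - s ^ n ∣
      a = (n * n + p * p) * (P * P)
      arith₁ : ∀ P e q → P * P * (e * e * q) ≡ P * e * (P * e) * q
      arith₁ = solve-∀
      arith₂ : ∀ a b q → 2 * (a * a + b * b) * q ≡ 2 * (a * a * q + b * b * q)
      arith₂ = solve-∀
      arith₃ : ∀ k P q c → 2 * (k * (P * P) * (k * (P * P)) * (q * q) + c * (P * (q * P) * (P * (q * P)))) ≡ P * P * (2 * (k * k + c) * (q * P * (q * P)))
      arith₃ = solve-∀

    -- q ≤ 2 s turns the scale qⁿ into 2ⁿ sⁿ. The constant moves inside the square by c ≤ c², and
    -- the factor n is inserted to match the shape of the final bound.
    irreducible-count-squares : ∣ n * L - s ^ n ∣ ^ 2 * q ≤ (countConstant p * 2 ^ n * n * s ^ n) ^ 2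
    irreducible-count-squares = begin
      e ^ 2 * q ≡⟨ cong (_* q) (cong (e *_) (*-identityʳ e)) ⟩
      e * e * q ≤⟨ irreducible-count ⟩
      c * (q ^ n * q ^ n) ≤⟨ *-mono-≤ (c≤c*c c) (*-mono-≤ q^n≤ q^n≤) ⟩
      c * c * (2 ^ n * s ^ n * (2 ^ n * s ^ n)) ≤⟨ *-monoʳ-≤ (c * c) (*-mono-≤ (m≤n*m (2 ^ n * s ^ n) n) (m≤n*m (2 ^ n * s ^ n) n)) ⟩
      c * c * (n * (2 ^ n * s ^ n) * (n * (2 ^ n * s ^ n))) ≡⟨ arith c n (2 ^ n) (s ^ n) ⟩
      (c * 2 ^ n * n * s ^ n) ^ 2 ∎
      where
      open ≤-Reasoning
      e = ∣ n * L - s ^ n ∣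
      c = countConstant p
      c≤c*c : ∀ c → c ≤ c * c
      c≤c*c zero = z≤n
      c≤c*c (suc c) = m≤n*m (suc c) (suc c)
      q^n≤ : q ^ n ≤ 2 ^ n * s ^ n
      q^n≤ = ≤-trans (^-monoˡ-≤ n q≤2s) (≤-reflexive (*-^ 2 s n))
      arith : ∀ c n a b → c * c * (n * (a * b) * (n * (a * b))) ≡ (c * a * n * b) ^ 2
      arith c n a b = trans (arith′ c n a b) (cong (c * a * n * b *_) (sym (*-identityʳ _)))
        where
        arith′ : ∀ c n a b → c * c * (n * (a * b) * (n * (a * b))) ≡ c * a * n * b * (c * a * n * b)
        arith′ = solve-∀

-- Transfer to the fields and enumerations of the statement.

unique-once : {A : Set} (_≟_ : DecidableEquality A) {xs : List A} {a : A} → Unique xs → a ∈ xs → ∑ xs (λ x → ⟦ x ≟ a ⟧) ≡ 1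
unique-once _≟_ {x ∷ xs} {a} (x∉ ∷ u) (here refl) = cong₂ _+_ (⟦⟧-yes (a ≟ a) refl) (absent xs x∉)
  where
  absent : ∀ ys → All (a ≢_) ys → ∑ ys (λ x → ⟦ x ≟ a ⟧) ≡ 0
  absent [] [] = refl
  absent (y ∷ ys) (ne ∷ nes) = cong₂ _+_ (⟦⟧-no (y ≟ a) (ne ∘ sym)) (absent ys nes)
unique-once _≟_ {x ∷ xs} {a} (x∉ ∷ u) (there a∈) = cong₂ _+_ (⟦⟧-no (x ≟ a) (All.lookup x∉ a∈)) (unique-once _≟_ u a∈)

-- Both sides count the pairs of an element of `A` and an equal entry of `xs`.
length-enumeration : {A : Set} (FA : Finite A) (xs : List A) {P : A → Set} (P? : ∀ a → Dec (P a)) → Unique xs →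
                     (∀ a → a ∈ xs → P a) → (∀ a → P a → a ∈ xs) → length xs ≡ ∑ (Finite.elems FA) (λ a → ⟦ P? a ⟧)
length-enumeration FA xs P? u sound complete = sym (begin
  ∑ F.elems (λ a → ⟦ P? a ⟧) ≡⟨ ∑-cong F.elems occurrences ⟩
  ∑ F.elems (λ a → ∑ xs (λ x → ⟦ x F.≟ a ⟧)) ≡⟨ ∑-swap F.elems xs _ ⟩
  ∑ xs (λ x → ∑ F.elems (λ a → ⟦ x F.≟ a ⟧)) ≡⟨ ∑-cong xs F.once′ ⟩
  ∑ xs (λ _ → 1) ≡⟨ ∑-one xs ⟩
  length xs ∎)
  where
  open ≡-Reasoning
  module F = Finite FA
  vanish : ∀ {a} ys → (∀ y → y ∈ ys → y ≢ a) → ∑ ys (λ x → ⟦ x F.≟ a ⟧) ≡ 0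
  vanish [] ne = refl
  vanish {a} (y ∷ ys) ne = cong₂ _+_ (⟦⟧-no (y F.≟ a) (ne y (here refl))) (vanish ys (λ z z∈ → ne z (there z∈)))
  occurrences : ∀ a → ⟦ P? a ⟧ ≡ ∑ xs (λ x → ⟦ x F.≟ a ⟧)
  occurrences a with P? a
  ... | yes p = sym (unique-once F._≟_ u (complete a p))
  ... | no ¬p = sym (vanish xs (λ { y y∈ refl → ¬p (sound y y∈) }))

module Indexed (𝔽₀ : FiniteField) where
  module R = FiniteField 𝔽₀
  module D = Polynomials 𝔽₀
  open D.NonconstPoly using (poly; deg-1; coeffs; lead≉0)
  open R using (_≈_; 0#; 1#; order) renaming (_+_ to _+ᴿ_; _*_ to _*ᴿ_; -_ to -ᴿ_)

  el : Fin order → R.Carrier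
  el = List.lookup R.elements

  idx : R.Carrier → Fin order
  idx x = Any.index (R.complete x)

  el-idx : ∀ x → el (idx x) ≈ x
  el-idx x = R.sym (Any.lookup-index (R.complete x))

  el-injective : ∀ {i j} → el i ≈ el j → i ≡ j
  el-injective {i} {j} = go R.distinct i j
    where
    apart : ∀ {x xs} → All (λ b → ¬ (x ≈ b)) xs → ∀ j → ¬ (x ≈ List.lookup xs j)
    apart (ne ∷ _) Fin.zero = ne
    apart (_ ∷ nes) (Fin.suc j) = apart nes j
    go : ∀ {xs} → AllPairs (λ a b → ¬ (a ≈ b)) xs → ∀ i j → List.lookup xs i ≈ List.lookup xs j → i ≡ j
    go (_ ∷ _) Fin.zero Fin.zero e = refl
    go (x∉ ∷ _) Fin.zero (Fin.suc j) e = ⊥-elim (apart x∉ j e)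
    go (x∉ ∷ _) (Fin.suc i) Fin.zero e = ⊥-elim (apart x∉ i (R.sym e))
    go (_ ∷ d) (Fin.suc i) (Fin.suc j) e = cong Fin.suc (go d i j e)

  el-cong : ∀ {i j} → i ≡ j → el i ≈ el j
  el-cong refl = R.refl

  idx-cong : ∀ {x y} → x ≈ y → idx x ≡ idx y
  idx-cong e = el-injective (R.trans (el-idx _) (R.trans e (R.sym (el-idx _))))

  idx-injective : ∀ {x y} → idx x ≡ idx y → x ≈ y
  idx-injective e = R.trans (R.sym (el-idx _)) (R.trans (el-cong e) (el-idx _))

  idx-el : ∀ i → idx (el i) ≡ i
  idx-el i = el-injective (el-idx (el i))

  el≈⇒≡idx : ∀ {i x} → el i ≈ x → i ≡ idx x
  el≈⇒≡idx e = el-injective (R.trans e (R.sym (el-idx _)))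

  -- The operations go through `el` and back. The ring laws become propositional equalities because
  -- `idx` sends equal elements to the same index.
  indexed-field : DiscreteFiniteField
  indexed-field = record
    { Carrier = Fin order
    ; _⊕_ = _⊕_ ; _⊗_ = _⊗_ ; ⊖_ = λ i → idx (-ᴿ el i) ; 0F = idx 0# ; 1F = idx 1#
    ; isCommutativeRing = record
      { isRing = record
        { +-isAbelianGroup = record
          { isGroup = record
            { isMonoid = record
              { isSemigroup = record
                { isMagma = record { isEquivalence = ≡.isEquivalence ; ∙-cong = cong₂ _⊕_ }
                ; assoc = λ i j k → idx-cong (R.trans (R.+-cong (el-idx _) R.refl) (R.trans (R.+-assoc _ _ _) (R.+-cong R.refl (R.sym (el-idx _))))) }
              ; identity = (λ i → trans (idx-cong (R.trans (R.+-cong (el-idx _) R.refl) (R.+-identityˡ _))) (idx-el i))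
                         , (λ i → trans (idx-cong (R.trans (R.+-cong R.refl (el-idx _)) (R.+-identityʳ _))) (idx-el i)) }
            ; inverse = (λ i → idx-cong (R.trans (R.+-cong (el-idx _) R.refl) (R.-‿inverseˡ _)))
                      , (λ i → idx-cong (R.trans (R.+-cong R.refl (el-idx _)) (R.-‿inverseʳ _)))
            ; ⁻¹-cong = cong (λ i → idx (-ᴿ el i)) }
          ; comm = λ i j → idx-cong (R.+-comm _ _) }
        ; *-cong = cong₂ _⊗_
        ; *-assoc = λ i j k → idx-cong (R.trans (R.*-cong (el-idx _) R.refl) (R.trans (R.*-assoc _ _ _) (R.*-cong R.refl (R.sym (el-idx _)))))
        ; *-identity = (λ i → trans (idx-cong (R.trans (R.*-cong (el-idx _) R.refl) (R.*-identityˡ _))) (idx-el i))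
                     , (λ i → trans (idx-cong (R.trans (R.*-cong R.refl (el-idx _)) (R.*-identityʳ _))) (idx-el i))
        ; distrib = (λ i j k → idx-cong (R.trans (R.*-cong R.refl (el-idx _)) (R.trans (R.distribˡ _ _ _) (R.+-cong (R.sym (el-idx _)) (R.sym (el-idx _))))))
                  , (λ i j k → idx-cong (R.trans (R.*-cong (el-idx _) R.refl) (R.trans (R.distribʳ _ _ _) (R.+-cong (R.sym (el-idx _)) (R.sym (el-idx _)))))) }
      ; *-comm = λ i j → idx-cong (R.*-comm _ _) }
    ; 1≢0 = λ e → R.1≉0 (idx-injective e)
    ; inverse = λ i i≢0 → let y , xy≈1 = R.inverse (el i) (λ e → i≢0 (el≈⇒≡idx e)) in
        idx y , idx-cong (R.trans (R.*-cong R.refl (el-idx y)) xy≈1)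
    ; finite = record { elems = List.allFin order ; _≟_ = Fin._≟_ ; once = λ a → unique-once Fin._≟_ (Unique.allFin⁺ order) (∈-allFin a) }
    }
    where
    _⊕_ _⊗_ : Fin order → Fin order → Fin order
    i ⊕ j = idx (el i +ᴿ el j)
    i ⊗ j = idx (el i *ᴿ el j)

  open FieldTheory indexed-field
  open Recurrence indexed-field using (vectors)
  open BilinearSums indexed-field using (w)
  open PolynomialRing indexed-field renaming (_≈_ to _≐_)
  open MonicPolynomials indexed-field
  open IrreducibleDivisors indexed-field
  open Counting indexed-field using (irreducibleCount)

  idx-+ : ∀ x y → idx (x +ᴿ y) ≡ idx x ⊕ idx y
  idx-+ x y = idx-cong (R.+-cong (R.sym (el-idx x)) (R.sym (el-idx y)))

  idx-* : ∀ x y → idx (x *ᴿ y) ≡ idx x ⊗ idx y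
  idx-* x y = idx-cong (R.*-cong (R.sym (el-idx x)) (R.sym (el-idx y)))

  q≡order : q ≡ order
  q≡order = List.length-tabulate {n = order} (λ i → i)

  square⇒IsSq : ∀ {i} → D.IsSquare (el i) → IsSq i
  square⇒IsSq (α , e) = idx α , trans (sym (idx-* α α)) (sym (el≈⇒≡idx (R.sym e)))

  IsSq⇒square : ∀ {i} → IsSq i → D.IsSquare (el i)
  IsSq⇒square (α , e) = el α , R.trans (R.sym (el-idx _)) (el-cong e)

  length-squares : ∀ S → D.EnumSquares S → length S ≡ s
  length-squares S (distinct , member) = trans (sym (List.length-map idx S))
    (length-enumeration finite (map idx S) isSq? (AllPairs.map⁺ (AllPairs.map (λ ne e → ne (idx-injective e)) distinct))
      (λ i i∈ → square⇒IsSq (Equivalence.to (member (el i)) (Any.map (λ e → R.trans (el-cong e) (el-idx _)) (Any.map⁻ i∈))))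
      (λ i i² → Any.map⁺ (Any.map el≈⇒≡idx (Equivalence.from (member (el i)) (IsSq⇒square i²)))))

  -- The coefficient lists of Defs start with the constant term.

  series : D.Poly → Series
  series [] i = 0F
  series (a ∷ p) zero = idx a
  series (a ∷ p) (suc i) = series p i

  series-below : ∀ p → Below (length p) (series p)
  series-below [] i _ = refl
  series-below (a ∷ p) (suc i) (s≤s le) = series-below p i le

  toPol : D.Poly → Pol
  toPol p = pol (series p) (length p) (series-below p)

  series-+ : ∀ p r i → series (p D.+ₚ r) i ≡ series p i ⊕ series r i
  series-+ [] r i = sym (⊕-identityˡ _)
  series-+ (a ∷ p) [] i = sym (⊕-identityʳ _)
  series-+ (a ∷ p) (b ∷ r) zero = idx-+ a b
  series-+ (a ∷ p) (b ∷ r) (suc i) = series-+ p r i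

  series-scale : ∀ a p i → series (D.scale a p) i ≡ idx a ⊗ series p i
  series-scale a [] i = sym (⊗-zeroʳ _)
  series-scale a (b ∷ p) zero = idx-* a b
  series-scale a (b ∷ p) (suc i) = series-scale a p i

  series-* : ∀ p r i → series (p D.*ₚ r) i ≡ conv (series p) (series r) i
  series-* [] r i = sym (conv-zeroˡ (series r) (λ _ → refl) i)
  series-* (a ∷ p) r zero = trans (series-+ (D.scale a r) (0# ∷ p D.*ₚ r) 0) (trans (⊕-identityʳ _) (series-scale a r 0))
  series-* (a ∷ p) r (suc i) = trans (series-+ (D.scale a r) (0# ∷ p D.*ₚ r) (suc i)) (cong₂ _⊕_ (series-scale a r (suc i)) (series-* p r i))

  toPol-* : ∀ p r → toPol (p D.*ₚ r) ≐ toPol p *ₚ toPol r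
  toPol-* p r = coefficientwise (λ i → trans (series-* p r i) (sym (co-* (toPol p) (toPol r) i)))

  ≈ₚ⇒≐ : ∀ p r → p D.≈ₚ r → ∀ i → series p i ≡ series r i
  ≈ₚ⇒≐ [] [] e i = refl
  ≈ₚ⇒≐ [] (b ∷ r) (e , es) zero = sym (idx-cong e)
  ≈ₚ⇒≐ [] (b ∷ r) (e , es) (suc i) = ≈ₚ⇒≐ [] r es i
  ≈ₚ⇒≐ (a ∷ p) [] (e , es) zero = idx-cong e
  ≈ₚ⇒≐ (a ∷ p) [] (e , es) (suc i) = ≈ₚ⇒≐ p [] es i
  ≈ₚ⇒≐ (a ∷ p) (b ∷ r) (e , es) zero = idx-cong e
  ≈ₚ⇒≐ (a ∷ p) (b ∷ r) (e , es) (suc i) = ≈ₚ⇒≐ p r es i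

  ≐⇒≈ₚ : ∀ p r → (∀ i → series p i ≡ series r i) → p D.≈ₚ r
  ≐⇒≈ₚ [] [] e = tt
  ≐⇒≈ₚ [] (b ∷ r) e = idx-injective (sym (e 0)) , ≐⇒≈ₚ [] r (e ∘ suc)
  ≐⇒≈ₚ (a ∷ p) [] e = idx-injective (e 0) , ≐⇒≈ₚ p [] (e ∘ suc)
  ≐⇒≈ₚ (a ∷ p) (b ∷ r) e = idx-injective (e 0) , ≐⇒≈ₚ p r (e ∘ suc)

  elV : ∀ {n} → Vec (Fin order) n → Vec R.Carrier n
  elV = Vec.map el

  series-snoc : ∀ ps a i → series (ps ++ List.[ a ]) i ≡ series ps i ⊕ co (monomial (idx a) (length ps)) i
  series-snoc [] a zero = sym (⊕-identityˡ _)
  series-snoc [] a (suc i) = sym (⊕-identityˡ _)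
  series-snoc (x ∷ ps) a zero = sym (⊕-identityʳ _)
  series-snoc (x ∷ ps) a (suc i) = series-snoc ps a i

  length-reverse : ∀ {n} (v : Vec (Fin order) n) → length (List.reverse (toList (elV v))) ≡ n
  length-reverse v = trans (List.length-reverse (toList (elV v))) (Vec.length-toList (elV v))

  -- The reversal of a cons is a snoc, the shape that `charPoly` also has with leading coefficient
  -- 1, so both go through `series-snoc-reverse`.
  series-reverse : ∀ {n} (v : Vec (Fin order) n) i → series (List.reverse (toList (elV v))) i ≡ co (lower v) i
  series-snoc-reverse : ∀ {n} (v : Vec (Fin order) n) x {a} → idx x ≡ a → ∀ i →
                        series (List.reverse (toList (elV v)) ++ List.[ x ]) i ≡ co (lower (a ∷ v)) i

  series-snoc-reverse {n} v x {a} refl i = begin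
    series (List.reverse (toList (elV v)) ++ List.[ x ]) i ≡⟨ series-snoc (List.reverse (toList (elV v))) x i ⟩
    series (List.reverse (toList (elV v))) i ⊕ co (monomial a (length (List.reverse (toList (elV v))))) i ≡⟨ cong₂ (λ y k → y ⊕ co (monomial a k) i) (series-reverse v i) (length-reverse v) ⟩
    co (lower v) i ⊕ co (monomial a n) i ≡⟨ ⊕-comm _ _ ⟩
    co (monomial a n) i ⊕ co (lower v) i ≡⟨ co-+ (monomial a n) (lower v) i ⟨
    co (lower (a ∷ v)) i ∎
    where open ≡-Reasoning

  series-reverse [] i = refl
  series-reverse (a ∷ v) i = trans (cong (λ ps → series ps i) (List.unfold-reverse (el a) (toList (elV v)))) (series-snoc-reverse v (el a) (idx-el a) i)

  series-charPoly : ∀ {n} (v : Vec (Fin order) n) i → series (D.charPoly (elV v)) i ≡ co (polynomial v) i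
  series-charPoly v = series-snoc-reverse v 1# refl

  toPol-charPoly : ∀ {n} (v : Vec (Fin order) n) → toPol (D.charPoly (elV v)) ≐ polynomial v
  toPol-charPoly v = coefficientwise (series-charPoly v)

  series-last : ∀ {d} (c : Vec R.Carrier (suc d)) → series (toList c) d ≡ idx (last c)
  series-last (x ∷ []) = refl
  series-last (x ∷ y ∷ c) = series-last (y ∷ c)

  NonconstPoly-lead : ∀ (g : D.NonconstPoly) →
                      series (poly g) (suc (deg-1 g)) ≢ 0F × Below (suc (suc (deg-1 g))) (series (poly g))
  NonconstPoly-lead g = (λ e → lead≉0 g (idx-injective (trans (sym (series-last (coeffs g))) e))) ,
    subst (λ N → Below N (series (poly g))) (Vec.length-toList (coeffs g)) (series-below (poly g))

  lowVec : ∀ N → Series → Vec R.Carrier N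
  lowVec zero p = []
  lowVec (suc N) p = el (p 0) ∷ lowVec N (p ∘ suc)

  series-lowVec : ∀ N p → Below N p → ∀ i → series (toList (lowVec N p)) i ≡ p i
  series-lowVec zero p b i = sym (b i z≤n)
  series-lowVec (suc N) p b zero = idx-el (p 0)
  series-lowVec (suc N) p b (suc i) = series-lowVec N (p ∘ suc) (λ j le → b (suc j) (s≤s le)) i

  monic-NonconstPoly : ∀ {d} p → Monic (suc d) p → Σ D.NonconstPoly λ g → toPol (poly g) ≐ p
  monic-NonconstPoly {d} p (top , b) = record
    { deg-1 = d ; coeffs = c
    ; lead≉0 = λ e → 1≢0 (trans (sym top) (trans (sym (series-lowVec (suc (suc d)) (co p) b (suc d))) (trans (series-last c) (idx-cong e)))) } ,
    coefficientwise (series-lowVec (suc (suc d)) (co p) b)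
    where c = lowVec (suc (suc d)) (co p)

  Irr⇒Irreducible : ∀ {n} (v : Vec (Fin order) n) → Irr n (polynomial v) → D.Irreducible (D.charPoly (elV v))
  Irr⇒Irreducible {n} v I = nonconstant (List.reverse (toList (elV v))) (subst (1 ≤_) (sym (length-reverse v)) (Irr.positive I)) , reducible
    where
    nonconstant : ∀ ps → 1 ≤ length ps → D.Nonconstant (ps ++ List.[ 1# ])
    nonconstant (x ∷ ps) _ = Any.++⁺ʳ ps (here R.1≉0)
    reducible : ¬ (Σ D.NonconstPoly λ g → Σ D.NonconstPoly λ h → (poly g D.*ₚ poly h) D.≈ₚ D.charPoly (elV v))
    reducible (g , h , e) with normalize G g≢0 bg
      where
      G = toPol (poly g)
      g≢0 = proj₁ (NonconstPoly-lead g)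
      bg = proj₂ (NonconstPoly-lead g)
    ... | c , mG = absurd (cofactor-monic {H′} {G′} mG (polynomial-monic v) product)
      where
      open PolyReasoning
      a = suc (deg-1 g)
      b = suc (deg-1 h)
      G = toPol (poly g)
      H = toPol (poly h)
      G′ = constant c *ₚ G
      -- The leading coefficient of `G`, hence the inverse of `c`. Moving it to `H` keeps the
      -- product unchanged.
      d = co G a
      H′ = constant d *ₚ H
      dc≡1 : d ⊗ c ≡ 1F
      dc≡1 = trans (⊗-comm d c) (trans (sym (constant-* c G a)) (proj₁ mG))
      product : H′ *ₚ G′ ≐ polynomial v
      product = begin
        constant d *ₚ H *ₚ (constant c *ₚ G) ≈⟨ solveₚ 4 (λ d h c g → d ⊠ h ⊠ (c ⊠ g) ≜ (d ⊠ c) ⊠ (g ⊠ h)) ℙ.refl (constant d) H (constant c) G ⟩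
        constant d *ₚ constant c *ₚ (G *ₚ H) ≈⟨ ℙ.*-cong (ℙ.trans (monomial-scale d c 0) (ℙ.reflexive (cong constant dc≡1))) (ℙ.refl {G *ₚ H}) ⟩
        1ₚ *ₚ (G *ₚ H) ≈⟨ ℙ.*-identityˡ (G *ₚ H) ⟩
        G *ₚ H ≈⟨ toPol-* (poly g) (poly h) ⟨
        toPol (poly g D.*ₚ poly h) ≈⟨ coefficientwise (≈ₚ⇒≐ _ (D.charPoly (elV v)) e) ⟩
        toPol (D.charPoly (elV v)) ≈⟨ toPol-charPoly v ⟩
        polynomial v ∎
      absurd : ¬ (∃[ k ] k + a ≡ n × Monic k H′)
      absurd (k , _ , mH) with Irr.split I mH mG product
      ... | inj₂ ()
      -- A monic `H′` of degree 0 would have coefficient 0 at b ≥ 1, but there it is d ≠ 0 times the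
      -- leading coefficient of `h`.
      ... | inj₁ refl = ⊗≢0 (proj₁ (NonconstPoly-lead g)) (proj₁ (NonconstPoly-lead h))
              (trans (sym (constant-* d H b)) (proj₂ mH b (s≤s z≤n)))

  Irreducible⇒Irr : ∀ {n} (v : Vec (Fin order) n) → 1 ≤ n → D.Irreducible (D.charPoly (elV v)) → Irr n (polynomial v)
  Irreducible⇒Irr {n} v 1≤n (_ , ¬reducible) = irreducible-if v 1≤n improper
    where
    improper : ¬ ProperDivisor v
    improper (zero , _ , () , _)
    improper (suc a , a<n , _ , h , c , e) with cofactor-monic {c} (polynomial-monic h) (polynomial-monic v) e
    ... | zero , refl , _ = <-irrefl refl a<n
    ... | suc k , _ , mc with monic-NonconstPoly c mc | monic-NonconstPoly (polynomial h) (polynomial-monic h)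
    ... | g , eg | g′ , eg′ = ¬reducible (g , g′ , ≐⇒≈ₚ _ (D.charPoly (elV v)) (coefficients (begin
      toPol (poly g D.*ₚ poly g′) ≈⟨ toPol-* (poly g) (poly g′) ⟩
      toPol (poly g) *ₚ toPol (poly g′) ≈⟨ ℙ.*-cong eg eg′ ⟩
      c *ₚ polynomial h ≈⟨ e ⟩
      polynomial v ≈⟨ toPol-charPoly v ⟨
      toPol (D.charPoly (elV v)) ∎)))
      where open PolyReasoning

  allSq? : ∀ {n} (v : Vec (Fin order) n) → Dec (VAll.All IsSq v)
  allSq? = VAll.all? isSq?

  w≡allSq : ∀ {n} (v : Vec (Fin order) n) → w v ≡ ⟦ allSq? v ⟧
  w≡allSq [] = refl
  w≡allSq (x ∷ v) = trans (cong (sq x *_) (w≡allSq v)) (sym (trans (⟦⟧-cong (allSq? (x ∷ v)) (isSq? x ×-dec allSq? v)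
    (λ { (p VAll.∷ ps) → p , ps }) (λ { (p , ps) → p VAll.∷ ps })) (⟦⟧-× (isSq? x) (allSq? v) (isSq? x ×-dec allSq? v))))

  Pointwise⇒≡ : ∀ {n} {v : Vec (Fin order) n} {u} → Pointwise _≈_ (elV v) u → v ≡ Vec.map idx u
  Pointwise⇒≡ {v = []} {[]} [] = refl
  Pointwise⇒≡ {v = _ ∷ _} {_ ∷ _} (e ∷ es) = cong₂ _∷_ (el≈⇒≡idx e) (Pointwise⇒≡ es)

  ≡⇒Pointwise : ∀ {n} (u : Vec R.Carrier n) → Pointwise _≈_ (elV (Vec.map idx u)) u
  ≡⇒Pointwise [] = []
  ≡⇒Pointwise (x ∷ u) = el-idx x ∷ ≡⇒Pointwise u

  idxV-injective : ∀ {n} (u u′ : Vec R.Carrier n) → Vec.map idx u ≡ Vec.map idx u′ → Pointwise _≈_ u u′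
  idxV-injective [] [] e = []
  idxV-injective (x ∷ u) (y ∷ u′) e = idx-injective (∷-injˡ e) ∷ idxV-injective u u′ (∷-injʳ e)

  length-irreducibles : ∀ {n} → 1 ≤ n → ∀ L → D.EnumIrreducible n L → length L ≡ irreducibleCount n
  length-irreducibles {n} 1≤n L (distinct , member) = begin
    length L ≡⟨ List.length-map (Vec.map idx) L ⟨
    length (map (Vec.map idx) L) ≡⟨ length-enumeration (Vec-finite finite n) (map (Vec.map idx) L) (λ v → irr? v ×-dec allSq? v)
                                                           (AllPairs.map⁺ (AllPairs.map (λ ne e → ne (idxV-injective _ _ e)) distinct)) sound complete ⟩
    ∑ (vectors n) (λ v → ⟦ irr? v ×-dec allSq? v ⟧) ≡⟨ ∑-cong (vectors n) (λ v → trans (⟦⟧-× (irr? v) (allSq? v) (irr? v ×-dec allSq? v)) (cong (irr v *_) (sym (w≡allSq v)))) ⟩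
    irreducibleCount n ∎
    where
    open ≡-Reasoning
    squares : ∀ {m} {v : Vec (Fin order) m} → VAll.All D.IsSquare (elV v) → VAll.All IsSq v
    squares {v = []} VAll.[] = VAll.[]
    squares {v = _ ∷ _} (p VAll.∷ ps) = square⇒IsSq p VAll.∷ squares ps
    squares⁻ : ∀ {m} {v : Vec (Fin order) m} → VAll.All IsSq v → VAll.All D.IsSquare (elV v)
    squares⁻ VAll.[] = VAll.[]
    squares⁻ (p VAll.∷ ps) = IsSq⇒square p VAll.∷ squares⁻ ps
    sound : ∀ v → v ∈ map (Vec.map idx) L → Irr n (polynomial v) × VAll.All IsSq v
    sound v v∈ with Equivalence.to (member (elV v)) (Any.map (λ { refl → ≡⇒Pointwise _ }) (Any.map⁻ v∈))
    ... | sqs , I = Irreducible⇒Irr v 1≤n I , squares sqs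
    complete : ∀ v → Irr n (polynomial v) × VAll.All IsSq v → v ∈ map (Vec.map idx) L
    complete v (I , sqs) = Any.map⁺ (Any.map Pointwise⇒≡ (Equivalence.from (member (elV v)) (squares⁻ sqs , Irr⇒Irreducible v I)))

theorem1p1 : ∀ (n : ℕ) → 1 ≤ n →
    ∃[ C ] ∃[ q₀ ] ∀ (F : FiniteField) → q₀ ≤ FiniteField.order F →
    ∀ (S : List (FiniteField.Carrier F)) → Polynomials.EnumSquares F S →
    ∀ (L : List (Vec (FiniteField.Carrier F) n)) → Polynomials.EnumIrreducible F n L →
    ∣ n * length L - length S ^ n ∣ ^ 2 * FiniteField.order F
    ≤ (C * n * length S ^ n) ^ 2
-- `countConstant p` is relative to qⁿ, and 2ⁿ comes from q ≤ 2 s. The estimate holds for every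
-- order, so the threshold is 0.
theorem1p1 (suc p) 1≤n = countConstant p * 2 ^ suc p , 0 , λ 𝔽 _ S enumS L enumL →
  let open Indexed 𝔽 in
  subst₂ (λ a b → ∣ suc p * a - b ^ suc p ∣ ^ 2 * R.order ≤ (countConstant p * 2 ^ suc p * suc p * b ^ suc p) ^ 2)
    (sym (length-irreducibles 1≤n L enumL)) (sym (length-squares S enumS))
    (subst (λ k → ∣ suc p * Counting.irreducibleCount indexed-field (suc p) - FieldTheory.s indexed-field ^ suc p ∣ ^ 2 * k
                  ≤ (countConstant p * 2 ^ suc p * suc p * FieldTheory.s indexed-field ^ suc p) ^ 2)
      q≡order (Counting.irreducible-count-squares indexed-field p))
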